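{- Let $K$ be a finite $k$-dimensional simplicial complex with $k\ge1$, and let $D$ be the maximum upper degree of a ridge of $K$. Suppose that $\Gamma(K)$ is connected and that $K$ is disorientable in dimension $k$. Then $\lambda_1(L^{\mathrm{up}}_{k-1}(K))=D+k$ if and only if all $k$-faces of $K$ contain one common ridge.
   Context: A simplicial complex $K$ on a finite vertex set is a collection of subsets closed under taking subsets; a face with $m+1$ vertices has dimension $m$, and $K_j$ is the set of $j$-dimensional faces; $K$ is $k$-dimensional if $k$ is the largest dimension of a face. The $k$-faces are called facets and the $(k-1)$-faces ridges. The upper degree of a ridge $\rho$ is $d(\rho)=|\{F\in K_k:\rho\subset F\}|$. Choose an orientation (an ordering of the vertices, up to even permutations) of each face. The boundary matrix $B_k=([\sigma:F])_{\sigma\in K_{k-1},F\in K_k}$ has $[\sigma:F]=0$ if $\sigma\not\subset F$, and if $F=[v_0,\dots,v_k]$ and $\sigma=F\setminus\{v_i\}$ then $[\sigma:F]=(-1)^i\operatorname{sgn}(\pi)$, where $\pi$ is the permutation carrying $(v_0,\dots,\widehat{v_i},\dots,v_k)$ to the chosen ordering of $\sigma$. The up-Laplacian is $L^{\mathrm{up}}_{k-1}(K)=B_kB_k^{\mathsf T}$, and $\lambda_1$ denotes the largest eigenvalue. Two distinct facets are adjacent if they share a ridge; $\Gamma(K)$ is the graph on $K_k$ with these adjacencies. $K$ is disorientable in dimension $k$ if the $k$-simplices can be oriented so that any two adjacent $k$-simplices $F,G$ induce the same incidence sign on their common ridge $R$, i.e. $[R:F]=[R:G]$. -}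

module Defs where

open import Algebra.Bundles using (CommutativeMonoid)
open import Algebra.Bundles.Raw using (RawMonoid)
import Algebra.Definitions.RawMonoid as Summation
import Algebra.Properties.CommutativeSemigroup as CommutativeSemigroupProperties
open import Data.Bool.Properties using () renaming (_≟_ to _≟ᵇ_)
open import Data.Fin.Base using (Fin; toℕ; punchIn; punchOut)
open import Data.Fin.Permutation using (Permutation′; _⟨$⟩ʳ_)
import Data.Fin.Properties as Fin
open import Data.Fin.Subset
  using (Subset; inside; outside; _∈_; _∉_; _⊆_; _-_; _─_; ⁅_⁆; ∣_∣)
open import Data.Fin.Subset.Properties
  using (_⊆?_; p─q⊆p; x∈p∧x≢y⇒x∈p-y; x∈⁅x⁆)
open import Data.Integer.Base as ℤ using (ℤ; 0ℤ; -1ℤ)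
open import Data.List.Base
  using (List; []; _∷_; map; _++_; filter; length; lookup; allFin; cartesianProduct)
open import Data.List.Extrema.Nat using (max)
open import Data.Nat.Base as ℕ using (ℕ; suc)
import Data.Nat.Properties as ℕ
open import Data.Product.Base using (∃; _×_; _,_; proj₁; proj₂)
open import Data.Rational.Base as ℚ using (ℚ; 0ℚ; 1ℚ; ½)
import Data.Rational.Properties as ℚ
import Data.Vec.Base as Vec
open import Data.Vec.Properties using (≡-dec)
open import Data.Vec.Properties.WithK using ([]=-irrelevant)
open import Function.Base using (_∘_)
open import Function.Bundles using (_↔_; Inverse; mk↔ₛ′)
open import Function.Construct.Composition using (_↔-∘_)
open import Function.Construct.Symmetry using (↔-sym)
open import Level using (0ℓ)
open import Relation.Binary.Construct.Closure.ReflexiveTransitive using (Star)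
open import Relation.Binary.Definitions using (DecidableEquality; Universal)
open import Relation.Binary.PropositionalEquality
  using (_≡_; _≢_; refl; sym; trans; cong; cong₂; subst)
open import Relation.Nullary using (yes; no; ¬_)
open import Relation.Nullary.Decidable using (_×-dec_)
open import Relation.Unary using (Pred; Decidable)

------------------------------------------------------------------------
-- Real numbers: Cauchy sequences of rationals, up to _≈ℝ_

IsCauchy : (ℕ → ℚ) → Set
IsCauchy x = ∀ ε → 0ℚ ℚ.< ε →
  ∃ λ N → ∀ m n → N ℕ.≤ m → N ℕ.≤ n → ℚ.∣ x m ℚ.- x n ∣ ℚ.< ε

record ℝ : Set where
  constructor mkℝ
  field
    seq    : ℕ → ℚ
    cauchy : IsCauchy seq

open ℝ public

infix  4 _≈ℝ_ _≤ℝ_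
infixl 6 _+ℝ_
infixl 7 _*ℝ_

_≈ℝ_ : ℝ → ℝ → Set
x ≈ℝ y = ∀ ε → 0ℚ ℚ.< ε →
  ∃ λ N → ∀ n → N ℕ.≤ n → ℚ.∣ seq x n ℚ.- seq y n ∣ ℚ.< ε

_≤ℝ_ : ℝ → ℝ → Set
x ≤ℝ y = ∀ ε → 0ℚ ℚ.< ε →
  ∃ λ N → ∀ n → N ℕ.≤ n → seq x n ℚ.≤ seq y n ℚ.+ ε

fromℚ : ℚ → ℝ
fromℚ q = mkℝ (λ _ → q) λ ε ε>0 → 0 , λ _ _ _ _ →
  subst (λ r → ℚ.∣ r ∣ ℚ.< ε) (sym (ℚ.+-inverseʳ q)) ε>0

fromℤ : ℤ → ℝ
fromℤ i = fromℚ (i ℚ./ 1)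

0ℝ : ℝ
0ℝ = fromℚ 0ℚ

private
  open CommutativeSemigroupProperties
    (CommutativeMonoid.commutativeSemigroup ℚ.+-0-commutativeMonoid) using (interchange)

  half>0 : ∀ {ε} → 0ℚ ℚ.< ε → 0ℚ ℚ.< ½ ℚ.* ε
  half>0 {ε} ε>0 = ℚ.positive⁻¹ (½ ℚ.* ε) {{ℚ.pos*pos⇒pos ½ ε {{ℚ.positive ε>0}}}}

  half+half : ∀ ε → ½ ℚ.* ε ℚ.+ ½ ℚ.* ε ≡ ε
  half+half ε = trans (sym (ℚ.*-distribʳ-+ ε ½ ½)) (ℚ.*-identityˡ ε)

  *-distribˡ-- : ∀ a b c → a ℚ.* (b ℚ.- c) ≡ a ℚ.* b ℚ.- a ℚ.* c
  *-distribˡ-- a b c = trans (ℚ.*-distribˡ-+ a b (ℚ.- c))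
    (cong (a ℚ.* b ℚ.+_) (sym (ℚ.neg-distribʳ-* a c)))

  swap-+- : ∀ a b c d → (a ℚ.+ b) ℚ.- (c ℚ.+ d) ≡ (a ℚ.- c) ℚ.+ (b ℚ.- d)
  swap-+- a b c d = trans (cong ((a ℚ.+ b) ℚ.+_) (ℚ.neg-distrib-+ c d))
    (interchange a b (ℚ.- c) (ℚ.- d))

  recentre : ∀ a b → a ≡ b ℚ.+ (a ℚ.- b)
  recentre a b = sym (trans (ℚ.+-comm b (a ℚ.- b)) (trans (ℚ.+-assoc a (ℚ.- b) b)
    (trans (cong (a ℚ.+_) (ℚ.+-inverseˡ b)) (ℚ.+-identityʳ a))))

  split-- : ∀ a b c → a ℚ.- c ≡ (a ℚ.- b) ℚ.+ (b ℚ.- c)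
  split-- a b c = trans
    (cong (ℚ._- c) (trans (recentre a b) (ℚ.+-comm b (a ℚ.- b))))
    (ℚ.+-assoc (a ℚ.- b) b (ℚ.- c))

  split-* : ∀ a b c d → a ℚ.* b ℚ.- c ℚ.* d ≡ a ℚ.* (b ℚ.- d) ℚ.+ d ℚ.* (a ℚ.- c)
  split-* a b c d = trans (split-- (a ℚ.* b) (a ℚ.* d) (c ℚ.* d)) (cong₂ ℚ._+_
    (sym (*-distribˡ-- a b d))
    (sym (trans (*-distribˡ-- d a c) (cong₂ ℚ._-_ (ℚ.*-comm d a) (ℚ.*-comm d c)))))

  bounded : ∀ x → IsCauchy x →
    ∃ λ N → ∃ λ b → 0ℚ ℚ.< b × (∀ n → N ℕ.≤ n → ℚ.∣ x n ∣ ℚ.< b)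
  bounded x x-cauchy with x-cauchy 1ℚ (ℚ.positive⁻¹ 1ℚ)
  ... | N , close =
    N , b , ℚ.<-respˡ-≡ (ℚ.+-identityˡ 0ℚ) (ℚ.+-mono-≤-< (ℚ.0≤∣p∣ (x N)) (ℚ.positive⁻¹ 1ℚ)) , bound
    where
    b = ℚ.∣ x N ∣ ℚ.+ 1ℚ
    bound : ∀ n → N ℕ.≤ n → ℚ.∣ x n ∣ ℚ.< b
    bound n N≤n = begin-strict
      ℚ.∣ x n ∣                       ≡⟨ cong ℚ.∣_∣ (recentre (x n) (x N)) ⟩
      ℚ.∣ x N ℚ.+ (x n ℚ.- x N) ∣     ≤⟨ ℚ.∣p+q∣≤∣p∣+∣q∣ (x N) (x n ℚ.- x N) ⟩
      ℚ.∣ x N ∣ ℚ.+ ℚ.∣ x n ℚ.- x N ∣ <⟨ ℚ.+-monoʳ-< ℚ.∣ x N ∣ (close n N N≤n ℕ.≤-refl) ⟩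
      b                               ∎
      where open ℚ.≤-Reasoning

  shrink : ∀ b e → 0ℚ ℚ.< b → 0ℚ ℚ.< e → ∃ λ δ → 0ℚ ℚ.< δ ×
    (∀ a c → ℚ.∣ a ∣ ℚ.< b → ℚ.∣ c ∣ ℚ.< δ → ℚ.∣ a ℚ.* c ∣ ℚ.< e)
  shrink b e b>0 e>0 = δ , δ>0 , small
    where
    open ℚ.≤-Reasoning
    instance
      b-pos : ℚ.Positive b
      b-pos = ℚ.positive b>0
      b-nz : ℚ.NonZero b
      b-nz = ℚ.pos⇒nonZero b

    δ = ℚ.1/ b ℚ.* e

    δ>0 : 0ℚ ℚ.< δ
    δ>0 = ℚ.positive⁻¹ δ {{ℚ.pos*pos⇒pos (ℚ.1/ b) {{ℚ.1/pos⇒pos b}} e {{ℚ.positive e>0}}}}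

    small : ∀ a c → ℚ.∣ a ∣ ℚ.< b → ℚ.∣ c ∣ ℚ.< δ → ℚ.∣ a ℚ.* c ∣ ℚ.< e
    small a c a<b c<δ = begin-strict
      ℚ.∣ a ℚ.* c ∣          ≡⟨ ℚ.∣p*q∣≡∣p∣*∣q∣ a c ⟩
      ℚ.∣ a ∣ ℚ.* ℚ.∣ c ∣    ≤⟨ ℚ.*-monoʳ-≤-nonNeg ℚ.∣ c ∣ {{ℚ.nonNegative (ℚ.0≤∣p∣ c)}} (ℚ.<⇒≤ a<b) ⟩
      b ℚ.* ℚ.∣ c ∣          <⟨ ℚ.*-monoʳ-<-pos b c<δ ⟩
      b ℚ.* (ℚ.1/ b ℚ.* e)   ≡⟨ ℚ.*-assoc b (ℚ.1/ b) e ⟨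
      b ℚ.* ℚ.1/ b ℚ.* e     ≡⟨ cong (ℚ._* e) (ℚ.*-inverseʳ b) ⟩
      1ℚ ℚ.* e               ≡⟨ ℚ.*-identityˡ e ⟩
      e                      ∎

  add-small : ∀ p q {ε} → ℚ.∣ p ∣ ℚ.< ½ ℚ.* ε → ℚ.∣ q ∣ ℚ.< ½ ℚ.* ε → ℚ.∣ p ℚ.+ q ∣ ℚ.< ε
  add-small p q {ε} p< q< = begin-strict
    ℚ.∣ p ℚ.+ q ∣          ≤⟨ ℚ.∣p+q∣≤∣p∣+∣q∣ p q ⟩
    ℚ.∣ p ∣ ℚ.+ ℚ.∣ q ∣    <⟨ ℚ.+-mono-< p< q< ⟩
    ½ ℚ.* ε ℚ.+ ½ ℚ.* ε    ≡⟨ half+half ε ⟩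
    ε                      ∎
    where open ℚ.≤-Reasoning

  +-cauchy : ∀ x y → IsCauchy x → IsCauchy y → IsCauchy (λ n → x n ℚ.+ y n)
  +-cauchy x y x-cauchy y-cauchy ε ε>0
    with x-cauchy (½ ℚ.* ε) (half>0 ε>0) | y-cauchy (½ ℚ.* ε) (half>0 ε>0)
  ... | M , x-close | N , y-close = M ℕ.⊔ N , λ m n m≥ n≥ →
    subst (λ r → ℚ.∣ r ∣ ℚ.< ε) (sym (swap-+- (x m) (y m) (x n) (y n)))
      (add-small (x m ℚ.- x n) (y m ℚ.- y n)
        (x-close m n (ℕ.m⊔n≤o⇒m≤o M N m≥) (ℕ.m⊔n≤o⇒m≤o M N n≥))
        (y-close m n (ℕ.m⊔n≤o⇒n≤o M N m≥) (ℕ.m⊔n≤o⇒n≤o M N n≥)))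

  *-cauchy : ∀ x y → IsCauchy x → IsCauchy y → IsCauchy (λ n → x n ℚ.* y n)
  *-cauchy x y x-cauchy y-cauchy ε ε>0 =
    let
      (Nx , bx , bx>0 , x-bound) = bounded x x-cauchy
      (Ny , by , by>0 , y-bound) = bounded y y-cauchy
      (δy , δy>0 , small-y) = shrink bx (½ ℚ.* ε) bx>0 (half>0 ε>0)
      (δx , δx>0 , small-x) = shrink by (½ ℚ.* ε) by>0 (half>0 ε>0)
      (M , x-close) = x-cauchy δx δx>0
      (N , y-close) = y-cauchy δy δy>0
      ≥bounds : ∀ {m} → (Nx ℕ.⊔ Ny) ℕ.⊔ (M ℕ.⊔ N) ℕ.≤ m → Nx ℕ.⊔ Ny ℕ.≤ m
      ≥bounds = ℕ.m⊔n≤o⇒m≤o (Nx ℕ.⊔ Ny) (M ℕ.⊔ N)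
      ≥close : ∀ {m} → (Nx ℕ.⊔ Ny) ℕ.⊔ (M ℕ.⊔ N) ℕ.≤ m → M ℕ.⊔ N ℕ.≤ m
      ≥close = ℕ.m⊔n≤o⇒n≤o (Nx ℕ.⊔ Ny) (M ℕ.⊔ N)
    in
    (Nx ℕ.⊔ Ny) ℕ.⊔ (M ℕ.⊔ N) , λ m n m≥ n≥ →
    subst (λ r → ℚ.∣ r ∣ ℚ.< ε) (sym (split-* (x m) (y m) (x n) (y n)))
      (add-small (x m ℚ.* (y m ℚ.- y n)) (y n ℚ.* (x m ℚ.- x n))
        (small-y (x m) (y m ℚ.- y n) (x-bound m (ℕ.m⊔n≤o⇒m≤o Nx Ny (≥bounds m≥)))
          (y-close m n (ℕ.m⊔n≤o⇒n≤o M N (≥close m≥)) (ℕ.m⊔n≤o⇒n≤o M N (≥close n≥))))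
        (small-x (y n) (x m ℚ.- x n) (y-bound n (ℕ.m⊔n≤o⇒n≤o Nx Ny (≥bounds n≥)))
          (x-close m n (ℕ.m⊔n≤o⇒m≤o M N (≥close m≥)) (ℕ.m⊔n≤o⇒m≤o M N (≥close n≥)))))

_+ℝ_ : ℝ → ℝ → ℝ
x +ℝ y = mkℝ (λ n → seq x n ℚ.+ seq y n) (+-cauchy (seq x) (seq y) (cauchy x) (cauchy y))

_*ℝ_ : ℝ → ℝ → ℝ
x *ℝ y = mkℝ (λ n → seq x n ℚ.* seq y n) (*-cauchy (seq x) (seq y) (cauchy x) (cauchy y))

+ℝ-rawMonoid : RawMonoid 0ℓ 0ℓ
+ℝ-rawMonoid = record { Carrier = ℝ ; _≈_ = _≈ℝ_ ; _∙_ = _+ℝ_ ; ε = 0ℝ }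

open Summation +ℝ-rawMonoid public using () renaming (sum to ∑ℝ)
open Summation ℤ.+-0-rawMonoid public using () renaming (sum to ∑ℤ)

------------------------------------------------------------------------
-- Eigenvalues

Matrix : Set → ℕ → ℕ → Set
Matrix A r c = Fin r → Fin c → A

IsEigenvalue : ∀ {r} → Matrix ℝ r r → ℝ → Set
IsEigenvalue {r} A λ₀ = ∃ λ (v : Fin r → ℝ) →
  ¬ (∀ i → v i ≈ℝ 0ℝ) × (∀ i → ∑ℝ (λ j → A i j *ℝ v j) ≈ℝ λ₀ *ℝ v i)

IsLargestEigenvalue : ∀ {r} → Matrix ℝ r r → ℝ → Set
IsLargestEigenvalue A λ₀ = IsEigenvalue A λ₀ × (∀ μ → IsEigenvalue A μ → μ ≤ℝ λ₀)

------------------------------------------------------------------------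
-- Simplicial complexes

-- Face is decidable because the complex is a finite object. Not every
-- vertex need be a face.
record SimplicialComplex (n : ℕ) : Set₁ where
  field
    Face   : Pred (Subset n) 0ℓ
    face?  : Decidable Face
    closed : ∀ {σ τ} → τ ⊆ σ → Face σ → Face τ

allSubsets : ∀ n → List (Subset n)
allSubsets ℕ.zero  = Vec.[] ∷ []
allSubsets (suc n) = map (outside Vec.∷_) (allSubsets n) ++ map (inside Vec.∷_) (allSubsets n)

_≟ˢ_ : ∀ {n} → DecidableEquality (Subset n)
_≟ˢ_ = ≡-dec _≟ᵇ_

module _ {n : ℕ} (K : SimplicialComplex n) where
  open SimplicialComplex K

  -- Faces are graded by their number s of vertices, so `faces s` lists the
  -- (s-1)-dimensional faces, each exactly once; `faceCount s` is their
  -- number and matrices and orientations are indexed by `Fin (faceCount s)`.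
  faces : ℕ → List (Subset n)
  faces s = filter (λ σ → face? σ ×-dec (∣ σ ∣ ℕ.≟ s)) (allSubsets n)

  faceCount : ℕ → ℕ
  faceCount s = length (faces s)

  face : ∀ s → Fin (faceCount s) → Subset n
  face s = lookup (faces s)

  HasDimension : ℕ → Set
  HasDimension k = (∃ λ σ → Face σ × ∣ σ ∣ ≡ suc k) × (∀ σ → Face σ → ∣ σ ∣ ℕ.≤ suc k)

  module _ (k : ℕ) where

    Ridge Facet : Set
    Ridge = Fin (faceCount k)
    Facet = Fin (faceCount (suc k))

    ridge : Ridge → Subset n
    ridge = face k

    facet : Facet → Subset n
    facet = face (suc k)

    upperDegree : Subset n → ℕ
    upperDegree ρ = length (filter (ρ ⊆?_) (faces (suc k)))

    maxUpperDegree : ℕ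
    maxUpperDegree = max 0 (map upperDegree (faces k))

    Adjacent : Facet → Facet → Set
    Adjacent F G = F ≢ G × ∃ λ (R : Ridge) → ridge R ⊆ facet F × ridge R ⊆ facet G

    ΓConnected : Set
    ΓConnected = Universal (Star Adjacent)

    CommonRidge : Set
    CommonRidge = ∃ λ (R : Ridge) → ∀ (F : Facet) → ridge R ⊆ facet F

------------------------------------------------------------------------
-- Orderings, orientations and incidence signs

-- An orientation class is given by any one of the orderings in it.
VertexOrdering : ∀ {n} → ℕ → Subset n → Set
VertexOrdering s σ = Fin s ↔ ∃ (_∈ σ)

module _ {n : ℕ} where

  vertex : ∀ {s} {σ : Subset n} → VertexOrdering s σ → Fin s → Fin n
  vertex o i = proj₁ (Inverse.to o i)

  private
    ∈─⇒∉ : ∀ {m} {x : Fin m} (p q : Subset m) → x ∈ p ─ q → x ∉ q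
    ∈─⇒∉ (_ Vec.∷ p) (outside Vec.∷ q) (Vec.there x∈) (Vec.there x∈q) = ∈─⇒∉ p q x∈ x∈q
    ∈─⇒∉ (_ Vec.∷ p) (inside  Vec.∷ q) (Vec.there x∈) (Vec.there x∈q) = ∈─⇒∉ p q x∈ x∈q

    ≡-∃∈ : ∀ {σ : Subset n} {x y : ∃ (_∈ σ)} → proj₁ x ≡ proj₁ y → x ≡ y
    ≡-∃∈ {x = v , p} {y = .v , q} refl = cong (v ,_) ([]=-irrelevant p q)

    vertex-injective : ∀ {s} {σ : Subset n} (o : VertexOrdering s σ) {i j} →
      vertex o i ≡ vertex o j → i ≡ j
    vertex-injective o {i} {j} eq =
      trans (sym (Inverse.strictlyInverseʳ o i))
        (trans (cong (Inverse.from o) (≡-∃∈ eq)) (Inverse.strictlyInverseʳ o j))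

  -- (v₀,…,v_s) ↦ (v₀,…,v̂ᵢ,…,v_s)
  delete : ∀ {s} {F : Subset n} (o : VertexOrdering (suc s) F) (i : Fin (suc s)) →
    VertexOrdering s (F - vertex o i)
  delete {s} {F} o i = mk↔ₛ′ to from to∘from from∘to
    where
    vᵢ = vertex o i

    to : Fin s → ∃ (_∈ F - vᵢ)
    to j = vertex o (punchIn i j) ,
      x∈p∧x≢y⇒x∈p-y (proj₂ (Inverse.to o (punchIn i j)))
        (Fin.punchInᵢ≢i i j ∘ vertex-injective o)

    position : ∃ (_∈ F - vᵢ) → Fin (suc s)
    position (x , x∈) = Inverse.from o (x , p─q⊆p F ⁅ vᵢ ⁆ x∈)

    vertex-position : ∀ x → vertex o (position x) ≡ proj₁ x
    vertex-position _ = cong proj₁ (Inverse.strictlyInverseˡ o _)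

    i≢position : ∀ x → i ≢ position x
    i≢position x@(v , v∈) eq = ∈─⇒∉ F ⁅ vᵢ ⁆ v∈
      (subst (_∈ ⁅ vᵢ ⁆) (trans (cong (vertex o) eq) (vertex-position x)) (x∈⁅x⁆ vᵢ))

    from : ∃ (_∈ F - vᵢ) → Fin s
    from x = punchOut (i≢position x)

    to∘from : ∀ x → to (from x) ≡ x
    to∘from x = ≡-∃∈
      (trans (cong (vertex o) (Fin.punchIn-punchOut (i≢position x))) (vertex-position x))

    from∘to : ∀ j → from (to j) ≡ j
    from∘to j = trans
      (Fin.punchOut-cong i (vertex-injective o (vertex-position (to j))))
      (Fin.punchOut-punchIn i)

-- The permutation π with w = u ∘ π.
carrying : ∀ {n s} {σ : Subset n} → VertexOrdering s σ → VertexOrdering s σ → Permutation′ s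
carrying u w = ↔-sym u ↔-∘ w

inversions : ∀ {s} → Permutation′ s → ℕ
inversions {s} π = length (filter
  (λ (i , j) → (i Fin.<? j) ×-dec (π ⟨$⟩ʳ j Fin.<? π ⟨$⟩ʳ i))
  (cartesianProduct (allFin s) (allFin s)))

sgn : ∀ {s} → Permutation′ s → ℤ
sgn π = -1ℤ ℤ.^ inversions π

-- [σ:F]
incidence : ∀ {n s} {σ F : Subset n} → VertexOrdering s σ → VertexOrdering (suc s) F → ℤ
incidence {σ = σ} {F = F} oσ oF with Fin.any? (λ i → σ ≟ˢ (F - vertex oF i))
... | yes (i , refl) = -1ℤ ℤ.^ toℕ i ℤ.* sgn (carrying (delete oF i) oσ)
... | no _           = 0ℤ

module _ {n : ℕ} (K : SimplicialComplex n) where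

  Orientation : Set
  Orientation = ∀ s (i : Fin (faceCount K s)) → VertexOrdering s (face K s i)

  module _ (o : Orientation) (k : ℕ) where

    -- B_k, for k ≥ 1
    boundary : Matrix ℤ (faceCount K k) (faceCount K (suc k))
    boundary R F = incidence (o k R) (o (suc k) F)

    -- L^up_{k-1} = B_k B_kᵀ
    upLaplacian : Matrix ℤ (faceCount K k) (faceCount K k)
    upLaplacian R S = ∑ℤ (λ F → boundary R F ℤ.* boundary S F)

    upLaplacianℝ : Matrix ℝ (faceCount K k) (faceCount K k)
    upLaplacianℝ R S = fromℤ (upLaplacian R S)

  -- The orientation of the ridges is immaterial: reversing a ridge changes
  -- both of the compared signs.
  Disorientable : ℕ → Set
  Disorientable k = ∃ λ (o : Orientation) →
    ∀ (F G : Facet K k) (R : Ridge K k) → F ≢ G →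
    ridge K k R ⊆ facet K k F → ridge K k R ⊆ facet K k G →
    boundary o k R F ≡ boundary o k R G

{-# OPTIONS --safe #-}

-- Rescaling the columns of B = B_k by the signs that turn the orientation o
-- into a disorientation gives a matrix C with C Cᵀ = B Bᵀ such that A = Cᵀ C is
-- the nonnegative matrix counting the ridges common to two facets: k + 1 on the
-- diagonal, 1 for adjacent facets and 0 otherwise. C and Cᵀ carry eigenvectors of
-- one product to eigenvectors of the other.
--
-- If all facets share a ridge then A = k I + J has constant row sums D + k, so
-- D + k is an eigenvalue, and it bounds all others by comparing 1-norms.
--
-- Otherwise let R₀ be a ridge of degree D. The indicator x of the facets
-- containing R₀ satisfies A x ≥ (D + k) x, strictly at some facet adjacent to
-- one containing R₀. As Γ(K) is connected, some power T of A is positive, and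
-- A T x ≥ (D + k + δ) T x with δ > 0. Power iteration with T, under which the
-- ratios (A p)_F / p_F contract geometrically, constructs the Perron eigenvector
-- as a vector of Cauchy sequences; its eigenvalue is at least D + k + δ.

module Submission where

open import Algebra.Bundles using (CommutativeRing; Semiring)
open import Data.Bool.Base using (true; false; if_then_else_)
open import Data.Fin.Base using (Fin; zero; suc; toℕ; punchIn)
open import Data.Fin.Permutation using (Permutation′; _⟨$⟩ʳ_)
import Data.Fin.Properties as Finₚ
open import Data.Integer.Base as ℤ using (ℤ; -[1+_])
import Data.Integer.Properties as ℤₚ
open import Data.Integer.Tactic.RingSolver using () renaming (solve-∀ to ℤ-solve-∀)
open import Data.List.Base as List using (List; []; _∷_)
open import Data.List.Extrema.Nat using (xs≤max; argmax-sel; max≤v⁺)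
open import Data.List.Membership.Propositional using () renaming (_∈_ to _∈ₗ_)
open import Data.List.Membership.Propositional.Properties
  using (∈-filter⁺; ∈-filter⁻; ∈-lookup; ∈-map⁺; ∈-map⁻; ∈-++⁺ˡ; ∈-++⁺ʳ)
import Data.List.Properties as Listₚ
import Data.List.Relation.Unary.All as All
import Data.List.Relation.Unary.All.Properties as Allₚ
import Data.List.Relation.Unary.AllPairs as AllPairs
import Data.List.Relation.Unary.Any as Any
import Data.List.Relation.Unary.Any.Properties as Anyₚ
open import Data.List.Relation.Unary.Unique.Propositional using (Unique)
import Data.List.Relation.Unary.Unique.Propositional.Properties as Uniqueₚ
open import Data.Nat.Base as ℕ using (ℕ; zero; suc)
import Data.Nat.Properties as ℕₚ
open import Data.Nat.Tactic.RingSolver using () renaming (solve-∀ to ℕ-solve-∀)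
open import Data.Product.Base using (∃; ∃₂; _×_; _,_; proj₁; proj₂)
open import Data.Rational.Base as ℚ using (ℚ; 0ℚ; 1ℚ; ½)
import Data.Rational.Properties as ℚₚ
import Data.Rational.Unnormalised.Base as ℚᵘ
import Data.Rational.Unnormalised.Properties as ℚᵘₚ
open import Data.Sum.Base using (_⊎_; inj₁; inj₂; [_,_]′)
import Data.Vec.Base as Vec
import Data.Vec.Properties as Vecₚ
open import Data.Vec.Properties.WithK using ([]=-irrelevant)
open import Defs
open import Function.Base using (_∘_; id)
open import Function.Bundles using (Inverse; _⇔_; mk⇔)
open import Level using (0ℓ)
open import Relation.Binary.Construct.Closure.ReflexiveTransitive
  using (Star; _◅_) renaming (ε to ∎⋆)
open import Relation.Binary.Definitions using (tri<; tri≈; tri>)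
open import Relation.Binary.PropositionalEquality
  using (_≡_; _≢_; refl; sym; trans; cong; cong₂; subst; subst₂; module ≡-Reasoning)
open import Relation.Nullary using (Dec; does; yes; no; ¬_; contradiction)
open import Relation.Nullary.Decidable using (_×-dec_; ¬?; dec⇒maybe; decidable-stable)
open import Relation.Unary using (Pred; Decidable)
import Tactic.RingSolver as Solver
import Tactic.RingSolver.Core.AlmostCommutativeRing as ACR

-- The obstacle is constructive. Order on the Cauchy sequences `ℝ` is not decidable, and a supremum
-- of Rayleigh quotients need not come with a vector attaining it, whereas `IsEigenvalue` asks for
-- an actual vector. An inequality `A x ≥ (D + k) x` with a strict entry therefore refutes
-- maximality of `D + k` only through an eigenpair that is constructed, which is why an effective
-- rate of convergence is needed. All estimates are made on rational vectors at a fixed index `n`,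
-- where order is decidable, and reals enter only as sequences of such vectors whose residuals tend
-- to 0.
--
-- The passage from `B` to `C` needs signs that compare across orientations. Each incidence number
-- is split into a sign of the ordering of the ridge, a sign of the ordering of the facet, both
-- relative to the increasing order, and a sign that depends on the two sets alone. Changing the
-- orientation thus multiplies rows and columns by signs, and these cancel in one Gram product or
-- the other.

ℚ-ring : ACR.AlmostCommutativeRing 0ℓ 0ℓ
ℚ-ring = ACR.fromCommutativeRing ℚₚ.+-*-commutativeRing (λ p → dec⇒maybe (0ℚ ℚₚ.≟ p))

ℚ-semiring : Semiring 0ℓ 0ℓ
ℚ-semiring = CommutativeRing.semiring ℚₚ.+-*-commutativeRing

-- Order and reciprocals of rational numbers

module RationalOrder where
  open import Data.Rational.Base

  ≤-by : ∀ {p q} d → 0ℚ ≤ d → q ≡ p + d → p ≤ q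
  ≤-by {p} d 0≤d refl = subst (_≤ p + d) (ℚₚ.+-identityʳ p) (ℚₚ.+-monoʳ-≤ p 0≤d)

  0≤-diff : ∀ {p q} → p ≤ q → 0ℚ ≤ q - p
  0≤-diff {p} {q} p≤q = subst (_≤ q - p) (ℚₚ.+-inverseʳ p) (ℚₚ.+-monoˡ-≤ (- p) p≤q)

  0≤-undiff : ∀ {p q} → 0ℚ ≤ q - p → p ≤ q
  0≤-undiff {p} {q} h = ≤-by (q - p) h (recover p q)
    where
    recover : ∀ p q → q ≡ p + (q - p)
    recover = Solver.solve-∀ ℚ-ring

  *-monoˡ : ∀ r {p q} → 0ℚ ≤ r → p ≤ q → r * p ≤ r * q
  *-monoˡ r 0≤r = ℚₚ.*-monoˡ-≤-nonNeg r {{nonNegative 0≤r}}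

  *-monoʳ : ∀ r {p q} → 0ℚ ≤ r → p ≤ q → p * r ≤ q * r
  *-monoʳ r 0≤r = ℚₚ.*-monoʳ-≤-nonNeg r {{nonNegative 0≤r}}

  0≤* : ∀ {p q} → 0ℚ ≤ p → 0ℚ ≤ q → 0ℚ ≤ p * q
  0≤* {p} {q} 0≤p 0≤q = subst (_≤ p * q) (ℚₚ.*-zeroʳ p) (*-monoˡ p 0≤p 0≤q)

  0<* : ∀ {p q} → 0ℚ < p → 0ℚ < q → 0ℚ < p * q
  0<* {p} {q} 0<p 0<q = ℚₚ.positive⁻¹ (p * q) {{ℚₚ.pos*pos⇒pos p {{positive 0<p}} q {{positive 0<q}}}}

  0≤+ : ∀ {p q} → 0ℚ ≤ p → 0ℚ ≤ q → 0ℚ ≤ p + q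
  0≤+ = ℚₚ.+-mono-≤

  0≤1 : 0ℚ ≤ 1ℚ
  0≤1 = ℚₚ.nonNegative⁻¹ 1ℚ

  0<1 : 0ℚ < 1ℚ
  0<1 = ℚₚ.positive⁻¹ 1ℚ

  *-cancelˡ : ∀ r {p q} → 0ℚ < r → r * p ≤ r * q → p ≤ q
  *-cancelˡ r 0<r = ℚₚ.*-cancelˡ-≤-pos r {{positive 0<r}}

  ∣p∣≤ : ∀ {p q} → p ≤ q → - p ≤ q → ∣ p ∣ ≤ q
  ∣p∣≤ {p} {q} h₁ h₂ with ℚₚ.∣p∣≡p∨∣p∣≡-p p
  ... | inj₁ e = subst (_≤ q) (sym e) h₁
  ... | inj₂ e = subst (_≤ q) (sym e) h₂

  p≤∣p∣ : ∀ p → p ≤ ∣ p ∣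
  p≤∣p∣ p with ℚₚ.≤-total 0ℚ p
  ... | inj₁ 0≤p = ℚₚ.≤-reflexive (sym (ℚₚ.0≤p⇒∣p∣≡p 0≤p))
  ... | inj₂ p≤0 = ℚₚ.≤-trans p≤0 (ℚₚ.0≤∣p∣ p)

  -- recip 0 = 0.
  recip : ℚ → ℚ
  recip q with q ℚₚ.≟ 0ℚ
  ... | yes _  = 0ℚ
  ... | no q≢0 = (1/ q) {{≢-nonZero q≢0}}

  *-recip : ∀ {q} → 0ℚ < q → q * recip q ≡ 1ℚ
  *-recip {q} 0<q with q ℚₚ.≟ 0ℚ
  ... | yes q≡0 = contradiction (sym q≡0) (ℚₚ.<⇒≢ 0<q)
  ... | no q≢0 = ℚₚ.*-inverseʳ q {{≢-nonZero q≢0}}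

  recip-pos : ∀ {q} → 0ℚ < q → 0ℚ < recip q
  recip-pos {q} 0<q with q ℚₚ.≟ 0ℚ
  ... | yes q≡0 = contradiction (sym q≡0) (ℚₚ.<⇒≢ 0<q)
  ... | no q≢0 = ℚₚ.positive⁻¹ _ {{ℚₚ.1/pos⇒pos q {{positive 0<q}}}}

  recip≤1 : ∀ {q} → 1ℚ ≤ q → recip q ≤ 1ℚ
  recip≤1 {q} 1≤q = subst₂ _≤_ (ℚₚ.*-identityˡ _) (*-recip 0<q)
      (*-monoʳ (recip q) (ℚₚ.<⇒≤ (recip-pos 0<q)) 1≤q)
    where
    0<q : 0ℚ < q
    0<q = ℚₚ.<-≤-trans 0<1 1≤q

  split : ∀ p → ½ * p + ½ * p ≡ p
  split = Solver.solve-∀ ℚ-ring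

  ½-pos : ∀ {ε} → 0ℚ < ε → 0ℚ < ½ * ε
  ½-pos = 0<* (ℚₚ.positive⁻¹ ½)

-- Integers inside the rationals

module FromIntegers where
  open RationalOrder
  open import Data.Rational.Base

  ι : ℤ → ℚ
  ι i = i / 1

  private
    toι : ∀ i → toℚᵘ (ι i) ℚᵘ.≃ ℚᵘ.mkℚᵘ i 0
    toι i = ℚₚ.toℚᵘ-fromℚᵘ (ℚᵘ.mkℚᵘ i 0)

  ι-+ : ∀ i j → ι (i ℤ.+ j) ≡ ι i + ι j
  ι-+ i j = ℚₚ.toℚᵘ-injective (ℚᵘₚ.≃-trans (toι (i ℤ.+ j)) (ℚᵘₚ.≃-trans (ℚᵘₚ.≃-reflexive e)
      (ℚᵘₚ.≃-sym (ℚᵘₚ.≃-trans (ℚₚ.toℚᵘ-homo-+ (ι i) (ι j)) (ℚᵘₚ.+-cong (toι i) (toι j))))))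
    where
    e : ℚᵘ.mkℚᵘ (i ℤ.+ j) 0 ≡ ℚᵘ.mkℚᵘ i 0 ℚᵘ.+ ℚᵘ.mkℚᵘ j 0
    e = cong₂ (λ a b → ℚᵘ.mkℚᵘ (a ℤ.+ b) 0) (sym (ℤₚ.*-identityʳ i)) (sym (ℤₚ.*-identityʳ j))

  ι-* : ∀ i j → ι (i ℤ.* j) ≡ ι i * ι j
  ι-* i j = ℚₚ.toℚᵘ-injective (ℚᵘₚ.≃-trans (toι (i ℤ.* j))
      (ℚᵘₚ.≃-sym (ℚᵘₚ.≃-trans (ℚₚ.toℚᵘ-homo-* (ι i) (ι j)) (ℚᵘₚ.*-cong (toι i) (toι j)))))

  ι-mono : ∀ {i j} → i ℤ.≤ j → ι i ≤ ι j
  ι-mono {i} {j} i≤j = ℚₚ.toℚᵘ-cancel-≤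
    (ℚᵘₚ.≤-respˡ-≃ (ℚᵘₚ.≃-sym (toι i)) (ℚᵘₚ.≤-respʳ-≃ (ℚᵘₚ.≃-sym (toι j))
      (ℚᵘ.*≤* (ℤₚ.*-monoʳ-≤-nonNeg (ℤ.+ 1) i≤j))))

  ι-nonneg : ∀ n → 0ℚ ≤ ι (ℤ.+ n)
  ι-nonneg n = ι-mono {ℤ.+ 0} {ℤ.+ n} (ℤ.+≤+ ℕ.z≤n)

  open import Algebra.Properties.Semiring.Sum ℚ-semiring using () renaming (sum to ∑)

  ι-∑ : ∀ {n} (f : Fin n → ℤ) → ι (∑ℤ f) ≡ ∑ (ι ∘ f)
  ι-∑ {zero} f = refl
  ι-∑ {suc n} f = trans (ι-+ (f zero) _) (cong (ι (f zero) +_) (ι-∑ (f ∘ suc)))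

  -- The Archimedean property: the denominator is at least 1, so the absolute value of the numerator
  -- is already a bound. It makes geometric sequences null.
  below-natural : ∀ q → ∃ λ n → q ≤ ι (ℤ.+ n)
  below-natural q@(mkℚ _ _ _) = ℤ.∣ ↥ q ∣ , ℚₚ.toℚᵘ-cancel-≤
    (ℚᵘₚ.≤-respʳ-≃ (ℚᵘₚ.≃-sym (toι (ℤ.+ ℤ.∣ ↥ q ∣))) (ℚᵘ.*≤* h))
    where
    i≤∣i∣ : ∀ i → i ℤ.≤ ℤ.+ ℤ.∣ i ∣
    i≤∣i∣ (ℤ.+ _) = ℤₚ.≤-refl
    i≤∣i∣ -[1+ _ ] = ℤ.-≤+
    h : ℚᵘ.↥ toℚᵘ q ℤ.* ℤ.+ 1 ℤ.≤ ℤ.+ ℤ.∣ ↥ q ∣ ℤ.* ℚᵘ.↧ toℚᵘ q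
    h = ℤₚ.≤-trans (subst (ℤ._≤ ℤ.+ ℤ.∣ ↥ q ∣) (sym (ℤₚ.*-identityʳ (↥ q))) (i≤∣i∣ (↥ q)))
      (ℤₚ.≤-trans (ℤₚ.≤-reflexive (sym (ℤₚ.*-identityʳ (ℤ.+ ℤ.∣ ↥ q ∣))))
        (ℤₚ.*-monoˡ-≤-nonNeg (ℤ.+ ℤ.∣ ↥ q ∣) (ℤ.+≤+ (ℕ.s≤s ℕ.z≤n))))

-- Counting by sums of natural numbers

module Counting where
  open import Algebra.Properties.Semiring.Sum ℕₚ.+-*-semiring public
    using (∑-distrib-+; ∑-comm; sum-remove; sum-permute)
    renaming (sum to ∑; sum-cong-≗ to ∑-cong)
  open import Data.Nat.Base using (_+_; _*_; _≤_)

  𝟙 : ∀ {p} {P : Set p} → Dec P → ℕ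
  𝟙 P? = if does P? then 1 else 0

  𝟙-yes : ∀ {p} {P : Set p} (P? : Dec P) → P → 𝟙 P? ≡ 1
  𝟙-yes (yes _) p = refl
  𝟙-yes (no ¬p) p = contradiction p ¬p

  𝟙-no : ∀ {p} {P : Set p} (P? : Dec P) → ¬ P → 𝟙 P? ≡ 0
  𝟙-no (yes p) ¬p = contradiction p ¬p
  𝟙-no (no _) ¬p = refl

  𝟙-× : ∀ {p q} {P : Set p} {Q : Set q} (P? : Dec P) (Q? : Dec Q) → 𝟙 (P? ×-dec Q?) ≡ 𝟙 P? * 𝟙 Q?
  𝟙-× (yes _) (yes _) = refl
  𝟙-× (yes _) (no _) = refl
  𝟙-× (no _) _ = refl

  ∑∑-cong : ∀ {m n} {f g : Fin m → Fin n → ℕ} → (∀ i j → f i j ≡ g i j) →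
    ∑ (λ i → ∑ (f i)) ≡ ∑ (λ i → ∑ (g i))
  ∑∑-cong h = ∑-cong λ i → ∑-cong (h i)

  ∑∑-+ : ∀ {m n} (f g : Fin m → Fin n → ℕ) →
    ∑ (λ i → ∑ λ j → f i j + g i j) ≡ ∑ (λ i → ∑ (f i)) + ∑ (λ i → ∑ (g i))
  ∑∑-+ f g = trans (∑-cong λ i → ∑-distrib-+ (f i) (g i)) (∑-distrib-+ (λ i → ∑ (f i)) (λ i → ∑ (g i)))

  ∑-zero : ∀ {n} {f : Fin n → ℕ} → (∀ i → f i ≡ 0) → ∑ f ≡ 0
  ∑-zero {zero} h = refl
  ∑-zero {suc n} h = cong₂ _+_ (h zero) (∑-zero (h ∘ suc))

  ∑-single : ∀ {n} {f : Fin n → ℕ} i → (∀ j → j ≢ i → f j ≡ 0) → ∑ f ≡ f i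
  ∑-single {suc n} {f} i h = trans (sum-remove {i = i} f)
    (trans (cong (f i +_) (∑-zero λ j → h (punchIn i j) (Finₚ.punchInᵢ≢i i j))) (ℕₚ.+-identityʳ (f i)))

  ∑-mono : ∀ {n} {f g : Fin n → ℕ} → (∀ i → f i ≤ g i) → ∑ f ≤ ∑ g
  ∑-mono {zero} h = ℕ.z≤n
  ∑-mono {suc n} h = ℕₚ.+-mono-≤ (h zero) (∑-mono (h ∘ suc))

  ∑-ones : ∀ n → ∑ {n} (λ _ → 1) ≡ n
  ∑-ones zero = refl
  ∑-ones (suc n) = cong suc (∑-ones n)

  term≤∑ : ∀ {n} (f : Fin n → ℕ) i → f i ≤ ∑ f
  term≤∑ f zero = ℕₚ.m≤m+n (f zero) _
  term≤∑ f (suc i) = ℕₚ.≤-trans (term≤∑ (f ∘ suc) i) (ℕₚ.m≤n+m _ (f zero))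

  module _ {a p} {A : Set a} {P : Pred A p} (P? : Decidable P) where

    length-filter-∷ : ∀ x xs →
      List.length (List.filter P? (x ∷ xs)) ≡ 𝟙 (P? x) + List.length (List.filter P? xs)
    length-filter-∷ x xs with does (P? x)
    ... | true = refl
    ... | false = refl

    length-filter-lookup : ∀ xs → List.length (List.filter P? xs) ≡ ∑ λ i → 𝟙 (P? (List.lookup xs i))
    length-filter-lookup [] = refl
    length-filter-lookup (x ∷ xs) = trans (length-filter-∷ x xs)
      (cong (𝟙 (P? x) +_) (length-filter-lookup xs))

    length-filter-tabulate : ∀ {n} (f : Fin n → A) →
      List.length (List.filter P? (List.tabulate f)) ≡ ∑ λ i → 𝟙 (P? (f i))
    length-filter-tabulate {zero} f = refl
    length-filter-tabulate {suc n} f = trans (length-filter-∷ (f zero) _)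
      (cong (𝟙 (P? (f zero)) +_) (length-filter-tabulate (f ∘ suc)))

  -- Turns `inversions` into a double sum, whose order of summation can be exchanged. Tabulated
  -- lists are used because the induction shifts `f`; `allFin` is the case of the identity.
  length-filter-product : ∀ {a b p} {A : Set a} {B : Set b} {P : Pred (A × B) p} (P? : Decidable P)
    {m n} (f : Fin m → A) (g : Fin n → B) →
    List.length (List.filter P? (List.cartesianProduct (List.tabulate f) (List.tabulate g))) ≡
    ∑ λ i → ∑ λ j → 𝟙 (P? (f i , g j))
  length-filter-product P? {zero} f g = refl
  length-filter-product P? {suc m} f g = begin
    List.length (List.filter P? (row List.++ rest))
      ≡⟨ cong List.length (Listₚ.filter-++ P? row rest) ⟩
    List.length (List.filter P? row List.++ List.filter P? rest)
      ≡⟨ Listₚ.length-++ (List.filter P? row) ⟩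
    List.length (List.filter P? row) + List.length (List.filter P? rest)
      ≡⟨ cong₂ _+_ (trans (cong (λ xs → List.length (List.filter P? xs)) (Listₚ.map-tabulate g (f zero ,_)))
           (length-filter-tabulate P? (λ j → f zero , g j))) (length-filter-product P? (f ∘ suc) g) ⟩
    ∑ (λ j → 𝟙 (P? (f zero , g j))) + ∑ (λ i → ∑ λ j → 𝟙 (P? (f (suc i) , g j))) ∎
    where
    open ≡-Reasoning
    row = List.map (f zero ,_) (List.tabulate g)
    rest = List.cartesianProduct (List.tabulate (f ∘ suc)) (List.tabulate g)

-- Rational vectors and matrices

module RationalVectors where
  open RationalOrder
  open import Data.Rational.Base
  open import Algebra.Properties.Semiring.Sum ℚ-semiring public
    using (∑-distrib-+; ∑-comm; *-distribˡ-sum; *-distribʳ-sum)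
    renaming (sum to ∑; sum-cong-≗ to ∑-cong)

  Vect : ℕ → Set
  Vect n = Fin n → ℚ

  private variable
    m n l : ℕ

  ∑-mono : {f g : Vect n} → (∀ i → f i ≤ g i) → ∑ f ≤ ∑ g
  ∑-mono {zero} h = ℚₚ.≤-refl
  ∑-mono {suc n} h = ℚₚ.+-mono-≤ (h zero) (∑-mono (h ∘ suc))

  ∑-nonneg : {f : Vect n} → (∀ i → 0ℚ ≤ f i) → 0ℚ ≤ ∑ f
  ∑-nonneg {zero} h = ℚₚ.≤-refl
  ∑-nonneg {suc n} h = 0≤+ (h zero) (∑-nonneg (h ∘ suc))

  term≤∑ : {f : Vect n} → (∀ i → 0ℚ ≤ f i) → ∀ i → f i ≤ ∑ f
  term≤∑ h zero = ≤-by _ (∑-nonneg (h ∘ suc)) refl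
  term≤∑ {f = f} h (suc i) = ℚₚ.≤-trans (term≤∑ (h ∘ suc) i) (≤-by (f zero) (h zero) (ℚₚ.+-comm (f zero) _))

  ∣∑∣≤∑∣∣ : (f : Vect n) → ∣ ∑ f ∣ ≤ ∑ (∣_∣ ∘ f)
  ∣∑∣≤∑∣∣ {zero} f = ℚₚ.≤-refl
  ∣∑∣≤∑∣∣ {suc n} f = ℚₚ.≤-trans (ℚₚ.∣p+q∣≤∣p∣+∣q∣ (f zero) _) (ℚₚ.+-monoʳ-≤ ∣ f zero ∣ (∣∑∣≤∑∣∣ (f ∘ suc)))

  ∑-linear : ∀ a b (f g : Vect n) → ∑ (λ i → a * f i + b * g i) ≡ a * ∑ f + b * ∑ g
  ∑-linear a b f g = trans (∑-distrib-+ (λ i → a * f i) (λ i → b * g i))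
    (cong₂ _+_ (sym (*-distribˡ-sum a f)) (sym (*-distribˡ-sum b g)))

  infixr 8 _·_
  _·_ : Matrix ℚ m n → Vect n → Vect m
  (M · x) i = ∑ λ j → M i j * x j

  ·-cong : (M : Matrix ℚ m n) {x y : Vect n} → (∀ j → x j ≡ y j) → ∀ i → (M · x) i ≡ (M · y) i
  ·-cong M h i = ∑-cong λ j → cong (M i j *_) (h j)

  ·-linear : (M : Matrix ℚ m n) → ∀ a b x y i →
    (M · (λ j → a * x j + b * y j)) i ≡ a * (M · x) i + b * (M · y) i
  ·-linear M a b x y i = trans (∑-cong λ j → expand (M i j) a (x j) b (y j))
      (∑-linear a b (λ j → M i j * x j) (λ j → M i j * y j))
    where
    expand : ∀ m a x b y → m * (a * x + b * y) ≡ a * (m * x) + b * (m * y)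
    expand = Solver.solve-∀ ℚ-ring

  ·-assoc : (M : Matrix ℚ m n) (P : Matrix ℚ n l) (Q : Matrix ℚ m l) →
    (∀ i k → Q i k ≡ ∑ λ j → M i j * P j k) → ∀ x i → (Q · x) i ≡ (M · P · x) i
  ·-assoc M P Q h x i = begin
    ∑ (λ k → Q i k * x k)
      ≡⟨ ∑-cong (λ k → trans (cong (_* x k) (h i k)) (*-distribʳ-sum (x k) (λ j → M i j * P j k))) ⟩
    ∑ (λ k → ∑ λ j → M i j * P j k * x k)      ≡⟨ ∑-comm (λ k j → M i j * P j k * x k) ⟩
    ∑ (λ j → ∑ λ k → M i j * P j k * x k)
      ≡⟨ ∑-cong (λ j → trans (∑-cong λ k → ℚₚ.*-assoc (M i j) (P j k) (x k))
        (sym (*-distribˡ-sum (M i j) (λ k → P j k * x k)))) ⟩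
    ∑ (λ j → M i j * ∑ λ k → P j k * x k)      ∎
    where open ≡-Reasoning

  ·-nonneg : {M : Matrix ℚ m n} → (∀ i j → 0ℚ ≤ M i j) → ∀ {x} → (∀ j → 0ℚ ≤ x j) → ∀ i → 0ℚ ≤ (M · x) i
  ·-nonneg M≥0 x≥0 i = ∑-nonneg λ j → 0≤* (M≥0 i j) (x≥0 j)

  ∑-· : (M : Matrix ℚ m n) (x : Vect n) → ∑ (M · x) ≡ ∑ λ j → ∑ (λ i → M i j) * x j
  ∑-· M x = trans (∑-comm λ i j → M i j * x j) (∑-cong λ j → sym (*-distribʳ-sum (x j) λ i → M i j))

-- Null sequences and geometric convergence

module NullSequences where
  open RationalOrder
  open FromIntegers
  open RationalVectors
  open import Data.Rational.Base

  -- `x ≈ℝ y` unfolds to `Null` of the difference of the two sequences, so equations between reals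
  -- are proved index by index with rational algebra.
  Null : (ℕ → ℚ) → Set
  Null f = ∀ ε → 0ℚ < ε → ∃ λ N → ∀ n → N ℕ.≤ n → ∣ f n ∣ < ε

  Eventually : (ℕ → Set) → Set
  Eventually P = ∃ λ N → ∀ n → N ℕ.≤ n → P n

  both : ∀ {P Q : ℕ → Set} → Eventually P → Eventually Q → Eventually (λ n → P n × Q n)
  both (M , p) (N , q) = M ℕ.⊔ N , λ n h → p n (ℕₚ.m⊔n≤o⇒m≤o M N h) , q n (ℕₚ.m⊔n≤o⇒n≤o M N h)

  null-squeeze : ∀ {f g} → Eventually (λ n → ∣ f n ∣ ≤ ∣ g n ∣) → Null g → Null f
  null-squeeze f≤g g→0 ε 0<ε with both f≤g (g→0 ε 0<ε)
  ... | N , h = N , λ n N≤n → ℚₚ.≤-<-trans (proj₁ (h n N≤n)) (proj₂ (h n N≤n))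

  null-cong : ∀ {f g} → (∀ n → f n ≡ g n) → Null g → Null f
  null-cong f≡g = null-squeeze (0 , λ n _ → ℚₚ.≤-reflexive (cong ∣_∣ (f≡g n)))

  null-0 : Null (λ _ → 0ℚ)
  null-0 ε 0<ε = 0 , λ _ _ → 0<ε

  null-+ : ∀ {f g} → Null f → Null g → Null (λ n → f n + g n)
  null-+ {f} {g} f→0 g→0 ε 0<ε with both (f→0 (½ * ε) (½-pos 0<ε)) (g→0 (½ * ε) (½-pos 0<ε))
  ... | N , h = N , λ n N≤n → ℚₚ.≤-<-trans (ℚₚ.∣p+q∣≤∣p∣+∣q∣ (f n) (g n))
    (subst (∣ f n ∣ + ∣ g n ∣ <_) (split ε) (ℚₚ.+-mono-< (proj₁ (h n N≤n)) (proj₂ (h n N≤n))))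

  null-*ˡ : ∀ c {f} → Null f → Null (λ n → c * f n)
  -- Dividing by `∣ c ∣ + 1ℚ` rather than `∣ c ∣` spares a separate case for `c = 0`.
  null-*ˡ c {f} f→0 ε 0<ε with f→0 (recip (∣ c ∣ + 1ℚ) * ε) (0<* (recip-pos c+1>0) 0<ε)
    where
    c+1>0 : 0ℚ < ∣ c ∣ + 1ℚ
    c+1>0 = ℚₚ.+-mono-≤-< (ℚₚ.0≤∣p∣ c) 0<1
  ... | N , h = N , λ n N≤n → begin-strict
    ∣ c * f n ∣                     ≡⟨ ℚₚ.∣p*q∣≡∣p∣*∣q∣ c (f n) ⟩
    ∣ c ∣ * ∣ f n ∣                 ≤⟨ *-monoʳ ∣ f n ∣ (ℚₚ.0≤∣p∣ (f n)) (≤-by {∣ c ∣} 1ℚ 0≤1 refl) ⟩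
    (∣ c ∣ + 1ℚ) * ∣ f n ∣          <⟨ ℚₚ.*-monoʳ-<-pos (∣ c ∣ + 1ℚ) {{positive c+1>0}} (h n N≤n) ⟩
    (∣ c ∣ + 1ℚ) * (recip (∣ c ∣ + 1ℚ) * ε)  ≡⟨ ℚₚ.*-assoc (∣ c ∣ + 1ℚ) _ ε ⟨
    (∣ c ∣ + 1ℚ) * recip (∣ c ∣ + 1ℚ) * ε    ≡⟨ cong (_* ε) (*-recip c+1>0) ⟩
    1ℚ * ε                          ≡⟨ ℚₚ.*-identityˡ ε ⟩
    ε                               ∎
    where
    open ℚₚ.≤-Reasoning
    c+1>0 : 0ℚ < ∣ c ∣ + 1ℚ
    c+1>0 = ℚₚ.+-mono-≤-< (ℚₚ.0≤∣p∣ c) 0<1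

  null-∑ : ∀ {k} {f : Fin k → ℕ → ℚ} → (∀ i → Null (f i)) → Null (λ n → ∑ λ i → f i n)
  null-∑ {zero} h = null-0
  null-∑ {suc k} h = null-+ (h zero) (null-∑ (h ∘ suc))

  null-· : ∀ {r c} (M : Matrix ℚ r c) {x : ℕ → Vect c} → (∀ j → Null (λ n → x n j)) →
    ∀ i → Null (λ n → (M · x n) i)
  null-· M h i = null-∑ λ j → null-*ˡ (M i j) (h j)

  null-abs : ∀ {f} → Null f → Null (λ n → ∣ f n ∣)
  null-abs {f} = null-squeeze (0 , λ n _ → ℚₚ.≤-reflexive (ℚₚ.∣∣p∣∣≡∣p∣ (f n)))

  null-*-cancelˡ : ∀ {c f} → 0ℚ < c → Null (λ n → c * f n) → Null f
  null-*-cancelˡ {c} {f} 0<c h = null-cong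
    (λ n → trans (sym (ℚₚ.*-identityˡ (f n)))
      (trans (cong (_* f n) (trans (sym (*-recip 0<c)) (ℚₚ.*-comm c _))) (ℚₚ.*-assoc (recip c) c (f n))))
    (null-*ˡ (recip c) h)

  ¬null-positive : ∀ {f c} → 0ℚ < c → (∀ n → c ≤ f n) → ¬ Null f
  ¬null-positive {f} {c} 0<c c≤f f→0 with f→0 c 0<c
  ... | N , h = ℚₚ.<-irrefl refl
    (ℚₚ.≤-<-trans (ℚₚ.≤-trans (c≤f N) (p≤∣p∣ (f N))) (h N ℕₚ.≤-refl))

  -- Bernoulli: (1 + n γ)(1 − γ)ⁿ ≤ 1.
  module _ {γ : ℚ} (0<γ : 0ℚ < γ) (γ≤1 : γ ≤ 1ℚ) where
    open import Algebra.Properties.Semiring.Exp ℚ-semiring using (_^_)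

    private
      α : ℚ
      α = 1ℚ - γ

      0≤α : 0ℚ ≤ α
      0≤α = 0≤-diff γ≤1

    power-nonneg : ∀ n → 0ℚ ≤ α ^ n
    power-nonneg zero = 0≤1
    power-nonneg (suc n) = 0≤* 0≤α (power-nonneg n)

    power-antitone : ∀ n → α ^ suc n ≤ α ^ n
    power-antitone n = ≤-by (γ * α ^ n) (0≤* (ℚₚ.<⇒≤ 0<γ) (power-nonneg n)) (e γ (α ^ n))
      where
      e : ∀ γ x → x ≡ (1ℚ - γ) * x + γ * x
      e = Solver.solve-∀ ℚ-ring

    power-antitone′ : ∀ m n → m ℕ.≤ n → α ^ n ≤ α ^ m
    power-antitone′ m n m≤n = go (ℕₚ.≤⇒≤′ m≤n)
      where
      go : ∀ {n} → m ℕ.≤′ n → α ^ n ≤ α ^ m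
      go (ℕ.≤′-reflexive refl) = ℚₚ.≤-refl
      go {suc n} (ℕ.≤′-step h) = ℚₚ.≤-trans (power-antitone n) (go h)

    bernoulli : ∀ n → (1ℚ + ι (ℤ.+ n) * γ) * α ^ n ≤ 1ℚ
    bernoulli zero = ℚₚ.≤-reflexive (trans (ℚₚ.*-identityʳ _) (trans (cong (1ℚ +_) (ℚₚ.*-zeroˡ γ)) refl))
    bernoulli (suc n) = ℚₚ.≤-trans
        (≤-by ((ι (ℤ.+ n) + 1ℚ) * (γ * γ) * α ^ n)
          (0≤* {(ι (ℤ.+ n) + 1ℚ) * (γ * γ)}
            (0≤* {ι (ℤ.+ n) + 1ℚ} (0≤+ (ι-nonneg n) 0≤1) (0≤* (ℚₚ.<⇒≤ 0<γ) (ℚₚ.<⇒≤ 0<γ))) (power-nonneg n))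
          (trans (e (ι (ℤ.+ n)) γ (α ^ n))
            (cong (λ k → (1ℚ + k * γ) * ((1ℚ - γ) * α ^ n) + (ι (ℤ.+ n) + 1ℚ) * (γ * γ) * α ^ n)
              (sym (ι-+ (ℤ.+ 1) (ℤ.+ n))))))
        (bernoulli n)
      where
      e : ∀ k γ x → (1ℚ + k * γ) * x ≡ (1ℚ + (1ℚ + k) * γ) * ((1ℚ - γ) * x) + (k + 1ℚ) * (γ * γ) * x
      e = Solver.solve-∀ ℚ-ring

    -- If `N` is at least `1 / (γ ε)`, then `1 + N γ` exceeds `1 / ε`, and Bernoulli's inequality
    -- puts the `N`-th power below `ε`.
    power-null : Null (α ^_)
    power-null ε 0<ε with below-natural (recip (γ * ε))
    ... | N , r≤N = N , λ n N≤n → begin-strict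
      ∣ α ^ n ∣  ≡⟨ ℚₚ.0≤p⇒∣p∣≡p (power-nonneg n) ⟩
      α ^ n      ≤⟨ power-antitone′ N n N≤n ⟩
      α ^ N      <⟨ small ⟩
      ε          ∎
      where
      open ℚₚ.≤-Reasoning
      0<γε : 0ℚ < γ * ε
      0<γε = 0<* 0<γ 0<ε
      X : ℚ
      X = 1ℚ + ι (ℤ.+ N) * γ
      1≤Nγε : 1ℚ ≤ ι (ℤ.+ N) * γ * ε
      1≤Nγε = begin
        1ℚ                       ≡⟨ *-recip 0<γε ⟨
        γ * ε * recip (γ * ε)    ≤⟨ *-monoˡ (γ * ε) (ℚₚ.<⇒≤ 0<γε) r≤N ⟩
        γ * ε * ι (ℤ.+ N)        ≡⟨ e γ ε (ι (ℤ.+ N)) ⟩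
        ι (ℤ.+ N) * γ * ε        ∎
        where
        e : ∀ a b c → a * b * c ≡ c * a * b
        e = Solver.solve-∀ ℚ-ring
      0≤N : 0ℚ ≤ ι (ℤ.+ N)
      0≤N = ι-nonneg N
      0≤X : 0ℚ ≤ X
      0≤X = 0≤+ 0≤1 (0≤* 0≤N (ℚₚ.<⇒≤ 0<γ))
      small : α ^ N < ε
      small = ℚₚ.*-cancelˡ-<-nonNeg X {{nonNegative 0≤X}} (begin-strict
        X * α ^ N               ≤⟨ bernoulli N ⟩
        1ℚ                      ≤⟨ 1≤Nγε ⟩
        ι (ℤ.+ N) * γ * ε       ≡⟨ ℚₚ.+-identityˡ _ ⟨
        0ℚ + ι (ℤ.+ N) * γ * ε  <⟨ ℚₚ.+-monoˡ-< _ 0<ε ⟩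
        ε + ι (ℤ.+ N) * γ * ε   ≡⟨ e ε (ι (ℤ.+ N) * γ) ⟩
        X * ε                   ∎)
        where
        e : ∀ a b → a + b * a ≡ (1ℚ + b) * a
        e = Solver.solve-∀ ℚ-ring

    -- Multiplying by `γ = 1 - α` makes the geometric bounds telescope to
    -- `H * (α ^ N - α ^ (j + N))`, so no infinite series is summed. The threshold for `H * α ^ N`
    -- carries the factor `γ` that is cancelled at the end, and two late terms are compared through
    -- the `N`-th one.
    geometric-cauchy : ∀ {H} (f : ℕ → ℚ) → 0ℚ ≤ H →
      (∀ n → ∣ f (suc n) - f n ∣ ≤ α ^ n * H) → IsCauchy f
    geometric-cauchy {H} f 0≤H step ε 0<ε = N , λ m n N≤m N≤n → subst (λ r → ∣ r ∣ < ε) (e (f m) (f n) (f N))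
        (ℚₚ.≤-<-trans (ℚₚ.∣p-q∣≤∣p∣+∣q∣ (f m - f N) (f n - f N))
          (subst (∣ f m - f N ∣ + ∣ f n - f N ∣ <_) (split ε) (ℚₚ.+-mono-< (near m N≤m) (near n N≤n))))
      where
      open ℚₚ.≤-Reasoning
      eventually : Eventually (λ n → ∣ H * α ^ n ∣ < γ * (½ * ε))
      eventually = null-*ˡ H power-null (γ * (½ * ε)) (0<* 0<γ (½-pos 0<ε))
      N : ℕ
      N = proj₁ eventually
      e : ∀ a b c → (a - c) - (b - c) ≡ a - b
      e = Solver.solve-∀ ℚ-ring
      telescope : ∀ j → γ * ∣ f (j ℕ.+ N) - f N ∣ ≤ H * (α ^ N - α ^ (j ℕ.+ N))
      telescope zero = ℚₚ.≤-reflexive (trans (cong (λ r → γ * ∣ r ∣) (ℚₚ.+-inverseʳ (f N)))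
        (trans (ℚₚ.*-zeroʳ γ) (sym (trans (cong (H *_) (ℚₚ.+-inverseʳ (α ^ N))) (ℚₚ.*-zeroʳ H)))))
      telescope (suc j) = begin
        γ * ∣ f (suc j ℕ.+ N) - f N ∣
          ≡⟨ cong (λ r → γ * ∣ r ∣) (e₁ (f (suc j ℕ.+ N)) (f N) (f (j ℕ.+ N))) ⟩
        γ * ∣ (f (j ℕ.+ N) - f N) + (f (suc j ℕ.+ N) - f (j ℕ.+ N)) ∣
          ≤⟨ *-monoˡ γ (ℚₚ.<⇒≤ 0<γ) (ℚₚ.≤-trans (ℚₚ.∣p+q∣≤∣p∣+∣q∣ (f (j ℕ.+ N) - f N) _)
               (ℚₚ.+-monoʳ-≤ ∣ f (j ℕ.+ N) - f N ∣ (step (j ℕ.+ N)))) ⟩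
        γ * (∣ f (j ℕ.+ N) - f N ∣ + α ^ (j ℕ.+ N) * H)
          ≡⟨ ℚₚ.*-distribˡ-+ γ _ _ ⟩
        γ * ∣ f (j ℕ.+ N) - f N ∣ + γ * (α ^ (j ℕ.+ N) * H)
          ≤⟨ ℚₚ.+-monoˡ-≤ _ (telescope j) ⟩
        H * (α ^ N - α ^ (j ℕ.+ N)) + γ * (α ^ (j ℕ.+ N) * H)
          ≡⟨ e₂ H γ (α ^ N) (α ^ (j ℕ.+ N)) ⟩
        H * (α ^ N - α ^ (suc j ℕ.+ N)) ∎
        where
        e₁ : ∀ a b c → a - b ≡ (c - b) + (a - c)
        e₁ = Solver.solve-∀ ℚ-ring
        e₂ : ∀ H γ x y → H * (x - y) + γ * (y * H) ≡ H * (x - (1ℚ - γ) * y)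
        e₂ = Solver.solve-∀ ℚ-ring
      near : ∀ n → N ℕ.≤ n → ∣ f n - f N ∣ < ½ * ε
      near n N≤n = ℚₚ.*-cancelˡ-<-nonNeg γ {{nonNegative (ℚₚ.<⇒≤ 0<γ)}} (begin-strict
        γ * ∣ f n - f N ∣
          ≡⟨ cong (λ k → γ * ∣ f k - f N ∣) (ℕₚ.m∸n+n≡m N≤n) ⟨
        γ * ∣ f (n ℕ.∸ N ℕ.+ N) - f N ∣
          ≤⟨ telescope (n ℕ.∸ N) ⟩
        H * (α ^ N - α ^ (n ℕ.∸ N ℕ.+ N))
          ≤⟨ *-monoˡ H 0≤H (≤-by (α ^ (n ℕ.∸ N ℕ.+ N)) (power-nonneg (n ℕ.∸ N ℕ.+ N))
            (e₃ (α ^ N) (α ^ (n ℕ.∸ N ℕ.+ N)))) ⟩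
        H * α ^ N
          ≤⟨ p≤∣p∣ (H * α ^ N) ⟩
        ∣ H * α ^ N ∣
          <⟨ proj₂ eventually N ℕₚ.≤-refl ⟩
        γ * (½ * ε) ∎)
        where
        e₃ : ∀ x y → x ≡ (x - y) + y
        e₃ = Solver.solve-∀ ℚ-ring

-- Eigenvalues of Gram matrices over Cauchy sequences

module Eigenvalues where
  open RationalOrder
  open FromIntegers
  open RationalVectors
  open NullSequences
  open import Data.Rational.Base

  seq-∑ℝ : ∀ {k} (f : Fin k → ℝ) n → seq (∑ℝ f) n ≡ ∑ λ i → seq (f i) n
  seq-∑ℝ {zero} f n = refl
  seq-∑ℝ {suc k} f n = cong (seq (f zero) n +_) (seq-∑ℝ (f ∘ suc) n)

  -- A single rational comparison, of the `N`-th term with `c + ε / 2`, decides between the two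
  -- cases. Later terms stay within `ε / 4` of it, so the sequence is either eventually below
  -- `c + ε` or eventually above `c + ε / 4`, and the latter is excluded.
  ≤ℝ-from-¬> : ∀ μ c → (∀ δ → 0ℚ < δ → ¬ Eventually (λ n → c + δ ≤ seq μ n)) → μ ≤ℝ fromℚ c
  ≤ℝ-from-¬> μ c ¬> ε 0<ε = N , below (seq μ N ℚₚ.≤? c + ½ * ε)
    where
    open ℚₚ.≤-Reasoning
    q : ℚ
    q = ½ * (½ * ε)
    0<q : 0ℚ < q
    0<q = ½-pos (½-pos 0<ε)
    N : ℕ
    N = proj₁ (cauchy μ q 0<q)
    near : ∀ m n → N ℕ.≤ m → N ℕ.≤ n → seq μ m ≤ seq μ n + q
    near m n N≤m N≤n = begin
      seq μ m                          ≡⟨ e (seq μ m) (seq μ n) ⟩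
      seq μ n + (seq μ m - seq μ n)    ≤⟨ ℚₚ.+-monoʳ-≤ (seq μ n) (p≤∣p∣ (seq μ m - seq μ n)) ⟩
      seq μ n + ∣ seq μ m - seq μ n ∣
        ≤⟨ ℚₚ.+-monoʳ-≤ (seq μ n) (ℚₚ.<⇒≤ (proj₂ (cauchy μ q 0<q) m n N≤m N≤n)) ⟩
      seq μ n + q                      ∎
      where
      e : ∀ a b → a ≡ b + (a - b)
      e = Solver.solve-∀ ℚ-ring
    below : _ → ∀ n → N ℕ.≤ n → seq μ n ≤ c + ε
    below (yes h) n N≤n = begin
      seq μ n          ≤⟨ near n N N≤n ℕₚ.≤-refl ⟩
      seq μ N + q      ≤⟨ ℚₚ.+-monoˡ-≤ q h ⟩
      c + ½ * ε + q    ≤⟨ ≤-by {c + ½ * ε + q} {c + ε} q (ℚₚ.<⇒≤ 0<q) (e c ε) ⟩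
      c + ε            ∎
      where
      e : ∀ c ε → c + ε ≡ c + ½ * ε + ½ * (½ * ε) + ½ * (½ * ε)
      e = Solver.solve-∀ ℚ-ring
    below (no h) = contradiction
      (N , λ n N≤n → ℚₚ.≤-trans (0≤-undiff {c + q} {seq μ N - q}
          (subst (0ℚ ≤_) (e c ε (seq μ N)) (0≤-diff (ℚₚ.<⇒≤ (ℚₚ.≰⇒> h)))))
        (0≤-undiff {seq μ N - q} {seq μ n}
          (subst (0ℚ ≤_) (e′ (seq μ n) (seq μ N) q) (0≤-diff (near N n ℕₚ.≤-refl N≤n)))))
      (¬> q 0<q)
      where
      e : ∀ c ε x → x - (c + ½ * ε) ≡ (x - ½ * (½ * ε)) - (c + ½ * (½ * ε))
      e = Solver.solve-∀ ℚ-ring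
      e′ : ∀ x y q → (x + q) - y ≡ x - (y - q)
      e′ = Solver.solve-∀ ℚ-ring

  module Gram {r c : ℕ} (C : Matrix ℤ r c) (L : Matrix ℤ r r) (A : Matrix ℤ c c)
    (L≡CCᵀ : ∀ R S → L R S ≡ ∑ℤ (λ F → C R F ℤ.* C S F))
    (A≡CᵀC : ∀ F G → A F G ≡ ∑ℤ (λ R → C R F ℤ.* C R G)) where

    private
      Cℚ : Matrix ℚ r c
      Cℚ R F = ι (C R F)
      Cᵀ : Matrix ℚ c r
      Cᵀ F R = ι (C R F)
      Lℚ : Matrix ℚ r r
      Lℚ R S = ι (L R S)
      Aℚ : Matrix ℚ c c
      Aℚ F G = ι (A F G)

      L· : ∀ x R → (Lℚ · x) R ≡ (Cℚ · Cᵀ · x) R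
      L· = ·-assoc Cℚ Cᵀ Lℚ λ R S → trans (cong ι (L≡CCᵀ R S))
        (trans (ι-∑ λ F → C R F ℤ.* C S F) (∑-cong λ F → ι-* (C R F) (C S F)))

      A· : ∀ x F → (Aℚ · x) F ≡ (Cᵀ · Cℚ · x) F
      A· = ·-assoc Cᵀ Cℚ Aℚ λ F G → trans (cong ι (A≡CᵀC F G))
        (trans (ι-∑ λ R → C R F ℤ.* C R G) (∑-cong λ R → ι-* (C R F) (C R G)))

      ·-residual : ∀ {m k} (M : Matrix ℚ m k) μ x y i →
        (M · (λ j → y j - μ * x j)) i ≡ (M · y) i - μ * (M · x) i
      ·-residual M μ x y i = trans (·-cong M (λ j → e (y j) μ (x j)) i)
        (trans (·-linear M 1ℚ (- μ) y x i) (sym (e ((M · y) i) μ ((M · x) i))))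
        where
        e : ∀ a μ b → a - μ * b ≡ 1ℚ * a + - μ * b
        e = Solver.solve-∀ ℚ-ring

    -- The eigenvector is `C x`, since `L (C x) = C (A x)`. It is not zero: if `C x` tended to 0, so
    -- would `Cᵀ (C x) = A x` and with it `μ x`, while the total of `μ x` stays above `δ`.
    isEigenvalue : ∀ (x : Fin c → ℝ) (μ : ℝ) →
      (∀ F → Null (λ n → (Aℚ · (λ G → seq (x G) n)) F - seq μ n * seq (x F) n)) →
      ∀ {δ} → 0ℚ < δ → (∀ n → δ ≤ seq μ n * ∑ (λ F → seq (x F) n)) →
      IsEigenvalue (λ R S → fromℤ (L R S)) μ
    isEigenvalue x μ eigen {δ} 0<δ away = v , v≉0 , Lv≈μv
      where
      xₙ : ℕ → Vect c
      xₙ n F = seq (x F) n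
      residual : ℕ → Vect c
      residual n F = (Aℚ · xₙ n) F - seq μ n * xₙ n F
      v : Fin r → ℝ
      v R = ∑ℝ λ F → fromℤ (C R F) *ℝ x F
      seq-v : ∀ n R → seq (v R) n ≡ (Cℚ · xₙ n) R
      seq-v n R = seq-∑ℝ (λ F → fromℤ (C R F) *ℝ x F) n

      Lv≈μv : ∀ R → ∑ℝ (λ S → fromℤ (L R S) *ℝ v S) ≈ℝ μ *ℝ v R
      Lv≈μv R = null-cong {g = λ n → (Cℚ · residual n) R} (λ n → begin
        seq (∑ℝ (λ S → fromℤ (L R S) *ℝ v S)) n - seq μ n * seq (v R) n
          ≡⟨ cong₂ (λ a b → a - seq μ n * b) (seq-∑ℝ (λ S → fromℤ (L R S) *ℝ v S) n) (seq-v n R) ⟩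
        (Lℚ · (λ S → seq (v S) n)) R - seq μ n * (Cℚ · xₙ n) R
          ≡⟨ cong (_- seq μ n * (Cℚ · xₙ n) R) (trans (·-cong Lℚ (seq-v n) R)
               (trans (L· (Cℚ · xₙ n) R) (·-cong Cℚ (λ F → sym (A· (xₙ n) F)) R))) ⟩
        (Cℚ · Aℚ · xₙ n) R - seq μ n * (Cℚ · xₙ n) R
          ≡⟨ ·-residual Cℚ (seq μ n) (xₙ n) (Aℚ · xₙ n) R ⟨
        (Cℚ · residual n) R ∎)
        (null-· Cℚ eigen R)
        where open ≡-Reasoning

      v≉0 : ¬ (∀ R → v R ≈ℝ 0ℝ)
      v≉0 v≈0 = ¬null-positive 0<δ away
        (null-cong (λ n → *-distribˡ-sum (seq μ n) (xₙ n)) (null-∑ μx→0))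
        where
        Cx→0 : ∀ R → Null (λ n → (Cℚ · xₙ n) R)
        Cx→0 R = null-cong (λ n → sym (trans (ℚₚ.+-identityʳ (seq (v R) n)) (seq-v n R))) (v≈0 R)
        e : ∀ a b → b ≡ a + - 1ℚ * (a - b)
        e = Solver.solve-∀ ℚ-ring
        μx→0 : ∀ F → Null (λ n → seq μ n * xₙ n F)
        μx→0 F = null-cong
          (λ n → trans (e ((Aℚ · xₙ n) F) (seq μ n * xₙ n F))
            (cong (_+ - 1ℚ * residual n F) (A· (xₙ n) F)))
          (null-+ (null-· Cᵀ Cx→0 F) (null-*ˡ (- 1ℚ) (eigen F)))

    -- Compares 1-norms of w = Cᵀ v, using A w = μ w.
    eigenvalue-bound : ∀ b → 0ℚ ≤ b → (∀ F G → 0ℚ ≤ Aℚ F G) → (∀ G → ∑ (λ F → Aℚ F G) ≤ b) →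
      ∀ μ → IsEigenvalue (λ R S → fromℤ (L R S)) μ → μ ≤ℝ fromℚ b
    eigenvalue-bound b 0≤b A≥0 columns≤b μ (v , v≉0 , Lv≈μv) = ≤ℝ-from-¬> μ b contra
      where
      vₙ : ℕ → Vect r
      vₙ n R = seq (v R) n
      residual : ℕ → Vect r
      residual n R = (Lℚ · vₙ n) R - seq μ n * vₙ n R
      residual→0 : ∀ R → Null (λ n → residual n R)
      residual→0 R = null-cong (λ n → cong (_- seq μ n * vₙ n R)
        (sym (seq-∑ℝ (λ S → fromℤ (L R S) *ℝ v S) n))) (Lv≈μv R)

      -- At an index where `μ` exceeds `b` by `δ`, the 1-norm of `w`, and then `v` itself, is
      -- bounded by the residual alone.
      module _ (δ : ℚ) (0<δ : 0ℚ < δ) (n : ℕ) (b+δ≤μ : b + δ ≤ seq μ n) where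
        open ℚₚ.≤-Reasoning
        μₙ : ℚ
        μₙ = seq μ n
        w : Vect c
        w = Cᵀ · vₙ n
        W E : ℚ
        W = ∑ λ F → ∣ w F ∣
        E = ∑ λ F → ∣ (Cᵀ · residual n) F ∣
        0≤δ : 0ℚ ≤ δ
        0≤δ = ℚₚ.<⇒≤ 0<δ
        δ≤μ : δ ≤ μₙ
        δ≤μ = ℚₚ.≤-trans (≤-by b 0≤b (ℚₚ.+-comm b δ)) b+δ≤μ
        0≤μ : 0ℚ ≤ μₙ
        0≤μ = ℚₚ.≤-trans 0≤δ δ≤μ
        0≤W : 0ℚ ≤ W
        0≤W = ∑-nonneg λ F → ℚₚ.0≤∣p∣ (w F)

        ∣μ*∣ : ∀ x → μₙ * ∣ x ∣ ≡ ∣ μₙ * x ∣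
        ∣μ*∣ x = trans (cong (_* ∣ x ∣) (sym (ℚₚ.0≤p⇒∣p∣≡p 0≤μ))) (sym (ℚₚ.∣p*q∣≡∣p∣*∣q∣ μₙ x))

        e₁ : ∀ a x → x ≡ a - (a - x)
        e₁ = Solver.solve-∀ ℚ-ring

        μw : ∀ F → μₙ * w F ≡ (Aℚ · w) F - (Cᵀ · residual n) F
        μw F = trans (e₁ ((Aℚ · w) F) (μₙ * w F)) (cong (λ z → (Aℚ · w) F - z)
          (sym (trans (·-residual Cᵀ μₙ (vₙ n) (Lℚ · vₙ n) F)
            (cong (_- μₙ * w F) (trans (·-cong Cᵀ (L· (vₙ n)) F) (sym (A· w F)))))))

        ∣Aw∣ : ∀ F → ∣ (Aℚ · w) F ∣ ≤ (Aℚ · (λ G → ∣ w G ∣)) F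
        ∣Aw∣ F = ℚₚ.≤-trans (∣∑∣≤∑∣∣ λ G → Aℚ F G * w G) (ℚₚ.≤-reflexive (∑-cong λ G →
          trans (ℚₚ.∣p*q∣≡∣p∣*∣q∣ (Aℚ F G) (w G)) (cong (_* ∣ w G ∣) (ℚₚ.0≤p⇒∣p∣≡p (A≥0 F G)))))

        μW≤ : μₙ * W ≤ b * W + E
        μW≤ = begin
          μₙ * W
            ≡⟨ *-distribˡ-sum μₙ (λ F → ∣ w F ∣) ⟩
          ∑ (λ F → μₙ * ∣ w F ∣)
            ≤⟨ ∑-mono (λ F → begin
                 μₙ * ∣ w F ∣                                  ≡⟨ trans (∣μ*∣ (w F)) (cong ∣_∣ (μw F)) ⟩
                 ∣ (Aℚ · w) F - (Cᵀ · residual n) F ∣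
                   ≤⟨ ℚₚ.∣p-q∣≤∣p∣+∣q∣ ((Aℚ · w) F) ((Cᵀ · residual n) F) ⟩
                 ∣ (Aℚ · w) F ∣ + ∣ (Cᵀ · residual n) F ∣
                   ≤⟨ ℚₚ.+-monoˡ-≤ ∣ (Cᵀ · residual n) F ∣ (∣Aw∣ F) ⟩
                 (Aℚ · (λ G → ∣ w G ∣)) F + ∣ (Cᵀ · residual n) F ∣ ∎) ⟩
          ∑ (λ F → (Aℚ · (λ G → ∣ w G ∣)) F + ∣ (Cᵀ · residual n) F ∣)
            ≡⟨ ∑-distrib-+ (Aℚ · (λ G → ∣ w G ∣)) (λ F → ∣ (Cᵀ · residual n) F ∣) ⟩
          ∑ (Aℚ · (λ G → ∣ w G ∣)) + E
            ≡⟨ cong (_+ E) (∑-· Aℚ (λ G → ∣ w G ∣)) ⟩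
          ∑ (λ G → ∑ (λ F → Aℚ F G) * ∣ w G ∣) + E
            ≤⟨ ℚₚ.+-monoˡ-≤ E (∑-mono λ G → *-monoʳ ∣ w G ∣ (ℚₚ.0≤∣p∣ (w G)) (columns≤b G)) ⟩
          ∑ (λ G → b * ∣ w G ∣) + E
            ≡⟨ cong (_+ E) (*-distribˡ-sum b (λ G → ∣ w G ∣)) ⟨
          b * W + E ∎

        δW≤E : δ * W ≤ E
        δW≤E = 0≤-undiff {δ * W} {E} (ℚₚ.≤-trans
          (0≤+ (0≤-diff μW≤) (0≤-diff (*-monoʳ W 0≤W b+δ≤μ)))
          (ℚₚ.≤-reflexive (e b W E μₙ δ)))
          where
          e : ∀ b W E μ δ → (b * W + E - μ * W) + (μ * W - (b + δ) * W) ≡ E - δ * W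
          e = Solver.solve-∀ ℚ-ring

        -- One factor `δ` is absorbed by `δ ≤ μₙ`, which replaces `v` by `C w` minus the residual;
        -- the other turns `W` into `δ * W`, which `E` bounds. Keeping both on the left avoids
        -- division.
        δ²v≤ : ∀ R → ∣ δ * δ * vₙ n R ∣ ≤ ∣ ∑ (λ F → ∣ Cℚ R F ∣) * E + δ * ∣ residual n R ∣ ∣
        δ²v≤ R = begin
          ∣ δ * δ * vₙ n R ∣
            ≡⟨ ℚₚ.∣p*q∣≡∣p∣*∣q∣ (δ * δ) (vₙ n R) ⟩
          ∣ δ * δ ∣ * ∣ vₙ n R ∣
            ≡⟨ cong (_* ∣ vₙ n R ∣) (ℚₚ.0≤p⇒∣p∣≡p (0≤* 0≤δ 0≤δ)) ⟩
          δ * δ * ∣ vₙ n R ∣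
            ≡⟨ ℚₚ.*-assoc δ δ ∣ vₙ n R ∣ ⟩
          δ * (δ * ∣ vₙ n R ∣)
            ≤⟨ *-monoˡ δ 0≤δ (*-monoʳ ∣ vₙ n R ∣ (ℚₚ.0≤∣p∣ (vₙ n R)) δ≤μ) ⟩
          δ * (μₙ * ∣ vₙ n R ∣)
            ≡⟨ cong (δ *_) (trans (∣μ*∣ (vₙ n R)) (cong ∣_∣ (trans (e₁ ((Lℚ · vₙ n) R) (μₙ * vₙ n R))
                 (cong (_- residual n R) (L· (vₙ n) R))))) ⟩
          δ * ∣ (Cℚ · w) R - residual n R ∣
            ≤⟨ *-monoˡ δ 0≤δ (ℚₚ.≤-trans (ℚₚ.∣p-q∣≤∣p∣+∣q∣ ((Cℚ · w) R) (residual n R))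
                 (ℚₚ.+-monoˡ-≤ ∣ residual n R ∣ ∣Cw∣)) ⟩
          δ * (∑ (λ F → ∣ Cℚ R F ∣) * W + ∣ residual n R ∣)
            ≡⟨ e δ (∑ (λ F → ∣ Cℚ R F ∣)) W ∣ residual n R ∣ ⟩
          ∑ (λ F → ∣ Cℚ R F ∣) * (δ * W) + δ * ∣ residual n R ∣
            ≤⟨ ℚₚ.+-monoˡ-≤ (δ * ∣ residual n R ∣) (*-monoˡ (∑ (λ F → ∣ Cℚ R F ∣))
                 (∑-nonneg λ F → ℚₚ.0≤∣p∣ (Cℚ R F)) δW≤E) ⟩
          ∑ (λ F → ∣ Cℚ R F ∣) * E + δ * ∣ residual n R ∣
            ≤⟨ p≤∣p∣ (∑ (λ F → ∣ Cℚ R F ∣) * E + δ * ∣ residual n R ∣) ⟩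
          ∣ ∑ (λ F → ∣ Cℚ R F ∣) * E + δ * ∣ residual n R ∣ ∣ ∎
          where
          e : ∀ δ c W r → δ * (c * W + r) ≡ c * (δ * W) + δ * r
          e = Solver.solve-∀ ℚ-ring
          ∣Cw∣ : ∣ (Cℚ · w) R ∣ ≤ ∑ (λ F → ∣ Cℚ R F ∣) * W
          ∣Cw∣ = begin
            ∣ (Cℚ · w) R ∣                     ≤⟨ ∣∑∣≤∑∣∣ (λ F → Cℚ R F * w F) ⟩
            ∑ (λ F → ∣ Cℚ R F * w F ∣)         ≡⟨ ∑-cong (λ F → ℚₚ.∣p*q∣≡∣p∣*∣q∣ (Cℚ R F) (w F)) ⟩
            ∑ (λ F → ∣ Cℚ R F ∣ * ∣ w F ∣)     ≤⟨ ∑-mono (λ F → *-monoˡ ∣ Cℚ R F ∣ (ℚₚ.0≤∣p∣ (Cℚ R F))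
                                                   (term≤∑ (λ G → ℚₚ.0≤∣p∣ (w G)) F)) ⟩
            ∑ (λ F → ∣ Cℚ R F ∣ * W)           ≡⟨ *-distribʳ-sum W (λ F → ∣ Cℚ R F ∣) ⟨
            ∑ (λ F → ∣ Cℚ R F ∣) * W           ∎

      contra : ∀ δ → 0ℚ < δ → ¬ Eventually (λ n → b + δ ≤ seq μ n)
      contra δ 0<δ (N , b+δ≤μ) = v≉0 λ R → null-cong (λ n → ℚₚ.+-identityʳ (vₙ n R))
        (null-*-cancelˡ (0<* 0<δ 0<δ) (null-squeeze (N , λ n N≤n → δ²v≤ δ 0<δ n (b+δ≤μ n N≤n) R)
          (null-+ (null-*ˡ (∑ (λ F → ∣ Cℚ R F ∣)) (null-∑ λ F → null-abs (null-· Cᵀ residual→0 F)))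
            (null-*ˡ δ (null-abs (residual→0 R))))))

-- Power iteration for a nonnegative matrix

module PowerIteration {N : ℕ} (A : Matrix ℚ N N) (A≥0 : ∀ F G → 0ℚ ℚ.≤ A F G) where
  open RationalOrder
  open FromIntegers
  open RationalVectors
  open NullSequences
  open Eigenvalues
  open import Data.Rational.Base
  open import Algebra.Properties.Semiring.Exp ℚ-semiring using (_^_)

  pow : ℕ → Vect N → Vect N
  pow zero x = x
  pow (suc j) x = A · pow j x

  pow-nonneg : ∀ j {x} → (∀ F → 0ℚ ≤ x F) → ∀ F → 0ℚ ≤ pow j x F
  pow-nonneg zero h = h
  pow-nonneg (suc j) h = ·-nonneg A≥0 (pow-nonneg j h)

  pow-cong : ∀ j {x y} → (∀ F → x F ≡ y F) → ∀ F → pow j x F ≡ pow j y F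
  pow-cong zero h = h
  pow-cong (suc j) h = ·-cong A (pow-cong j h)

  pow-linear : ∀ j a b x y F → pow j (λ G → a * x G + b * y G) F ≡ a * pow j x F + b * pow j y F
  pow-linear zero a b x y F = refl
  pow-linear (suc j) a b x y F =
    trans (·-cong A (pow-linear j a b x y) F) (·-linear A a b (pow j x) (pow j y) F)

  pow-+ : ∀ i j x → pow i (pow j x) ≡ pow (i ℕ.+ j) x
  pow-+ zero j x = refl
  pow-+ (suc i) j x = cong (A ·_) (pow-+ i j x)

  pow-comm : ∀ i j x → pow i (pow j x) ≡ pow j (pow i x)
  pow-comm i j x = trans (pow-+ i j x) (trans (cong (λ k → pow k x) (ℕₚ.+-comm i j)) (sym (pow-+ j i x)))

  pow-scale : ∀ j a x F → pow j (λ G → a * x G) F ≡ a * pow j x F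
  pow-scale j a x F = trans (pow-cong j (λ G → e a (x G)) F)
    (trans (pow-linear j a 0ℚ x x F) (sym (e a (pow j x F))))
    where
    e : ∀ a x → a * x ≡ a * x + 0ℚ * x
    e = Solver.solve-∀ ℚ-ring

  pow-minus : ∀ j a x y F → pow j (λ G → y G - a * x G) F ≡ pow j y F - a * pow j x F
  pow-minus j a x y F = trans (pow-cong j (λ G → e (y G) a (x G)) F)
    (trans (pow-linear j 1ℚ (- a) y x F) (sym (e (pow j y F) a (pow j x F))))
    where
    e : ∀ y a x → y - a * x ≡ 1ℚ * y + - a * x
    e = Solver.solve-∀ ℚ-ring

  -- The sum of all entries dominates every column sum, hence bounds the growth of the 1-norm under
  -- `A`.
  ∑∑A : ℚ
  ∑∑A = ∑ λ F → ∑ λ G → A G F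

  ∑∑A≥0 : 0ℚ ≤ ∑∑A
  ∑∑A≥0 = ∑-nonneg λ F → ∑-nonneg λ G → A≥0 G F

  ∑A· : ∀ {x} → (∀ F → 0ℚ ≤ x F) → ∑ (A · x) ≤ ∑∑A * ∑ x
  ∑A· {x} x≥0 = begin
    ∑ (A · x)                         ≡⟨ ∑-· A x ⟩
    ∑ (λ F → ∑ (λ G → A G F) * x F)   ≤⟨ ∑-mono (λ F → *-monoʳ (x F) (x≥0 F)
                                           (term≤∑ (λ H → ∑-nonneg λ G → A≥0 G H) F)) ⟩
    ∑ (λ F → ∑∑A * x F)               ≡⟨ *-distribˡ-sum ∑∑A x ⟨
    ∑∑A * ∑ x                         ∎
    where open ℚₚ.≤-Reasoning

  ^-nonneg : ∀ {a} → 0ℚ ≤ a → ∀ j → 0ℚ ≤ a ^ j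
  ^-nonneg h zero = 0≤1
  ^-nonneg h (suc j) = 0≤* h (^-nonneg h j)

  ∑-pow : ∀ j {x} → (∀ F → 0ℚ ≤ x F) → ∑ (pow j x) ≤ ∑∑A ^ j * ∑ x
  ∑-pow zero {x} x≥0 = ℚₚ.≤-reflexive (sym (ℚₚ.*-identityˡ (∑ x)))
  ∑-pow (suc j) {x} x≥0 = begin
    ∑ (A · pow j x)              ≤⟨ ∑A· (pow-nonneg j x≥0) ⟩
    ∑∑A * ∑ (pow j x)            ≤⟨ *-monoˡ ∑∑A ∑∑A≥0 (∑-pow j x≥0) ⟩
    ∑∑A * (∑∑A ^ j * ∑ x)        ≡⟨ ℚₚ.*-assoc ∑∑A (∑∑A ^ j) (∑ x) ⟨
    ∑∑A * ∑∑A ^ j * ∑ x          ∎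
    where open ℚₚ.≤-Reasoning

  _≤[_]_ : Vect N → ℚ → Vect N → Set
  y ≤[ a ] x = ∀ F → y F ≤ a * x F

  _≥[_]_ : Vect N → ℚ → Vect N → Set
  y ≥[ a ] x = ∀ F → a * x F ≤ y F

  -- The sum of the ratios stands in for their maximum. The added 1 keeps `h` positive even when `y`
  -- vanishes, so that its reciprocal can be used.
  dominate : ∀ {k} (x y : Vect k) → (∀ i → 0ℚ < x i) → ∃ λ h → 0ℚ < h × (∀ i → y i ≤ h * x i)
  dominate {k} x y x>0 = 1ℚ + ∑ ratio , ℚₚ.+-mono-<-≤ 0<1 (∑-nonneg ratio≥0) , bound
    where
    open ℚₚ.≤-Reasoning
    ratio : Vect k
    ratio i = ∣ y i ∣ * recip (x i)
    ratio≥0 : ∀ i → 0ℚ ≤ ratio i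
    ratio≥0 i = 0≤* (ℚₚ.0≤∣p∣ (y i)) (ℚₚ.<⇒≤ (recip-pos (x>0 i)))
    bound : ∀ i → y i ≤ (1ℚ + ∑ ratio) * x i
    bound i = begin
      y i                               ≤⟨ p≤∣p∣ (y i) ⟩
      ∣ y i ∣                           ≡⟨ ℚₚ.*-identityʳ ∣ y i ∣ ⟨
      ∣ y i ∣ * 1ℚ                      ≡⟨ cong (∣ y i ∣ *_) (*-recip (x>0 i)) ⟨
      ∣ y i ∣ * (x i * recip (x i))     ≡⟨ e ∣ y i ∣ (x i) (recip (x i)) ⟩
      ratio i * x i                     ≤⟨ *-monoʳ (x i) (ℚₚ.<⇒≤ (x>0 i))
                                             (ℚₚ.≤-trans (term≤∑ ratio≥0 i) (≤-by {∑ ratio} 1ℚ 0≤1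
                                               (ℚₚ.+-comm 1ℚ (∑ ratio)))) ⟩
      (1ℚ + ∑ ratio) * x i              ∎
      where
      e : ∀ a b c → a * (b * c) ≡ a * c * b
      e = Solver.solve-∀ ℚ-ring

  -- As p has total 1, ∑ y is the p-weighted average of the ratios y F / p F.
  oscillation : ∀ {lo hi} {p y : Vect N} → (∀ F → 0ℚ ≤ p F) → ∑ p ≡ 1ℚ → y ≥[ lo ] p → y ≤[ hi ] p →
    ∀ F → ∣ y F - ∑ y * p F ∣ ≤ hi - lo
  oscillation {lo} {hi} {p} {y} p≥0 ∑p≡1 lo≤ ≤hi F = ℚₚ.≤-trans
      (∣p∣≤ (≤-by {y F - s * p F} {(hi - lo) * p F} ((hi * p F - y F) + (s - lo) * p F)
               (0≤+ (0≤-diff (≤hi F)) (0≤* (0≤-diff lo≤s) (p≥0 F))) (e₁ hi lo (p F) (y F) s))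
            (≤-by {(- (y F - s * p F))} {(hi - lo) * p F} ((hi - s) * p F + (y F - lo * p F))
               (0≤+ (0≤* (0≤-diff s≤hi) (p≥0 F)) (0≤-diff (lo≤ F))) (e₂ hi lo (p F) (y F) s)))
      (subst ((hi - lo) * p F ≤_) (ℚₚ.*-identityʳ (hi - lo))
        (*-monoˡ (hi - lo) (0≤-diff (ℚₚ.≤-trans lo≤s s≤hi)) (subst (p F ≤_) ∑p≡1 (term≤∑ p≥0 F))))
    where
    s : ℚ
    s = ∑ y
    total : ∀ a → ∑ (λ G → a * p G) ≡ a
    total a = trans (sym (*-distribˡ-sum a p)) (trans (cong (a *_) ∑p≡1) (ℚₚ.*-identityʳ a))
    lo≤s : lo ≤ s
    lo≤s = subst (_≤ s) (total lo) (∑-mono lo≤)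
    s≤hi : s ≤ hi
    s≤hi = subst (s ≤_) (total hi) (∑-mono ≤hi)
    e₁ : ∀ h l p y s → (h - l) * p ≡ (y - s * p) + ((h * p - y) + (s - l) * p)
    e₁ = Solver.solve-∀ ℚ-ring
    e₂ : ∀ h l p y s → (h - l) * p ≡ - (y - s * p) + ((h - s) * p + (y - l * p))
    e₂ = Solver.solve-∀ ℚ-ring

  -- `spreads` says that every entry of the `m`-th power of `A` is at least 1, phrased on vectors so
  -- that matrix powers are never formed.
  module Primitive (m : ℕ) (spreads : ∀ {x} → (∀ F → 0ℚ ≤ x F) → ∀ F G → x G ≤ pow m x F) where

    T : Vect N → Vect N
    T = pow m

    κ τ : ℚ
    κ = ι (ℤ.+ N)
    τ = ∑∑A ^ m

    ∑-const : ∀ k a → ∑ {k} (λ _ → a) ≡ ι (ℤ.+ k) * a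
    ∑-const zero a = sym (ℚₚ.*-zeroˡ a)
    ∑-const (suc k) a = trans (cong (a +_) (∑-const k a))
      (trans (e a (ι (ℤ.+ k))) (cong (_* a) (sym (ι-+ (ℤ.+ 1) (ℤ.+ k)))))
      where
      e : ∀ a k → a + k * a ≡ (1ℚ + k) * a
      e = Solver.solve-∀ ℚ-ring

    ∑≤κT : ∀ {x} → (∀ F → 0ℚ ≤ x F) → ∀ F → ∑ x ≤ κ * T x F
    ∑≤κT {x} x≥0 F = subst (∑ x ≤_) (∑-const N (T x F)) (∑-mono (spreads x≥0 F))

    T≤τ∑ : ∀ {x} → (∀ F → 0ℚ ≤ x F) → ∀ F → T x F ≤ τ * ∑ x
    T≤τ∑ x≥0 F = ℚₚ.≤-trans (term≤∑ (pow-nonneg m x≥0) F) (∑-pow m x≥0)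

    0≤κ : 0ℚ ≤ κ
    0≤κ = ι-nonneg N
    0≤τ : 0ℚ ≤ τ
    0≤τ = ^-nonneg ∑∑A≥0 m

    -- An entry of `T u` is at least `∑ u / κ` and one of `T x` at most `τ * ∑ x`, so an excess of
    -- average size spreads at the rate `1 / (κ τ)`. The half in `γ` comes from comparing with the
    -- midpoint of an interval; the 1 in `K` ensures `0 < K` and `γ ≤ 1`.
    K γ : ℚ
    K = 1ℚ + κ * τ
    γ = ½ * recip K

    1≤K : 1ℚ ≤ K
    1≤K = ≤-by (κ * τ) (0≤* 0≤κ 0≤τ) refl
    0<K : 0ℚ < K
    0<K = ℚₚ.<-≤-trans 0<1 1≤K
    0<γ : 0ℚ < γ
    0<γ = ½-pos (recip-pos 0<K)
    γ≤1 : γ ≤ 1ℚ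
    γ≤1 = ℚₚ.≤-trans (*-monoˡ ½ (ℚₚ.nonNegative⁻¹ ½) (recip≤1 1≤K)) (≤-by ½ (ℚₚ.nonNegative⁻¹ ½) refl)

    -- If y is on average at least halfway from lo·x to hi·x, then T spreads
    -- the excess over lo·x to every coordinate.
    raise : ∀ {lo hi x y} → (∀ F → 0ℚ ≤ x F) → lo ≤ hi → y ≥[ lo ] x → ½ * (lo + hi) * ∑ x ≤ ∑ y →
      T y ≥[ lo + γ * (hi - lo) ] T x
    raise {lo} {hi} {x} {y} x≥0 lo≤hi lo≤y half F =
      -- As `K * γ = ½`, multiplying by `K` reduces the claim to `Δ * T x F ≤ K * T u F` for the
      -- excess `u` of `y` over `lo * x`.
      *-cancelˡ K 0<K (≤-by {K * ((lo + γ * (hi - lo)) * T x F)} {K * T y F} d 0≤d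
        (e₀ K (recip K) lo hi (T x F) (T y F) (*-recip 0<K)))
      where
      open ℚₚ.≤-Reasoning
      u : Vect N
      u G = y G - lo * x G
      u≥0 : ∀ G → 0ℚ ≤ u G
      u≥0 G = 0≤-diff (lo≤y G)
      Δ : ℚ
      Δ = ½ * (hi - lo)
      0≤Δ : 0ℚ ≤ Δ
      0≤Δ = 0≤* (ℚₚ.nonNegative⁻¹ ½) (0≤-diff lo≤hi)
      d : ℚ
      d = K * (T y F - lo * T x F) - Δ * T x F
      Tu : T u F ≡ T y F - lo * T x F
      Tu = pow-minus m lo x y F
      0≤Tu : 0ℚ ≤ T u F
      0≤Tu = pow-nonneg m u≥0 F
      ∑u : ∑ u ≡ ∑ y - lo * ∑ x
      ∑u = trans (∑-cong λ G → e (y G) lo (x G)) (trans (∑-linear 1ℚ (- lo) y x) (sym (e (∑ y) lo (∑ x))))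
        where
        e : ∀ y a x → y - a * x ≡ 1ℚ * y + - a * x
        e = Solver.solve-∀ ℚ-ring
      0≤d : 0ℚ ≤ d
      0≤d = 0≤-diff (begin
        Δ * T x F
          ≤⟨ *-monoˡ Δ 0≤Δ (T≤τ∑ x≥0 F) ⟩
        Δ * (τ * ∑ x)
          ≡⟨ e₁ Δ τ (∑ x) ⟩
        τ * (Δ * ∑ x)
          ≤⟨ *-monoˡ τ 0≤τ (begin
               Δ * ∑ x               ≤⟨ 0≤-undiff {Δ * ∑ x} {∑ y - lo * ∑ x}
                 (subst (0ℚ ≤_) (e₂ lo hi (∑ x) (∑ y)) (0≤-diff half)) ⟩
               ∑ y - lo * ∑ x        ≡⟨ ∑u ⟨
               ∑ u                   ≤⟨ ∑≤κT u≥0 F ⟩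
               κ * T u F             ∎) ⟩
        τ * (κ * T u F)
          ≤⟨ ≤-by {τ * (κ * T u F)} {K * T u F} (T u F) 0≤Tu (e₃ κ τ (T u F)) ⟩
        K * T u F
          ≡⟨ cong (K *_) Tu ⟩
        K * (T y F - lo * T x F) ∎)
        where
        e₁ : ∀ a b c → a * (b * c) ≡ b * (a * c)
        e₁ = Solver.solve-∀ ℚ-ring
        e₂ : ∀ l h x y → y - ½ * (l + h) * x ≡ (y - l * x) - ½ * (h - l) * x
        e₂ = Solver.solve-∀ ℚ-ring
        e₃ : ∀ κ τ u → (1ℚ + κ * τ) * u ≡ τ * (κ * u) + u
        e₃ = Solver.solve-∀ ℚ-ring
      e₀ : ∀ K r l h x y → K * r ≡ 1ℚ →
        K * y ≡ K * ((l + ½ * r * (h - l)) * x) + (K * (y - l * x) - ½ * (h - l) * x)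
      e₀ K r l h x y Kr = trans (e K r l h x y) (trans
          (cong (λ z → z - (½ * (h - l) * x) + K * ((l + ½ * r * (h - l)) * x) + K * (y - l * x))
            (trans (cong (λ z → (1ℚ - z) * (½ * (h - l) * x)) Kr) (ℚₚ.*-zeroˡ (½ * (h - l) * x))))
          (e′ K r l h x y))
        where
        e : ∀ K r l h x y → K * y ≡ (1ℚ - K * r) * (½ * (h - l) * x) - (½ * (h - l) * x)
          + K * ((l + ½ * r * (h - l)) * x) + K * (y - l * x)
        e = Solver.solve-∀ ℚ-ring
        e′ : ∀ K r l h x y → 0ℚ - (½ * (h - l) * x) + K * ((l + ½ * r * (h - l)) * x) + K * (y - l * x)
          ≡ K * ((l + ½ * r * (h - l)) * x) + (K * (y - l * x) - ½ * (h - l) * x)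
        e′ = Solver.solve-∀ ℚ-ring

    α : ℚ
    α = 1ℚ - γ

    -- The ratios `y F / x F` lie in an interval of length `w`, written without division since
    -- entries of `x` are only known to be nonnegative. The length is exact, so that iterating
    -- yields exactly a power of `α` times the initial length.
    Squeezed : ℚ → Vect N → Vect N → Set
    Squeezed w x y = ∃₂ λ lo hi → lo ≤ hi × hi - lo ≡ w × y ≥[ lo ] x × y ≤[ hi ] x

    -- The average ratio lies in the upper or the lower half of the interval. In the upper half
    -- `raise` lifts the lower end; in the lower half `raise` applied to the negated vector, with
    -- ends `- hi` and `- lo`, brings down the upper end. Either way the length shrinks by `α`.
    contract : ∀ {w x y} → (∀ F → 0ℚ ≤ x F) → Squeezed w x y → Squeezed (α * w) (T x) (T y)
    contract {w} {x} {y} x≥0 (lo , hi , lo≤hi , refl , lo≤y , y≤hi) =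
        [ raised , lowered ]′ (ℚₚ.≤-total (½ * (lo + hi) * ∑ x) (∑ y))
      where
      0≤αw : 0ℚ ≤ α * (hi - lo)
      0≤αw = 0≤* (0≤-diff γ≤1) (0≤-diff lo≤hi)
      T≥ : T y ≥[ lo ] T x
      T≥ F = 0≤-undiff {lo * T x F} {T y F}
        (subst (0ℚ ≤_) (pow-minus m lo x y F) (pow-nonneg m (λ G → 0≤-diff (lo≤y G)) F))
      y⁻ : Vect N
      y⁻ F = - 1ℚ * y F
      T-neg : ∀ F → T y⁻ F ≡ - 1ℚ * T y F
      T-neg = pow-scale m (- 1ℚ) y
      flip : ∀ {a b p} → a ≤ b * p → - b * p ≤ - 1ℚ * a
      flip {a} {b} {p} h = 0≤-undiff {(- b) * p} {(- 1ℚ) * a} (subst (0ℚ ≤_) (e a b p) (0≤-diff h))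
        where
        e : ∀ a b p → b * p - a ≡ - 1ℚ * a - (- b) * p
        e = Solver.solve-∀ ℚ-ring
      unflip : ∀ {a b p} → b * p ≤ - 1ℚ * a → a ≤ (- b) * p
      unflip {a} {b} {p} h = 0≤-undiff {a} {(- b) * p} (subst (0ℚ ≤_) (e a b p) (0≤-diff h))
        where
        e : ∀ a b p → - 1ℚ * a - b * p ≡ (- b) * p - a
        e = Solver.solve-∀ ℚ-ring
      T≤ : T y ≤[ hi ] T x
      T≤ F = 0≤-undiff {T y F} {hi * T x F} (subst (0ℚ ≤_)
        (trans (pow-minus m (- hi) x y⁻ F)
          (trans (cong (_- (- hi) * T x F) (T-neg F)) (e (T y F) hi (T x F))))
        (pow-nonneg m (λ G → 0≤-diff (flip {y G} {hi} {x G} (y≤hi G))) F))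
        where
        e : ∀ a b p → - 1ℚ * a - (- b) * p ≡ b * p - a
        e = Solver.solve-∀ ℚ-ring
      squeezed : ∀ lo′ hi′ → hi′ - lo′ ≡ α * (hi - lo) → T y ≥[ lo′ ] T x → T y ≤[ hi′ ] T x →
        Squeezed (α * (hi - lo)) (T x) (T y)
      squeezed lo′ hi′ width h₁ h₂ =
        lo′ , hi′ , 0≤-undiff {lo′} {hi′} (subst (0ℚ ≤_) (sym width) 0≤αw) , width , h₁ , h₂
      raised : ½ * (lo + hi) * ∑ x ≤ ∑ y → Squeezed (α * (hi - lo)) (T x) (T y)
      raised half = squeezed (lo + γ * (hi - lo)) hi (e lo hi γ) (raise x≥0 lo≤hi lo≤y half) T≤
        where
        e : ∀ l h g → h - (l + g * (h - l)) ≡ (1ℚ - g) * (h - l)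
        e = Solver.solve-∀ ℚ-ring
      lowered : ∑ y ≤ ½ * (lo + hi) * ∑ x → Squeezed (α * (hi - lo)) (T x) (T y)
      lowered half = squeezed lo (- (- hi + γ * (- lo - - hi))) (e lo hi γ) T≥
          (λ F → unflip {T y F} {(- hi + γ * (- lo - - hi))} {T x F}
            (subst ((- hi + γ * (- lo - - hi)) * T x F ≤_) (T-neg F)
            (raise {y = y⁻} x≥0 (ℚₚ.neg-antimono-≤ lo≤hi) (λ G → flip {y G} {hi} {x G} (y≤hi G)) half′ F)))
        where
        e : ∀ l h g → - (- h + g * (- l - - h)) - l ≡ (1ℚ - g) * (h - l)
        e = Solver.solve-∀ ℚ-ring
        half′ : ½ * (- hi + - lo) * ∑ x ≤ ∑ y⁻
        half′ = subst (½ * (- hi + - lo) * ∑ x ≤_) (*-distribˡ-sum (- 1ℚ) y)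
          (0≤-undiff {½ * (- hi + - lo) * ∑ x} {(- 1ℚ) * ∑ y}
            (subst (0ℚ ≤_) (e″ lo hi (∑ x) (∑ y)) (0≤-diff half)))
          where
          e″ : ∀ l h x y → ½ * (l + h) * x - y ≡ - 1ℚ * y - ½ * (- h + - l) * x
          e″ = Solver.solve-∀ ℚ-ring

    -- The normalised iterates and the Perron pair

    normalise : Vect N → Vect N
    normalise x F = recip (∑ x) * x F

    ∑-normalise : ∀ {x} → 0ℚ < ∑ x → ∑ (normalise x) ≡ 1ℚ
    ∑-normalise {x} 0<∑ = trans (sym (*-distribˡ-sum (recip (∑ x)) x))
      (trans (ℚₚ.*-comm (recip (∑ x)) (∑ x)) (*-recip 0<∑))

    scale-≥ : ∀ {a b c x y} → 0ℚ ≤ c → a * x ≤ y → y ≡ b → a * (c * x) ≤ c * b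
    scale-≥ {a} {b} {c} {x} 0≤c h refl = ℚₚ.≤-trans (ℚₚ.≤-reflexive (e a c x)) (*-monoˡ c 0≤c h)
      where
      e : ∀ a c x → a * (c * x) ≡ c * (a * x)
      e = Solver.solve-∀ ℚ-ring

    scale-≤ : ∀ {a b c x y} → 0ℚ ≤ c → y ≤ a * x → y ≡ b → c * b ≤ a * (c * x)
    scale-≤ {a} {b} {c} {x} 0≤c h refl = ℚₚ.≤-trans (*-monoˡ c 0≤c h) (ℚₚ.≤-reflexive (e a c x))
      where
      e : ∀ a c x → c * (a * x) ≡ a * (c * x)
      e = Solver.solve-∀ ℚ-ring

    module _ (x₀ : Vect N) (x₀>0 : ∀ F → 0ℚ < x₀ F) (∑x₀>0 : 0ℚ < ∑ x₀) where

      p : ℕ → Vect N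
      p zero = normalise x₀
      p (suc n) = normalise (T (p n))

      Total : Vect N → Set
      Total x = (∀ F → 0ℚ ≤ x F) × ∑ x ≡ 1ℚ

      1≤∑T : ∀ {x} → Total x → 1ℚ ≤ ∑ (T x)
      1≤∑T {x} (x≥0 , ∑x≡1) = subst (_≤ ∑ (T x)) ∑x≡1 (∑-mono λ F → spreads x≥0 F F)

      0<∑T : ∀ {x} → Total x → 0ℚ < ∑ (T x)
      0<∑T h = ℚₚ.<-≤-trans 0<1 (1≤∑T h)

      p-total : ∀ n → Total (p n)
      p-total zero = (λ F → 0≤* (ℚₚ.<⇒≤ (recip-pos ∑x₀>0)) (ℚₚ.<⇒≤ (x₀>0 F))) , ∑-normalise ∑x₀>0
      p-total (suc n) =
        (λ F → 0≤* (ℚₚ.<⇒≤ (recip-pos (0<∑T (p-total n)))) (pow-nonneg m (proj₁ (p-total n)) F)) ,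
        ∑-normalise (0<∑T (p-total n))

      width : ℕ → ℚ
      width j = proj₁ (dominate (p 0) (pow j (p 0)) (λ F → 0<* (recip-pos ∑x₀>0) (x₀>0 F)))

      0<width : ∀ j → 0ℚ < width j
      0<width j = proj₁ (proj₂ (dominate (p 0) (pow j (p 0)) (λ F → 0<* (recip-pos ∑x₀>0) (x₀>0 F))))

      pow-p-suc : ∀ j n F → pow j (p (suc n)) F ≡ recip (∑ (T (p n))) * T (pow j (p n)) F
      pow-p-suc j n F = trans (pow-scale j (recip (∑ (T (p n)))) (T (p n)) F)
        (cong (λ y → recip (∑ (T (p n))) * y F) (pow-comm j m (p n)))

      -- `pow j` commutes with `T` and scalars, so passing from `p n` to `p (suc n)` transforms both
      -- vectors alike and `contract` applies. The case `j = m` gives convergence of the iterates,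
      -- the case `j = 1` the eigenvalue equation.
      squeezed : ∀ j n → Squeezed (α ^ n * width j) (p n) (pow j (p n))
      -- The first interval starts at 0: the ratios to the positive vector `p 0` are nonnegative,
      -- and `dominate` bounds them above.
      squeezed j zero = 0ℚ , width j , ℚₚ.<⇒≤ (0<width j) ,
        trans (ℚₚ.+-identityʳ (width j)) (sym (ℚₚ.*-identityˡ (width j))) ,
        (λ F → ℚₚ.≤-trans (ℚₚ.≤-reflexive (ℚₚ.*-zeroˡ (p 0 F))) (pow-nonneg j (proj₁ (p-total 0)) F)) ,
        proj₂ (proj₂ (dominate (p 0) (pow j (p 0)) (λ F → 0<* (recip-pos ∑x₀>0) (x₀>0 F))))
      squeezed j (suc n) = rescale (contract (proj₁ (p-total n)) (squeezed j n))
        where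
        s : ℚ
        s = recip (∑ (T (p n)))
        0≤s : 0ℚ ≤ s
        0≤s = ℚₚ.<⇒≤ (recip-pos (0<∑T (p-total n)))
        rescale : Squeezed (α * (α ^ n * width j)) (T (p n)) (T (pow j (p n))) →
          Squeezed (α ^ suc n * width j) (p (suc n)) (pow j (p (suc n)))
        rescale (lo , hi , lo≤hi , w≡ , lo≤ , ≤hi) =
          lo , hi , lo≤hi , trans w≡ (sym (ℚₚ.*-assoc α (α ^ n) (width j))) ,
          (λ F → subst (lo * (s * T (p n) F) ≤_) (sym (pow-p-suc j n F))
            (scale-≥ {lo} {T (pow j (p n)) F} {s} {T (p n) F} 0≤s (lo≤ F) refl)) ,
          (λ F → subst (_≤ hi * (s * T (p n) F)) (sym (pow-p-suc j n F))
            (scale-≤ {hi} {T (pow j (p n)) F} {s} {T (p n) F} 0≤s (≤hi F) refl))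

      oscillates : ∀ j n F → ∣ pow j (p n) F - ∑ (pow j (p n)) * p n F ∣ ≤ α ^ n * width j
      oscillates j n F = go (squeezed j n)
        where
        go : Squeezed (α ^ n * width j) (p n) (pow j (p n)) → _
        go (lo , hi , lo≤hi , w≡ , lo≤ , ≤hi) = subst (∣ pow j (p n) F - ∑ (pow j (p n)) * p n F ∣ ≤_) w≡
          (oscillation {lo} {hi} (proj₁ (p-total n)) (proj₂ (p-total n)) lo≤ ≤hi F)

      -- With `S = ∑ (T (p n))` the step equals `(T (p n) - S * p n) / S`. Since `S` is at least 1,
      -- the oscillation bound for `j = m` carries over.
      p-step : ∀ F n → ∣ p (suc n) F - p n F ∣ ≤ α ^ n * width m
      p-step F n = begin
        ∣ s * T (p n) F - p n F ∣
          ≡⟨ cong (λ z → ∣ s * T (p n) F - z ∣)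
            (trans (sym (ℚₚ.*-identityˡ (p n F)))
              (cong (_* p n F) (sym (trans (ℚₚ.*-comm s S) (*-recip (0<∑T (p-total n))))))) ⟩
        ∣ s * T (p n) F - s * S * p n F ∣
          ≡⟨ cong ∣_∣ (e s (T (p n) F) S (p n F)) ⟩
        ∣ s * (T (p n) F - S * p n F) ∣
          ≡⟨ trans (ℚₚ.∣p*q∣≡∣p∣*∣q∣ s Y) (cong (_* ∣ Y ∣) (ℚₚ.0≤p⇒∣p∣≡p 0≤s)) ⟩
        s * ∣ Y ∣
          ≤⟨ *-monoʳ ∣ Y ∣ (ℚₚ.0≤∣p∣ Y) (recip≤1 (1≤∑T (p-total n))) ⟩
        1ℚ * ∣ Y ∣
          ≡⟨ ℚₚ.*-identityˡ ∣ Y ∣ ⟩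
        ∣ Y ∣
          ≤⟨ oscillates m n F ⟩
        α ^ n * width m ∎
        where
        open ℚₚ.≤-Reasoning
        S s Y : ℚ
        S = ∑ (T (p n))
        s = recip S
        Y = T (p n) F - S * p n F
        0≤s : 0ℚ ≤ s
        0≤s = ℚₚ.<⇒≤ (recip-pos (0<∑T (p-total n)))
        e : ∀ s t S p → s * t - s * S * p ≡ s * (t - S * p)
        e = Solver.solve-∀ ℚ-ring

      perronVector : Fin N → ℝ
      perronVector F = mkℝ (λ n → p n F)
        (geometric-cauchy 0<γ γ≤1 (λ n → p n F) (ℚₚ.<⇒≤ (0<width m)) (p-step F))

      -- As each `p n` has total 1, the eigenvalue is the limit of the totals of `A · p n`. Building
      -- it from finite operations on reals supplies its Cauchy property.
      perronValue : ℝ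
      perronValue = ∑ℝ λ F → ∑ℝ λ G → fromℚ (A F G) *ℝ perronVector G

      seq-perronValue : ∀ n → seq perronValue n ≡ ∑ (A · p n)
      seq-perronValue n = trans (seq-∑ℝ (λ F → ∑ℝ λ G → fromℚ (A F G) *ℝ perronVector G) n)
        (∑-cong λ F → seq-∑ℝ (λ G → fromℚ (A F G) *ℝ perronVector G) n)

      perron-residual : ∀ F → Null (λ n → (A · p n) F - seq perronValue n * p n F)
      perron-residual F = null-squeeze (0 , λ n _ → ℚₚ.≤-trans
          (subst (λ s → ∣ (A · p n) F - s * p n F ∣ ≤ α ^ n * width 1) (sym (seq-perronValue n))
            (oscillates 1 n F))
          (ℚₚ.≤-trans (ℚₚ.≤-reflexive (ℚₚ.*-comm (α ^ n) (width 1))) (p≤∣p∣ (width 1 * α ^ n))))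
        (null-*ˡ (width 1) (power-null 0<γ γ≤1))

      -- `T` preserves inequalities and commutes with `A`, so `c x ≤ A x` passes from `x₀` to every
      -- iterate; summing over the entries, of total 1, gives the bound.
      perronValue≥ : ∀ c → pow 1 x₀ ≥[ c ] x₀ → ∀ n → c ≤ seq perronValue n
      perronValue≥ c c≤ n = subst (c ≤_) (sym (seq-perronValue n))
          (subst (_≤ ∑ (A · p n)) (trans (sym (*-distribˡ-sum c (p n)))
            (trans (cong (c *_) (proj₂ (p-total n))) (ℚₚ.*-identityʳ c)))
            (∑-mono (growth n)))
        where
        growth : ∀ n → pow 1 (p n) ≥[ c ] p n
        growth zero F = subst (c * p 0 F ≤_) (sym (pow-scale 1 (recip (∑ x₀)) x₀ F))
          (scale-≥ {c} {pow 1 x₀ F} {recip (∑ x₀)} {x₀ F} (ℚₚ.<⇒≤ (recip-pos ∑x₀>0)) (c≤ F) refl)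
        growth (suc n) F = subst (c * p (suc n) F ≤_) (sym (pow-p-suc 1 n F))
          (scale-≥ {c} {T (pow 1 (p n)) F} {recip (∑ (T (p n)))} {T (p n) F}
            (ℚₚ.<⇒≤ (recip-pos (0<∑T (p-total n))))
            (0≤-undiff {c * T (p n) F} {T (pow 1 (p n)) F}
              (subst (0ℚ ≤_) (pow-minus m c (p n) (pow 1 (p n)) F)
              (pow-nonneg m (λ G → 0≤-diff (growth n G)) F))) refl)

  -- A positive power from connectedness

  step-≥ : ∀ {F G y} → 1ℚ ≤ A F G → (∀ H → 0ℚ ≤ y H) → y G ≤ (A · y) F
  step-≥ {F} {G} {y} 1≤A y≥0 = begin
    y G            ≡⟨ ℚₚ.*-identityˡ (y G) ⟨
    1ℚ * y G       ≤⟨ *-monoʳ (y G) (y≥0 G) 1≤A ⟩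
    A F G * y G    ≤⟨ term≤∑ (λ H → 0≤* (A≥0 F H) (y≥0 H)) G ⟩
    (A · y) F      ∎
    where open ℚₚ.≤-Reasoning

  module Connected (diagonal : ∀ F → 1ℚ ≤ A F F) {Edge : Fin N → Fin N → Set}
    (edge : ∀ {F G} → Edge F G → 1ℚ ≤ A F G) (connected : ∀ F G → Star Edge F G) where

    distance : ∀ {F G} → Star Edge F G → ℕ
    distance ∎⋆ = 0
    distance (_ ◅ path) = suc (distance path)

    along : ∀ {F G} (path : Star Edge F G) {x} → (∀ H → 0ℚ ≤ x H) → x G ≤ pow (distance path) x F
    along ∎⋆ x≥0 = ℚₚ.≤-refl
    along (e ◅ path) x≥0 = ℚₚ.≤-trans (along path x≥0) (step-≥ (edge e) (pow-nonneg (distance path) x≥0))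

    -- The diagonal entries let a walk pause, so walks of different lengths can be padded to one
    -- common length.
    pow-monotone : ∀ {i j x} → (∀ H → 0ℚ ≤ x H) → i ℕ.≤ j → ∀ F → pow i x F ≤ pow j x F
    pow-monotone {i} {x = x} x≥0 i≤j F = go (ℕₚ.≤⇒≤′ i≤j)
      where
      go : ∀ {j} → i ℕ.≤′ j → pow i x F ≤ pow j x F
      go (ℕ.≤′-reflexive refl) = ℚₚ.≤-refl
      go {suc j} (ℕ.≤′-step h) = ℚₚ.≤-trans (go h) (step-≥ (diagonal F) (pow-nonneg j x≥0))

    -- The sum of the lengths of all chosen paths, an easy upper bound for each of them; it need not
    -- be the graph diameter.
    diameter : ℕ
    diameter = Counting.∑ λ F → Counting.∑ λ G → distance (connected F G)

    spreads : ∀ {x} → (∀ F → 0ℚ ≤ x F) → ∀ F G → x G ≤ pow diameter x F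
    spreads x≥0 F G = ℚₚ.≤-trans (along (connected F G) x≥0) (pow-monotone x≥0
      (ℕₚ.≤-trans (Counting.term≤∑ (λ G → distance (connected F G)) G)
        (Counting.term≤∑ (λ F → Counting.∑ λ G → distance (connected F G)) F)) F)

    open Primitive diameter spreads

    -- A subeigenvector for c that is strict somewhere becomes strict everywhere
    -- after applying T, so the Perron value exceeds c.
    larger-eigenvalue : ∀ {c x} → (∀ F → 0ℚ ≤ x F) → (∀ F → c * x F ≤ (A · x) F) →
      ∀ {F₀} → 1ℚ ≤ x F₀ → ∀ {F₁} → 1ℚ ≤ (A · x) F₁ - c * x F₁ →
      ∃ λ (v : Fin N → ℝ) → ∃ λ μ → ∃ λ δ → 0ℚ < δ ×
        (∀ F → Null (λ n → (A · (λ G → seq (v G) n)) F - seq μ n * seq (v F) n)) ×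
        (∀ n → ∑ (λ F → seq (v F) n) ≡ 1ℚ) × (∀ n → c + δ ≤ seq μ n)
    larger-eigenvalue {c} {x} x≥0 cx≤Ax {F₀} 1≤x {F₁} 1≤u =
      perronVector x₀ x₀>0 ∑x₀>0 , perronValue x₀ x₀>0 ∑x₀>0 , δ , recip-pos 0<h ,
      perron-residual x₀ x₀>0 ∑x₀>0 , (λ n → proj₂ (p-total x₀ x₀>0 ∑x₀>0 n)) ,
      perronValue≥ x₀ x₀>0 ∑x₀>0 (c + δ) growth
      where
      x₀ : Vect N
      x₀ = T x
      x₀>0 : ∀ F → 0ℚ < x₀ F
      x₀>0 F = ℚₚ.<-≤-trans 0<1 (ℚₚ.≤-trans 1≤x (spreads x≥0 F F₀))
      ∑x₀>0 : 0ℚ < ∑ x₀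
      ∑x₀>0 = ℚₚ.<-≤-trans (x₀>0 F₀) (term≤∑ (λ F → ℚₚ.<⇒≤ (x₀>0 F)) F₀)
      dominated : ∃ λ h → 0ℚ < h × (∀ F → x₀ F ≤ h * 1ℚ)
      dominated = dominate (λ _ → 1ℚ) x₀ (λ _ → 0<1)
      h : ℚ
      h = proj₁ dominated
      0<h : 0ℚ < h
      0<h = proj₁ (proj₂ dominated)
      -- `h` bounds all entries of `x₀`, so `δ * x₀` is at most 1, which is at most `T u`, the
      -- excess of `A x₀` over `c x₀`.
      δ : ℚ
      δ = recip h
      u : Vect N
      u F = (A · x) F - c * x F
      1≤Tu : ∀ F → 1ℚ ≤ T u F
      1≤Tu F = ℚₚ.≤-trans 1≤u (spreads (λ G → 0≤-diff (cx≤Ax G)) F F₁)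
      Tu : ∀ F → T u F ≡ pow 1 x₀ F - c * x₀ F
      Tu F = trans (pow-minus diameter c x (A · x) F) (cong (λ y → y F - c * x₀ F) (pow-comm diameter 1 x))
      δx₀≤1 : ∀ F → δ * x₀ F ≤ 1ℚ
      δx₀≤1 F = ℚₚ.≤-trans (*-monoˡ δ (ℚₚ.<⇒≤ (recip-pos 0<h)) (proj₂ (proj₂ dominated) F))
        (ℚₚ.≤-reflexive (trans (cong (δ *_) (ℚₚ.*-identityʳ h)) (trans (ℚₚ.*-comm δ h) (*-recip 0<h))))
      growth : ∀ F → (c + δ) * x₀ F ≤ pow 1 x₀ F
      growth F = 0≤-undiff {(c + δ) * x₀ F} {pow 1 x₀ F} (subst (0ℚ ≤_)
        (trans (cong (_- δ * x₀ F) (Tu F)) (e (pow 1 x₀ F) c δ (x₀ F)))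
        (0≤-diff (ℚₚ.≤-trans (δx₀≤1 F) (1≤Tu F))))
        where
        e : ∀ y c d x → (y - c * x) - d * x ≡ y - (c + d) * x
        e = Solver.solve-∀ ℚ-ring

open import Data.Fin.Subset using (Subset; _∈_; _∉_; _⊆_; _-_; ⁅_⁆; _∩_; ∣_∣)
import Data.Fin.Subset.Properties as Subsetₚ

-- Inversions and signs of sequences

module Signs where
  open Counting
  open import Data.Nat.Base using (_+_; _*_)

  χ : ∀ {n} → Fin n → Fin n → ℕ
  χ i j = 𝟙 (i Finₚ.<? j)

  χ-diag : ∀ {n} (i : Fin n) → χ i i ≡ 0
  χ-diag i = 𝟙-no (i Finₚ.<? i) (Finₚ.<-irrefl refl)

  χ-total : ∀ {n} {i j : Fin n} → i ≢ j → χ i j + χ j i ≡ 1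
  χ-total {i = i} {j} i≢j with Finₚ.<-cmp i j
  ... | tri< i<j _ j≮i = cong₂ _+_ (𝟙-yes (i Finₚ.<? j) i<j) (𝟙-no (j Finₚ.<? i) j≮i)
  ... | tri≈ _ i≡j _ = contradiction i≡j i≢j
  ... | tri> i≮j _ j<i = cong₂ _+_ (𝟙-no (i Finₚ.<? j) i≮j) (𝟙-yes (j Finₚ.<? i) j<i)

  ∑χ : ∀ {n} (i : Fin n) → ∑ (λ j → χ j i) ≡ toℕ i
  ∑χ {suc n} zero = ∑-zero {suc n} λ _ → refl
  ∑χ (suc i) = cong suc (∑χ i)

  χ-punchIn : ∀ {n} (i : Fin (suc n)) a b → χ (punchIn i a) (punchIn i b) ≡ χ a b
  χ-punchIn i a b = cases (a Finₚ.<? b)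
    where
    cases : Dec _ → _
    cases (yes a<b) = trans
      (𝟙-yes (punchIn i a Finₚ.<? punchIn i b) (ℕₚ.≰⇒> λ h → ℕₚ.<⇒≱ a<b (Finₚ.punchIn-cancel-≤ i b a h)))
      (sym (𝟙-yes (a Finₚ.<? b) a<b))
    cases (no a≮b) = trans
      (𝟙-no (punchIn i a Finₚ.<? punchIn i b) (ℕₚ.≤⇒≯ (Finₚ.punchIn-mono-≤ i b a (ℕₚ.≮⇒≥ a≮b))))
      (sym (𝟙-no (a Finₚ.<? b) a≮b))

  Injection : ∀ {s n} → (Fin s → Fin n) → Set
  Injection f = ∀ {i j} → f i ≡ f j → i ≡ j

  -- Inversions of an arbitrary sequence, so that a list of vertices, its reorderings and its
  -- deletions are treated alike.
  inv : ∀ {s n} → (Fin s → Fin n) → ℕ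
  inv f = ∑ λ i → ∑ λ j → χ i j * χ (f j) (f i)

  inversions≡inv : ∀ {s} (π : Permutation′ s) → inversions π ≡ inv (π ⟨$⟩ʳ_)
  inversions≡inv π = trans (length-filter-product
    (λ (i , j) → (i Finₚ.<? j) ×-dec (π ⟨$⟩ʳ j Finₚ.<? π ⟨$⟩ʳ i)) id id)
    (∑∑-cong λ i j → 𝟙-× (i Finₚ.<? j) (π ⟨$⟩ʳ j Finₚ.<? π ⟨$⟩ʳ i))

  sign : ℕ → ℤ
  sign n = ℤ.-1ℤ ℤ.^ n

  sign-+ : ∀ m n → sign (m + n) ≡ sign m ℤ.* sign n
  sign-+ = ℤₚ.^-distribˡ-+-* ℤ.-1ℤ

  sign-square : ∀ n → sign n ℤ.* sign n ≡ ℤ.1ℤ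
  sign-square zero = refl
  sign-square (suc n) = trans (e (sign n)) (sign-square n)
    where
    e : ∀ x → ℤ.-1ℤ ℤ.* x ℤ.* (ℤ.-1ℤ ℤ.* x) ≡ x ℤ.* x
    e = ℤ-solve-∀

  sign-double : ∀ m x → sign (m + (x + x)) ≡ sign m
  sign-double m x = trans (sign-+ m (x + x))
    (trans (cong (sign m ℤ.*_) (trans (sign-+ x x) (sign-square x))) (ℤₚ.*-identityʳ (sign m)))

  -- Discordance of a pair is exclusive-or additive under composition; summing
  -- it over all ordered pairs, which π permutes, counts every inversion twice.
  inv-∘ : ∀ {s n} {f : Fin s → Fin n} → Injection f → (π : Permutation′ s) →
    sign (inv (f ∘ (π ⟨$⟩ʳ_))) ≡ sign (inv (π ⟨$⟩ʳ_)) ℤ.* sign (inv f)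
  inv-∘ {s} {f = f} f-inj π = begin
      sign (inv (f ∘ π′))                          ≡⟨ sign-double (inv (f ∘ π′)) X ⟨
      sign (inv (f ∘ π′) + (X + X))                ≡⟨ cong sign parity ⟩
      sign (inv π′ + Y)                            ≡⟨ cong (λ y → sign (inv π′ + y)) Y≡inv ⟩
      sign (inv π′ + inv f)                        ≡⟨ sign-+ (inv π′) (inv f) ⟩
      sign (inv π′) ℤ.* sign (inv f)               ∎
    where
    open ≡-Reasoning
    π′ : Fin s → Fin s
    π′ = π ⟨$⟩ʳ_
    π-inj : Injection π′
    π-inj {i} {j} eq = trans (sym (Inverse.strictlyInverseʳ π i))
      (trans (cong (Inverse.from π) eq) (Inverse.strictlyInverseʳ π j))
    e : Fin s → Fin s → ℕ
    e x y = χ x y * χ (f y) (f x) + χ y x * χ (f x) (f y)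
    -- For bits, `a xor b + 2 a b = a + b`: `X` collects the products `a b`, whose double drops out
    -- of the sign, and `Y` counts the discordant pairs of `f` reached through `π`.
    X Y : ℕ
    X = ∑ λ i → ∑ λ j → χ i j * (χ (π′ j) (π′ i) * e (π′ i) (π′ j))
    Y = ∑ λ i → ∑ λ j → χ i j * e (π′ i) (π′ j)

    xor : ∀ p p′ q q′ → p + p′ ≡ 1 → q + q′ ≡ 1 →
      q′ + (p′ * (p * q′ + p′ * q) + p′ * (p * q′ + p′ * q)) ≡ p′ + (p * q′ + p′ * q)
    xor zero (suc zero) zero (suc zero) _ _ = refl
    xor zero (suc zero) (suc zero) zero _ _ = refl
    xor (suc zero) zero zero (suc zero) _ _ = refl
    xor (suc zero) zero (suc zero) zero _ _ = refl
    xor zero (suc (suc _)) _ _ () _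
    xor zero zero _ _ () _
    xor (suc zero) (suc _) _ _ () _
    xor (suc (suc _)) _ _ _ () _
    xor _ _ zero (suc (suc _)) _ ()
    xor _ _ zero zero _ ()
    xor _ _ (suc zero) (suc _) _ ()
    xor _ _ (suc (suc _)) _ _ ()

    pointwise : ∀ i j → χ i j * χ (f (π′ j)) (f (π′ i)) +
      (χ i j * (χ (π′ j) (π′ i) * e (π′ i) (π′ j)) + χ i j * (χ (π′ j) (π′ i) * e (π′ i) (π′ j)))
      ≡ χ i j * χ (π′ j) (π′ i) + χ i j * e (π′ i) (π′ j)
    pointwise i j with i Finₚ.≟ j
    ... | yes refl rewrite χ-diag i = refl
    ... | no i≢j = trans (factor (χ i j) (χ (f (π′ j)) (f (π′ i))) (χ (π′ j) (π′ i) * e (π′ i) (π′ j)))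
      (trans (cong (χ i j *_) (xor (χ (π′ i) (π′ j)) (χ (π′ j) (π′ i)) (χ (f (π′ i)) (f (π′ j)))
        (χ (f (π′ j)) (f (π′ i)))
        (χ-total (i≢j ∘ π-inj)) (χ-total (i≢j ∘ π-inj ∘ f-inj))))
        (ℕₚ.*-distribˡ-+ (χ i j) (χ (π′ j) (π′ i)) (e (π′ i) (π′ j))))
      where
      factor : ∀ a b c → a * b + (a * c + a * c) ≡ a * (b + (c + c))
      factor = ℕ-solve-∀

    parity : inv (f ∘ π′) + (X + X) ≡ inv π′ + Y
    parity = trans (cong (inv (f ∘ π′) +_) (sym (∑∑-+ x x)))
      (trans (sym (∑∑-+ (λ i j → χ i j * χ (f (π′ j)) (f (π′ i))) (λ i j → x i j + x i j)))
      (trans (∑∑-cong pointwise) (∑∑-+ (λ i j → χ i j * χ (π′ j) (π′ i)) (λ i j → χ i j * e (π′ i) (π′ j)))))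
      where
      x : Fin s → Fin s → ℕ
      x i j = χ i j * (χ (π′ j) (π′ i) * e (π′ i) (π′ j))

    e-sym : ∀ x y → e x y ≡ e y x
    e-sym x y = ℕₚ.+-comm (χ x y * χ (f y) (f x)) (χ y x * χ (f x) (f y))

    e-diag : ∀ x → e x x ≡ 0
    e-diag x rewrite χ-diag x = refl

    halves : ∀ i j → χ i j * e (π′ i) (π′ j) + χ j i * e (π′ j) (π′ i) ≡ e (π′ i) (π′ j)
    halves i j with i Finₚ.≟ j
    ... | yes refl rewrite e-diag (π′ i) | ℕₚ.*-zeroʳ (χ i i) = refl
    ... | no i≢j = begin
      χ i j * e (π′ i) (π′ j) + χ j i * e (π′ j) (π′ i)
        ≡⟨ cong (λ z → χ i j * e (π′ i) (π′ j) + χ j i * z) (e-sym (π′ j) (π′ i)) ⟩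
      χ i j * e (π′ i) (π′ j) + χ j i * e (π′ i) (π′ j)
        ≡⟨ ℕₚ.*-distribʳ-+ (e (π′ i) (π′ j)) (χ i j) (χ j i) ⟨
      (χ i j + χ j i) * e (π′ i) (π′ j)                  ≡⟨ cong (_* e (π′ i) (π′ j)) (χ-total i≢j) ⟩
      1 * e (π′ i) (π′ j)                                ≡⟨ ℕₚ.*-identityˡ (e (π′ i) (π′ j)) ⟩
      e (π′ i) (π′ j)                                    ∎

    Y+Y : Y + Y ≡ inv f + inv f
    Y+Y = begin
      Y + Y
        ≡⟨ cong (Y +_) (∑-comm (λ i j → χ i j * e (π′ i) (π′ j))) ⟩
      Y + ∑ (λ i → ∑ λ j → χ j i * e (π′ j) (π′ i))
        ≡⟨ ∑∑-+ (λ i j → χ i j * e (π′ i) (π′ j)) (λ i j → χ j i * e (π′ j) (π′ i)) ⟨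
      ∑ (λ i → ∑ λ j → χ i j * e (π′ i) (π′ j) + χ j i * e (π′ j) (π′ i))
        ≡⟨ ∑∑-cong halves ⟩
      ∑ (λ i → ∑ λ j → e (π′ i) (π′ j))
        ≡⟨ ∑-cong (λ i → sum-permute (e (π′ i)) π) ⟨
      ∑ (λ i → ∑ λ j → e (π′ i) j)
        ≡⟨ sum-permute (λ i → ∑ (e i)) π ⟨
      ∑ (λ i → ∑ λ j → e i j)
        ≡⟨ ∑∑-+ (λ i j → χ i j * χ (f j) (f i)) (λ i j → χ j i * χ (f i) (f j)) ⟩
      inv f + ∑ (λ i → ∑ λ j → χ j i * χ (f i) (f j))
        ≡⟨ cong (inv f +_) (∑-comm (λ i j → χ j i * χ (f i) (f j))) ⟩
      inv f + inv f ∎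

    Y≡inv : Y ≡ inv f
    Y≡inv = half Y (inv f) Y+Y
      where
      half : ∀ a b → a + a ≡ b + b → a ≡ b
      half a b eq with ℕₚ.<-cmp a b
      ... | tri< a<b _ _ = contradiction eq (ℕₚ.<⇒≢ (ℕₚ.+-mono-< a<b a<b))
      ... | tri≈ _ a≡b _ = a≡b
      ... | tri> _ _ b<a = contradiction (sym eq) (ℕₚ.<⇒≢ (ℕₚ.+-mono-< b<a b<a))

  -- For an injective `f`, the rank of `f i` among the values in increasing order; it depends on the
  -- set of values, not on their listing.
  below : ∀ {s n} → (Fin s → Fin n) → Fin s → ℕ
  below f i = ∑ λ j → χ (f j) (f i)

  -- Of the j before i, those with f j > f i are inversions with i; so are the
  -- j after i with f j < f i. Their number is i + below f i modulo 2.
  inv-punchIn : ∀ {s n} {f : Fin (suc s) → Fin n} → Injection f → ∀ i →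
    sign (toℕ i) ℤ.* sign (inv (f ∘ punchIn i)) ≡ sign (inv f) ℤ.* sign (below f i)
  inv-punchIn {s} {f = f} f-inj i = begin
      sign (toℕ i) ℤ.* sign (inv g)              ≡⟨ sign-+ (toℕ i) (inv g) ⟨
      sign (toℕ i + inv g)                       ≡⟨ sign-double (toℕ i + inv g) R ⟨
      sign (toℕ i + inv g + (R + R))             ≡⟨ cong sign count ⟨
      sign (inv f + below f i)                   ≡⟨ sign-+ (inv f) (below f i) ⟩
      sign (inv f) ℤ.* sign (below f i)          ∎
    where
    open ≡-Reasoning
    g : Fin s → _
    g = f ∘ punchIn i
    -- Entries compared with the `i`-th: `R` later and smaller, `C` earlier and larger, `P` earlier
    -- and smaller. Only `R` occurs both in `inv f` and in `below f i`.
    R C P : ℕ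
    R = ∑ λ j → χ i j * χ (f j) (f i)
    C = ∑ λ j → χ j i * χ (f i) (f j)
    P = ∑ λ j → χ j i * χ (f j) (f i)

    inv-split : inv f ≡ R + (C + inv g)
    inv-split = trans (sum-remove {i = i} (λ a → ∑ λ b → χ a b * χ (f b) (f a))) (cong (R +_) (begin
      ∑ (λ a → ∑ λ b → χ (punchIn i a) b * χ (f b) (g a))
        ≡⟨ ∑-cong (λ a → sum-remove {i = i} (λ b → χ (punchIn i a) b * χ (f b) (g a))) ⟩
      ∑ (λ a → χ (punchIn i a) i * χ (f i) (g a) + ∑ λ b → χ (punchIn i a) (punchIn i b) * χ (g b) (g a))
        ≡⟨ ∑-distrib-+ (λ a → χ (punchIn i a) i * χ (f i) (g a))
          (λ a → ∑ λ b → χ (punchIn i a) (punchIn i b) * χ (g b) (g a)) ⟩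
      ∑ (λ a → χ (punchIn i a) i * χ (f i) (g a)) +
        ∑ (λ a → ∑ λ b → χ (punchIn i a) (punchIn i b) * χ (g b) (g a))
        ≡⟨ cong₂ _+_ (sym (trans (sum-remove {i = i} (λ a → χ a i * χ (f i) (f a)))
              (cong (λ z → z * χ (f i) (f i) + ∑ (λ a → χ (punchIn i a) i * χ (f i) (g a))) (χ-diag i))))
            (∑∑-cong λ a b → cong (_* χ (g b) (g a)) (χ-punchIn i a b)) ⟩
      C + inv g ∎))

    below-split : below f i ≡ R + P
    below-split = trans (∑-cong pointwise)
      (∑-distrib-+ (λ j → χ i j * χ (f j) (f i)) (λ j → χ j i * χ (f j) (f i)))
      where
      pointwise : ∀ j → χ (f j) (f i) ≡ χ i j * χ (f j) (f i) + χ j i * χ (f j) (f i)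
      pointwise j with i Finₚ.≟ j
      ... | yes refl rewrite χ-diag (f i) | ℕₚ.*-zeroʳ (χ i i) = refl
      ... | no i≢j = trans (sym (trans (cong (_* χ (f j) (f i)) (χ-total i≢j))
        (ℕₚ.*-identityˡ (χ (f j) (f i)))))
        (ℕₚ.*-distribʳ-+ (χ (f j) (f i)) (χ i j) (χ j i))

    C+P : C + P ≡ toℕ i
    C+P = trans (sym (∑-distrib-+ (λ j → χ j i * χ (f i) (f j)) (λ j → χ j i * χ (f j) (f i))))
      (trans (∑-cong pointwise) (∑χ i))
      where
      pointwise : ∀ j → χ j i * χ (f i) (f j) + χ j i * χ (f j) (f i) ≡ χ j i
      pointwise j with i Finₚ.≟ j
      ... | yes refl rewrite χ-diag i = refl
      ... | no i≢j = trans (sym (ℕₚ.*-distribˡ-+ (χ j i) (χ (f i) (f j)) (χ (f j) (f i))))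
        (trans (cong (χ j i *_) (χ-total (i≢j ∘ f-inj))) (ℕₚ.*-identityʳ (χ j i)))

    count : inv f + below f i ≡ toℕ i + inv g + (R + R)
    count = begin
      inv f + below f i                ≡⟨ cong₂ _+_ inv-split below-split ⟩
      R + (C + inv g) + (R + P)        ≡⟨ e R C (inv g) P ⟩
      C + P + inv g + (R + R)          ≡⟨ cong (λ z → z + inv g + (R + R)) C+P ⟩
      toℕ i + inv g + (R + R)          ∎
      where
      e : ∀ r c g p → r + (c + g) + (r + p) ≡ c + p + g + (r + r)
      e = ℕ-solve-∀

x∉p-x : ∀ {n} (p : Subset n) x → x ∉ p - x
x∉p-x (true Vec.∷ p) zero ()
x∉p-x (false Vec.∷ p) zero ()
x∉p-x (_ Vec.∷ p) (suc x) (Vec.there x∈) = x∉p-x p x x∈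

-- Incidence numbers split into orientation signs

module Incidence {n : ℕ} where
  open Counting
  open Signs
  open import Data.Integer.Base using (_*_)

  module _ {s : ℕ} {σ : Subset n} where

    vertex-injective : (o : VertexOrdering s σ) → Injection (vertex o)
    vertex-injective o {i} {j} eq = trans (sym (Inverse.strictlyInverseʳ o i))
        (trans (cong (Inverse.from o) (∃∈-≡ eq)) (Inverse.strictlyInverseʳ o j))
      where
      ∃∈-≡ : {x y : ∃ (_∈ σ)} → proj₁ x ≡ proj₁ y → x ≡ y
      ∃∈-≡ {v , p} {.v , q} refl = cong (v ,_) ([]=-irrelevant p q)

    -- The orientation sign of an ordering relative to the increasing one.
    ε : VertexOrdering s σ → ℤ
    ε o = sign (inv (vertex o))

    ε-square : ∀ o → ε o * ε o ≡ ℤ.1ℤ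
    ε-square o = sign-square (inv (vertex o))

    vertex-carrying : ∀ (u w : VertexOrdering s σ) i → vertex u (carrying u w ⟨$⟩ʳ i) ≡ vertex w i
    vertex-carrying u w i = cong proj₁ (Inverse.strictlyInverseˡ u (Inverse.to w i))

    -- Since `w` is `u` composed with the carrying permutation, `inv-∘` gives `ε w` as its sign
    -- times `ε u`, and `ε u` squares to 1.
    sgn-carrying : ∀ (u w : VertexOrdering s σ) → sgn (carrying u w) ≡ ε u * ε w
    sgn-carrying u w = begin
      sgn π                     ≡⟨ cong sign (inversions≡inv π) ⟩
      sign (inv π′)             ≡⟨ ℤₚ.*-identityʳ (sign (inv π′)) ⟨
      sign (inv π′) * ℤ.1ℤ      ≡⟨ cong (sign (inv π′) *_) (ε-square u) ⟨
      sign (inv π′) * (ε u * ε u) ≡⟨ e (sign (inv π′)) (ε u) ⟩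
      ε u * (sign (inv π′) * ε u) ≡⟨ cong (ε u *_) (sym (inv-∘ (vertex-injective u) π)) ⟩
      ε u * sign (inv (vertex u ∘ π′)) ≡⟨ cong (λ k → ε u * sign k) (∑∑-cong λ i j →
                                     cong₂ (λ a b → χ i j ℕ.* χ a b) (vertex-carrying u w j)
                                       (vertex-carrying u w i)) ⟩
      ε u * ε w                 ∎
      where
      open ≡-Reasoning
      π : Permutation′ s
      π = carrying u w
      π′ : Fin s → Fin s
      π′ = π ⟨$⟩ʳ_
      e : ∀ a b → a * (b * b) ≡ b * (a * b)
      e = ℤ-solve-∀

    below-invariant : ∀ (u w : VertexOrdering s σ) {i j} → vertex u i ≡ vertex w j →
      below (vertex u) i ≡ below (vertex w) j
    below-invariant u w {i} {j} eq = trans (sum-permute (λ k → χ (vertex u k) (vertex u i)) (carrying u w))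
      (∑-cong λ k → cong₂ (χ {n}) (vertex-carrying u w k) eq)

  module _ {s : ℕ} {σ F : Subset n} where

    vertex-unique : (o o′ : VertexOrdering (suc s) F) → ∀ {i j} →
      σ ≡ F - vertex o i → σ ≡ F - vertex o′ j → vertex o i ≡ vertex o′ j
    vertex-unique o o′ {i} {j} eq eq′ with vertex o i Finₚ.≟ vertex o′ j
    ... | yes same = same
    ... | no differ = contradiction
      (subst (vertex o i ∈_) (trans (sym eq′) eq) (Subsetₚ.x∈p∧x≢y⇒x∈p-y (proj₂ (Inverse.to o i)) differ))
      (x∉p-x F (vertex o i))

  -- The position `i` and the sign of the shortened list both depend on the chosen ordering;
  -- `inv-punchIn` trades them for `ε oF` and the rank of the deleted vertex, which is intrinsic to
  -- `F`.
  deletion-sign : ∀ {s} {F : Subset n} (oF : VertexOrdering (suc s) F) i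
    (oσ : VertexOrdering s (F - vertex oF i)) →
    sign (toℕ i) * sgn (carrying (delete oF i) oσ) ≡ ε oσ * ε oF * sign (below (vertex oF) i)
  deletion-sign oF i oσ = begin
    sign (toℕ i) * sgn (carrying (delete oF i) oσ)
      ≡⟨ cong (sign (toℕ i) *_) (sgn-carrying (delete oF i) oσ) ⟩
    sign (toℕ i) * (ε (delete oF i) * ε oσ)
      ≡⟨ ℤₚ.*-assoc (sign (toℕ i)) (ε (delete oF i)) (ε oσ) ⟨
    sign (toℕ i) * ε (delete oF i) * ε oσ
      ≡⟨ cong (_* ε oσ) (inv-punchIn (vertex-injective oF) i) ⟩
    ε oF * sign (below (vertex oF) i) * ε oσ            ≡⟨ e (ε oF) (sign (below (vertex oF) i)) (ε oσ) ⟩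
    ε oσ * ε oF * sign (below (vertex oF) i)            ∎
    where
    open ≡-Reasoning
    e : ∀ a b c → a * b * c ≡ c * a * b
    e = ℤ-solve-∀

  -- The only place where `incidence` is unfolded; everything later works from these two
  -- alternatives.
  incidence-cases : ∀ {s} {σ F : Subset n} (oσ : VertexOrdering s σ) (oF : VertexOrdering (suc s) F) →
    (∃ λ i → σ ≡ F - vertex oF i × incidence oσ oF ≡ ε oσ * ε oF * sign (below (vertex oF) i)) ⊎
    ((∀ i → σ ≢ F - vertex oF i) × incidence oσ oF ≡ ℤ.0ℤ)
  incidence-cases {σ = σ} {F} oσ oF with Finₚ.any? (λ i → σ ≟ˢ (F - vertex oF i))
  ... | yes (i , refl) = inj₁ (i , refl , deletion-sign oF i oσ)
  ... | no none = inj₂ ((λ i eq → none (i , eq)) , refl)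

  vertex-at : ∀ {s} {F : Subset n} (o : VertexOrdering s F) {v} → v ∈ F → ∃ λ i → vertex o i ≡ v
  vertex-at o {v} v∈F = Inverse.from o (v , v∈F) , cong proj₁ (Inverse.strictlyInverseˡ o (v , v∈F))

  -- The rank of the deleted vertex is the same for `w` and `w′`, so the two values differ only in
  -- their `ε` factors, each its own inverse.
  incidence-reorder : ∀ {s} {σ F : Subset n} (u u′ : VertexOrdering s σ) (w w′ : VertexOrdering (suc s) F) →
    incidence u′ w′ ≡ ε u * ε u′ * (ε w * ε w′) * incidence u w
  incidence-reorder {σ = σ} {F} u u′ w w′ = cases (incidence-cases u w) (incidence-cases u′ w′)
    where
    open ≡-Reasoning
    η : ℤ
    η = ε u * ε u′ * (ε w * ε w′)
    transfer : ∀ (o o′ : VertexOrdering _ F) {i} → σ ≡ F - vertex o i → ∃ λ j → σ ≡ F - vertex o′ j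
    transfer o o′ {i} eq with vertex-at o′ (proj₂ (Inverse.to o i))
    ... | j , same = j , trans eq (cong (F -_) (sym same))
    cases : _ → _ → incidence u′ w′ ≡ η * incidence u w
    cases (inj₁ (i , eq , val)) (inj₁ (j , eq′ , val′)) = begin
      incidence u′ w′                     ≡⟨ val′ ⟩
      ε u′ * ε w′ * sign (below (vertex w′) j)
        ≡⟨ cong (λ k → ε u′ * ε w′ * sign k) (below-invariant w′ w (vertex-unique w′ w eq′ eq)) ⟩
      ε u′ * ε w′ * t                     ≡⟨ ℤₚ.*-identityˡ (ε u′ * ε w′ * t) ⟨
      ℤ.1ℤ * (ε u′ * ε w′ * t)
        ≡⟨ cong (_* (ε u′ * ε w′ * t)) (cong₂ _*_ (sym (ε-square u)) (sym (ε-square w))) ⟩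
      ε u * ε u * (ε w * ε w) * (ε u′ * ε w′ * t) ≡⟨ e (ε u) (ε u′) (ε w) (ε w′) t ⟩
      η * (ε u * ε w * t)                 ≡⟨ cong (η *_) val ⟨
      η * incidence u w                   ∎
      where
      t : ℤ
      t = sign (below (vertex w) i)
      e : ∀ a a′ b b′ t → a * a * (b * b) * (a′ * b′ * t) ≡ a * a′ * (b * b′) * (a * b * t)
      e = ℤ-solve-∀
    cases (inj₁ (i , eq , _)) (inj₂ (none , _)) with transfer w w′ eq
    ... | j , eq′ = contradiction eq′ (none j)
    cases (inj₂ (none , _)) (inj₁ (j , eq′ , _)) with transfer w′ w eq′
    ... | i , eq = contradiction eq (none i)
    cases (inj₂ (_ , val)) (inj₂ (_ , val′)) = trans val′ (sym (trans (cong (η *_) val) (ℤₚ.*-zeroʳ η)))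

  p⊆q∧∣q∣≤∣p∣⇒p≡q : ∀ {p q : Subset n} → p ⊆ q → ∣ q ∣ ℕ.≤ ∣ p ∣ → p ≡ q
  p⊆q∧∣q∣≤∣p∣⇒p≡q {p} {q} p⊆q ∣q∣≤∣p∣ with Finₚ.any? (λ x → (x Subsetₚ.∈? q) ×-dec ¬? (x Subsetₚ.∈? p))
  ... | yes (x , x∈q , x∉p) = contradiction ∣q∣≤∣p∣ (ℕₚ.<⇒≱ (Subsetₚ.p⊂q⇒∣p∣<∣q∣ (p⊆q , x , x∈q , x∉p)))
  ... | no none = Subsetₚ.⊆-antisym p⊆q λ {x} x∈q → decidable-stable (x Subsetₚ.∈? p) λ x∉p →
    none (x , x∈q , x∉p)

  -- By cardinality some vertex of `F` is missing from `σ`; deleting it leaves a set that contains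
  -- `σ` and has the same size.
  ⊆⇒deletion : ∀ {s} {σ F : Subset n} (oF : VertexOrdering (suc s) F) → ∣ σ ∣ ≡ s → ∣ F ∣ ≡ suc s → σ ⊆ F →
    ∃ λ i → σ ≡ F - vertex oF i
  ⊆⇒deletion {s} {σ} {F} oF ∣σ∣ ∣F∣ σ⊆F with Finₚ.any? (λ i → ¬? (vertex oF i Subsetₚ.∈? σ))
  ... | no none = contradiction (Subsetₚ.p⊆q⇒∣p∣≤∣q∣ F⊆σ)
    (ℕₚ.<⇒≱ (ℕₚ.≤-reflexive (trans (cong suc ∣σ∣) (sym ∣F∣))))
    where
    F⊆σ : F ⊆ σ
    F⊆σ {v} v∈F with vertex-at oF v∈F
    ... | i , refl = decidable-stable (vertex oF i Subsetₚ.∈? σ) λ v∉ → none (i , v∉)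
  ... | yes (i , v∉σ) = i , p⊆q∧∣q∣≤∣p∣⇒p≡q
    (λ {x} x∈σ → Subsetₚ.x∈p∧x≢y⇒x∈p-y (σ⊆F x∈σ) λ { refl → v∉σ x∈σ })
    (ℕ.s≤s⁻¹ (subst (ℕ._≤_ _) (trans ∣F∣ (cong suc (sym ∣σ∣)))
      (Subsetₚ.x∈p⇒∣p-x∣<∣p∣ (proj₂ (Inverse.to oF i)))))

  incidence-square-⊆ : ∀ {s} {σ F : Subset n} (oσ : VertexOrdering s σ) (oF : VertexOrdering (suc s) F) →
    ∣ σ ∣ ≡ s → ∣ F ∣ ≡ suc s → σ ⊆ F → incidence oσ oF * incidence oσ oF ≡ ℤ.1ℤ
  incidence-square-⊆ oσ oF ∣σ∣ ∣F∣ σ⊆F with incidence-cases oσ oF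
  ... | inj₁ (i , _ , val) = trans (cong₂ _*_ val val)
      (trans (e (ε oσ) (ε oF) (sign (below (vertex oF) i)))
        (cong₂ _*_ (cong₂ _*_ (ε-square oσ) (ε-square oF)) (sign-square (below (vertex oF) i))))
    where
    e : ∀ a b c → a * b * c * (a * b * c) ≡ a * a * (b * b) * (c * c)
    e = ℤ-solve-∀
  ... | inj₂ (none , _) with ⊆⇒deletion oF ∣σ∣ ∣F∣ σ⊆F
  ... | i , eq = contradiction eq (none i)

  incidence-⊈ : ∀ {s} {σ F : Subset n} (oσ : VertexOrdering s σ) (oF : VertexOrdering (suc s) F) →
    ¬ σ ⊆ F → incidence oσ oF ≡ ℤ.0ℤ
  incidence-⊈ {F = F} oσ oF σ⊈F with incidence-cases oσ oF
  ... | inj₁ (i , refl , _) = contradiction (λ {x} → Subsetₚ.p─q⊆p F ⁅ vertex oF i ⁆ {x}) σ⊈F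
  ... | inj₂ (_ , val) = val

-- Enumerating subsets without repetition

lookup-injective : ∀ {a} {A : Set a} {xs : List A} → Unique xs →
  ∀ i j → List.lookup xs i ≡ List.lookup xs j → i ≡ j
lookup-injective {xs = _ ∷ _} u zero zero eq = refl
lookup-injective {xs = _ ∷ xs} (x≢ AllPairs.∷ u) zero (suc j) eq = contradiction eq
  (All.lookup x≢ (∈-lookup {xs = xs} j))
lookup-injective {xs = _ ∷ xs} (x≢ AllPairs.∷ u) (suc i) zero eq = contradiction (sym eq)
  (All.lookup x≢ (∈-lookup {xs = xs} i))
lookup-injective {xs = _ ∷ _} (_ AllPairs.∷ u) (suc i) (suc j) eq = cong suc (lookup-injective u i j eq)

allSubsets-unique : ∀ n → Unique (allSubsets n)
allSubsets-unique zero = All.[] AllPairs.∷ AllPairs.[]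
allSubsets-unique (suc n) = Uniqueₚ.++⁺
  (Uniqueₚ.map⁺ Vecₚ.∷-injectiveʳ (allSubsets-unique n))
  (Uniqueₚ.map⁺ Vecₚ.∷-injectiveʳ (allSubsets-unique n))
  λ (p∈ , p∈′) → case-disjoint (∈-map⁻ (false Vec.∷_) p∈) (∈-map⁻ (true Vec.∷_) p∈′)
  where
  case-disjoint : ∀ {p} → (∃ λ q → q ∈ₗ allSubsets n × p ≡ false Vec.∷ q) →
    (∃ λ q → q ∈ₗ allSubsets n × p ≡ true Vec.∷ q) → _
  case-disjoint (_ , _ , refl) (_ , _ , ())

∈-allSubsets : ∀ {n} (p : Subset n) → p ∈ₗ allSubsets n
∈-allSubsets Vec.[] = Any.here refl
∈-allSubsets (false Vec.∷ p) = ∈-++⁺ˡ (∈-map⁺ (false Vec.∷_) (∈-allSubsets p))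
∈-allSubsets {suc n} (true Vec.∷ p) =
  ∈-++⁺ʳ (List.map (false Vec.∷_) (allSubsets n)) (∈-map⁺ (true Vec.∷_) (∈-allSubsets p))

∣p∣≤1+∣p-x∣ : ∀ {n} (p : Subset n) x → ∣ p ∣ ℕ.≤ suc ∣ p - x ∣
∣p∣≤1+∣p-x∣ (true Vec.∷ p) zero = ℕ.s≤s (ℕₚ.≤-reflexive (cong ∣_∣ (sym (Subsetₚ.p─⊥≡p p))))
∣p∣≤1+∣p-x∣ (false Vec.∷ p) zero = ℕₚ.m≤n⇒m≤1+n (ℕₚ.≤-reflexive (cong ∣_∣ (sym (Subsetₚ.p─⊥≡p p))))
∣p∣≤1+∣p-x∣ (true Vec.∷ p) (suc x) = ℕ.s≤s (∣p∣≤1+∣p-x∣ p x)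
∣p∣≤1+∣p-x∣ (false Vec.∷ p) (suc x) = ∣p∣≤1+∣p-x∣ p x

∑ℤ-cong : ∀ {n} {f g : Fin n → ℤ} → (∀ i → f i ≡ g i) → ∑ℤ f ≡ ∑ℤ g
∑ℤ-cong {zero} h = refl
∑ℤ-cong {suc n} h = cong₂ ℤ._+_ (h zero) (∑ℤ-cong (h ∘ suc))

∑ℤ-+ : ∀ {n} (f : Fin n → ℕ) → ∑ℤ (λ i → ℤ.+ f i) ≡ ℤ.+ Counting.∑ f
∑ℤ-+ {zero} f = refl
∑ℤ-+ {suc n} f = cong (ℤ._+_ (ℤ.+ f zero)) (∑ℤ-+ (f ∘ suc))

-- Ridges common to two facets

module Complex {n : ℕ} (K : SimplicialComplex n) where
  open Counting
  open Signs
  open Incidence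
  open SimplicialComplex K

  private
    isFace? : ∀ s → Decidable (λ σ → Face σ × ∣ σ ∣ ≡ s)
    isFace? s σ = face? σ ×-dec (∣ σ ∣ ℕₚ.≟ s)

  face-valid : ∀ s i → Face (face K s i) × ∣ face K s i ∣ ≡ s
  face-valid s i = proj₂ (∈-filter⁻ (isFace? s) {xs = allSubsets n} (∈-lookup {xs = faces K s} i))

  face-injective : ∀ s {i j} → face K s i ≡ face K s j → i ≡ j
  face-injective s = lookup-injective (Uniqueₚ.filter⁺ (isFace? s) (allSubsets-unique n)) _ _

  face-index : ∀ s {σ} → Face σ → ∣ σ ∣ ≡ s → ∃ λ i → face K s i ≡ σ
  face-index s {σ} h ∣σ∣ = Any.index σ∈ , sym (Anyₚ.lookup-index σ∈)
    where
    σ∈ : σ ∈ₗ faces K s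
    σ∈ = ∈-filter⁺ (isFace? s) (∈-allSubsets σ) (h , ∣σ∣)

  module _ (k : ℕ) where
    open import Data.Nat.Base using (_+_; _*_; _≤_)

    contains : Ridge K k → Facet K k → ℕ
    contains R F = 𝟙 (ridge K k R Subsetₚ.⊆? facet K k F)

    common : Facet K k → Facet K k → ℕ
    common F G = ∑ λ R → contains R F * contains R G

    common-sym : ∀ F G → common F G ≡ common G F
    common-sym F G = ∑-cong λ R → ℕₚ.*-comm (contains R F) (contains R G)

    contains-yes : ∀ {R F} → ridge K k R ⊆ facet K k F → contains R F ≡ 1
    contains-yes h = 𝟙-yes (_ Subsetₚ.⊆? _) (λ {x} → h {x})

    contains-no : ∀ {R F} → ¬ ridge K k R ⊆ facet K k F → contains R F ≡ 0
    contains-no h = 𝟙-no (_ Subsetₚ.⊆? _) h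

    ∣facet∣ : ∀ F → ∣ facet K k F ∣ ≡ suc k
    ∣facet∣ F = proj₂ (face-valid (suc k) F)

    ∣ridge∣ : ∀ R → ∣ ridge K k R ∣ ≡ k
    ∣ridge∣ R = proj₂ (face-valid k R)

    upperDegree≡∑ : ∀ ρ → upperDegree K k ρ ≡ ∑ λ F → 𝟙 (ρ Subsetₚ.⊆? facet K k F)
    upperDegree≡∑ ρ = length-filter-lookup (ρ Subsetₚ.⊆?_) (faces K (suc k))

    upperDegree≤ : ∀ R → upperDegree K k (ridge K k R) ≤ maxUpperDegree K k
    upperDegree≤ R = All.lookup (xs≤max 0 (List.map (upperDegree K k) (faces K k)))
      (∈-map⁺ (upperDegree K k) (∈-lookup {xs = faces K k} R))

    contains≤1 : ∀ R F → contains R F ≤ 1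
    contains≤1 R F with ridge K k R Subsetₚ.⊆? facet K k F
    ... | yes _ = ℕₚ.≤-refl
    ... | no _ = ℕ.z≤n

    maxUpperDegree≤ : maxUpperDegree K k ≤ faceCount K (suc k)
    maxUpperDegree≤ = max≤v⁺ {xs = List.map (upperDegree K k) (faces K k)} ℕ.z≤n
      (Allₚ.map⁺ (All.tabulate λ {ρ} _ → subst₂ _≤_ (sym (upperDegree≡∑ ρ))
        (∑-ones (faceCount K (suc k))) (∑-mono (bound ρ))))
      where
      bound : ∀ ρ F → 𝟙 (ρ Subsetₚ.⊆? facet K k F) ≤ 1
      bound ρ F with ρ Subsetₚ.⊆? facet K k F
      ... | yes _ = ℕₚ.≤-refl
      ... | no _ = ℕ.z≤n

    module _ (o : Orientation K) where

      private
        vertexOf : ∀ F → Fin (suc k) → Fin n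
        vertexOf F = vertex (o (suc k) F)

      ridge-opposite : ∀ F i → ∃ λ R → ridge K k R ≡ facet K k F - vertexOf F i
      ridge-opposite F i = face-index k
        (closed {σ = facet K k F} (Subsetₚ.p─q⊆p (facet K k F) ⁅ v ⁆) (proj₁ (face-valid (suc k) F)))
        (ℕₚ.≤-antisym
          (ℕ.s≤s⁻¹ (subst (suc ∣ facet K k F - v ∣ ≤_) (∣facet∣ F)
            (Subsetₚ.x∈p⇒∣p-x∣<∣p∣ (proj₂ (Inverse.to (o (suc k) F) i)))))
          (ℕ.s≤s⁻¹ (subst (_≤ suc ∣ facet K k F - v ∣) (∣facet∣ F) (∣p∣≤1+∣p-x∣ (facet K k F) v))))
        where
        v : Fin n
        v = vertexOf F i

      ridge-opposite-⊆ : ∀ F i → ridge K k (proj₁ (ridge-opposite F i)) ⊆ facet K k F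
      ridge-opposite-⊆ F i {x} x∈ = Subsetₚ.p─q⊆p (facet K k F) ⁅ vertexOf F i ⁆
        (subst (x ∈_) (proj₂ (ridge-opposite F i)) x∈)

      private
        opposite : Facet K k → Ridge K k → Fin (suc k) → ℕ
        opposite F R i = 𝟙 (ridge K k R ≟ˢ (facet K k F - vertexOf F i))

        contains≡∑opposite : ∀ R F → contains R F ≡ ∑ (opposite F R)
        contains≡∑opposite R F = cases (ridge K k R Subsetₚ.⊆? facet K k F)
          where
          cases : Dec (ridge K k R ⊆ facet K k F) → contains R F ≡ ∑ (opposite F R)
          cases (no R⊈F) = trans (contains-no {R} {F} R⊈F) (sym (∑-zero λ i →
            𝟙-no (ridge K k R ≟ˢ (facet K k F - vertexOf F i)) λ eq →
              R⊈F λ {x} x∈ → Subsetₚ.p─q⊆p (facet K k F) ⁅ vertexOf F i ⁆ (subst (x ∈_) eq x∈)))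
          cases (yes R⊆F) with ⊆⇒deletion (o (suc k) F) (∣ridge∣ R) (∣facet∣ F) R⊆F
          ... | i , eq = trans (contains-yes {R} {F} R⊆F) (sym (trans
            (∑-single i λ j j≢i → 𝟙-no (ridge K k R ≟ˢ (facet K k F - vertexOf F j)) λ eq′ →
              j≢i (vertex-injective (o (suc k) F) (vertex-unique (o (suc k) F) (o (suc k) F) eq′ eq)))
            (𝟙-yes (ridge K k R ≟ˢ (facet K k F - vertexOf F i)) eq)))

      -- Double counting of pairs of a ridge and a position `i` whose deletion from `F` yields it: a
      -- ridge in `F` omits exactly one vertex, and each of the `k + 1` deletions is a ridge because
      -- the complex is closed.
      common-diag : ∀ F → common F F ≡ suc k
      common-diag F = begin
        ∑ (λ R → contains R F * contains R F)   ≡⟨ ∑-cong (λ R → idem (contains≤1 R F)) ⟩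
        ∑ (λ R → contains R F)                  ≡⟨ ∑-cong (λ R → contains≡∑opposite R F) ⟩
        ∑ (λ R → ∑ (opposite F R))              ≡⟨ ∑-comm (opposite F) ⟩
        ∑ (λ i → ∑ λ R → opposite F R i)        ≡⟨ ∑-cong one ⟩
        ∑ {suc k} (λ _ → 1)                     ≡⟨ ∑-ones (suc k) ⟩
        suc k                                   ∎
        where
        open ≡-Reasoning
        idem : ∀ {m} → m ≤ 1 → m * m ≡ m
        idem ℕ.z≤n = refl
        idem (ℕ.s≤s ℕ.z≤n) = refl
        one : ∀ i → ∑ (λ R → opposite F R i) ≡ 1
        one i = trans (∑-single (proj₁ (ridge-opposite F i)) λ R R≢ →
            𝟙-no (ridge K k R ≟ˢ (facet K k F - vertexOf F i)) λ eq → R≢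
              (face-injective k (trans eq (sym (proj₂ (ridge-opposite F i))))))
          (𝟙-yes (ridge K k (proj₁ (ridge-opposite F i)) ≟ˢ (facet K k F - vertexOf F i))
            (proj₂ (ridge-opposite F i)))

    -- Both ridges equal the intersection of the facets: it contains them, and it has at most `k`
    -- vertices, since with more it would equal both `F` and `G`.
    common-ridge-unique : ∀ {F G} → F ≢ G → ∀ {R S} →
      ridge K k R ⊆ facet K k F → ridge K k R ⊆ facet K k G →
      ridge K k S ⊆ facet K k F → ridge K k S ⊆ facet K k G → R ≡ S
    common-ridge-unique {F} {G} F≢G {R} {S} R⊆F R⊆G S⊆F S⊆G = face-injective k
        (trans (is-meet R (λ {x} → R⊆F {x}) (λ {x} → R⊆G {x}))
          (sym (is-meet S (λ {x} → S⊆F {x}) (λ {x} → S⊆G {x}))))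
      where
      M : Subset n
      M = facet K k F ∩ facet K k G
      M-small : ∣ M ∣ ≤ k
      M-small = ℕₚ.≮⇒≥ λ k<∣M∣ → F≢G (face-injective (suc k)
        (trans (sym (p⊆q∧∣q∣≤∣p∣⇒p≡q (Subsetₚ.p∩q⊆p (facet K k F) (facet K k G))
          (subst (_≤ ∣ M ∣) (sym (∣facet∣ F)) k<∣M∣)))
          (p⊆q∧∣q∣≤∣p∣⇒p≡q (Subsetₚ.p∩q⊆q (facet K k F) (facet K k G))
            (subst (_≤ ∣ M ∣) (sym (∣facet∣ G)) k<∣M∣))))
      is-meet : ∀ T → ridge K k T ⊆ facet K k F → ridge K k T ⊆ facet K k G → ridge K k T ≡ M
      is-meet T T⊆F T⊆G = p⊆q∧∣q∣≤∣p∣⇒p≡q (λ x∈ → Subsetₚ.x∈p∩q⁺ (T⊆F x∈ , T⊆G x∈))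
        (subst (∣ M ∣ ≤_) (sym (∣ridge∣ T)) M-small)

    common-adjacent : ∀ {F G R} → ridge K k R ⊆ facet K k F → ridge K k R ⊆ facet K k G → 1 ≤ common F G
    common-adjacent {F} {G} {R} R⊆F R⊆G = subst (_≤ common F G)
      (cong₂ _*_ (contains-yes {R} {F} R⊆F) (contains-yes {R} {G} R⊆G))
        (term≤∑ (λ S → contains S F * contains S G) R)

    common-off-diag : ∀ {F G R} → F ≢ G →
      ridge K k R ⊆ facet K k F → ridge K k R ⊆ facet K k G → common F G ≡ 1
    common-off-diag {F} {G} {R} F≢G R⊆F R⊆G = trans (∑-single R none)
        (cong₂ _*_ (contains-yes {R} {F} R⊆F) (contains-yes {R} {G} R⊆G))
      where
      none : ∀ S → S ≢ R → contains S F * contains S G ≡ 0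
      none S S≢R with ridge K k S Subsetₚ.⊆? facet K k F | ridge K k S Subsetₚ.⊆? facet K k G
      ... | no _ | _ = refl
      ... | yes _ | no _ = refl
      ... | yes S⊆F | yes S⊆G = contradiction
        (common-ridge-unique F≢G S⊆F S⊆G (λ {x} → R⊆F {x}) (λ {x} → R⊆G {x})) S≢R

    -- The sign-corrected boundary matrix

    -- θ and η are the signs by which o differs from o′ on facets and on ridges.
    module Disoriented (o o′ : Orientation K)
      (disoriented : ∀ F G R → F ≢ G → ridge K k R ⊆ facet K k F → ridge K k R ⊆ facet K k G →
        boundary K o′ k R F ≡ boundary K o′ k R G) where

      private
        θ : Facet K k → ℤ
        θ F = ε (o′ (suc k) F) ℤ.* ε (o (suc k) F)
        η : Ridge K k → ℤ
        η R = ε (o′ k R) ℤ.* ε (o k R)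

        square₂ : ∀ a b → a ℤ.* a ≡ ℤ.1ℤ → b ℤ.* b ≡ ℤ.1ℤ → a ℤ.* b ℤ.* (a ℤ.* b) ≡ ℤ.1ℤ
        square₂ a b a² b² = trans (e a b) (cong₂ ℤ._*_ a² b²)
          where
          e : ∀ a b → a ℤ.* b ℤ.* (a ℤ.* b) ≡ a ℤ.* a ℤ.* (b ℤ.* b)
          e = ℤ-solve-∀

        θ-square : ∀ F → θ F ℤ.* θ F ≡ ℤ.1ℤ
        θ-square F = square₂ (ε (o′ (suc k) F)) (ε (o (suc k) F)) (ε-square (o′ (suc k) F))
          (ε-square (o (suc k) F))

        η-square : ∀ R → η R ℤ.* η R ≡ ℤ.1ℤ
        η-square R = square₂ (ε (o′ k R)) (ε (o k R)) (ε-square (o′ k R)) (ε-square (o k R))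

      C : Matrix ℤ (faceCount K k) (faceCount K (suc k))
      C R F = boundary K o k R F ℤ.* θ F

      upLaplacian≡CCᵀ : ∀ R S → upLaplacian K o k R S ≡ ∑ℤ λ F → C R F ℤ.* C S F
      upLaplacian≡CCᵀ R S = ∑ℤ-cong λ F → sym (trans (e (boundary K o k R F) (boundary K o k S F) (θ F))
          (trans (cong (boundary K o k R F ℤ.* boundary K o k S F ℤ.*_) (θ-square F)) (ℤₚ.*-identityʳ _)))
        where
        e : ∀ a b t → a ℤ.* t ℤ.* (b ℤ.* t) ≡ a ℤ.* b ℤ.* (t ℤ.* t)
        e = ℤ-solve-∀

      private
        b′ : Ridge K k → Facet K k → ℤ
        b′ = boundary K o′ k

        -- The factor `θ` in `C` undoes the change of facet orientations. Only the row signs `η`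
        -- remain, and they square away in `Cᵀ C`.
        C≡ηb′ : ∀ R F → C R F ≡ η R ℤ.* b′ R F
        C≡ηb′ R F = trans (cong (ℤ._* θ F) (incidence-reorder (o′ k R) (o k R) (o′ (suc k) F) (o (suc k) F)))
          (trans (e (η R) (θ F) (b′ R F))
            (trans (cong (η R ℤ.* b′ R F ℤ.*_) (θ-square F)) (ℤₚ.*-identityʳ _)))
          where
          e : ∀ h t b → h ℤ.* t ℤ.* b ℤ.* t ≡ h ℤ.* b ℤ.* (t ℤ.* t)
          e = ℤ-solve-∀

        -- Disorientability enters here: on a ridge in both facets the two signs agree, so their
        -- product is the square of a sign. The equality is trivial for `F = G`, which the
        -- hypothesis excludes.
        b′-product : ∀ R F G → b′ R F ℤ.* b′ R G ≡ ℤ.+ (contains R F * contains R G)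
        b′-product R F G = cases (ridge K k R Subsetₚ.⊆? facet K k F) (ridge K k R Subsetₚ.⊆? facet K k G)
          where
          same : ridge K k R ⊆ facet K k F → ridge K k R ⊆ facet K k G → b′ R G ≡ b′ R F
          same R⊆F R⊆G with F Finₚ.≟ G
          ... | yes refl = refl
          ... | no F≢G = sym (disoriented F G R F≢G R⊆F R⊆G)
          cases : Dec (ridge K k R ⊆ facet K k F) → Dec (ridge K k R ⊆ facet K k G) →
            b′ R F ℤ.* b′ R G ≡ ℤ.+ (contains R F * contains R G)
          cases (no R⊈F) _ = trans (cong (ℤ._* b′ R G) (incidence-⊈ (o′ k R) (o′ (suc k) F) R⊈F))
            (cong (λ z → ℤ.+ (z * contains R G)) (sym (contains-no {R} {F} R⊈F)))
          cases (yes _) (no R⊈G) = trans (cong (b′ R F ℤ.*_) (incidence-⊈ (o′ k R) (o′ (suc k) G) R⊈G))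
            (trans (ℤₚ.*-zeroʳ (b′ R F)) (cong ℤ.+_
              (sym (trans (cong (contains R F *_) (contains-no {R} {G} R⊈G)) (ℕₚ.*-zeroʳ (contains R F))))))
          cases (yes R⊆F) (yes R⊆G) = trans (cong (b′ R F ℤ.*_) (same R⊆F R⊆G))
            (trans (incidence-square-⊆ (o′ k R) (o′ (suc k) F) (∣ridge∣ R) (∣facet∣ F) R⊆F)
              (cong ℤ.+_ (sym (cong₂ _*_ (contains-yes {R} {F} R⊆F) (contains-yes {R} {G} R⊆G)))))

      common≡CᵀC : ∀ F G → ℤ.+ common F G ≡ ∑ℤ λ R → C R F ℤ.* C R G
      common≡CᵀC F G = trans (sym (∑ℤ-+ λ R → contains R F * contains R G)) (∑ℤ-cong λ R →
          sym (trans (cong₂ ℤ._*_ (C≡ηb′ R F) (C≡ηb′ R G)) (trans (e (η R) (b′ R F) (b′ R G))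
            (trans (cong₂ ℤ._*_ (η-square R) (b′-product R F G)) (ℤₚ.*-identityˡ _)))))
        where
        e : ∀ h a b → h ℤ.* a ℤ.* (h ℤ.* b) ≡ h ℤ.* h ℤ.* (a ℤ.* b)
        e = ℤ-solve-∀

-- The facet matrix of common ridges

module Spectrum {n : ℕ} (K : SimplicialComplex n) (k : ℕ) (o o′ : Orientation K)
  (disoriented : ∀ F G R → F ≢ G → ridge K k R ⊆ facet K k F → ridge K k R ⊆ facet K k G →
    boundary K o′ k R F ≡ boundary K o′ k R G) where
  open RationalOrder
  open FromIntegers
  open RationalVectors
  open NullSequences
  open Eigenvalues
  open import Data.Nat.Base using (_+_; _*_; _≤_)
  open Complex K
  open Disoriented k o o′ disoriented

  private
    N D : ℕ
    N = faceCount K (suc k)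
    D = maxUpperDegree K k

    ℕ∑ : ∀ {m} → (Fin m → ℕ) → ℕ
    ℕ∑ = Counting.∑

    fromℕ : ℕ → ℚ
    fromℕ m = ι (ℤ.+ m)

    A : Matrix ℚ N N
    A F G = fromℕ (common k F G)

    A≥0 : ∀ F G → 0ℚ ℚ.≤ A F G
    A≥0 F G = ι-nonneg (common k F G)

    fromℕ-+ : ∀ a b → fromℕ (a + b) ≡ fromℕ a ℚ.+ fromℕ b
    fromℕ-+ a b = ι-+ (ℤ.+ a) (ℤ.+ b)

    fromℕ-* : ∀ a b → fromℕ (a * b) ≡ fromℕ a ℚ.* fromℕ b
    fromℕ-* a b = trans (cong ι (ℤₚ.pos-* a b)) (ι-* (ℤ.+ a) (ℤ.+ b))

    fromℕ-mono : ∀ {a b} → a ≤ b → fromℕ a ℚ.≤ fromℕ b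
    fromℕ-mono {a} {b} a≤b = ι-mono {ℤ.+ a} {ℤ.+ b} (ℤ.+≤+ a≤b)

    fromℕ-∑ : ∀ {m} (f : Fin m → ℕ) → fromℕ (ℕ∑ f) ≡ ∑ (λ i → fromℕ (f i))
    fromℕ-∑ {zero} f = refl
    fromℕ-∑ {suc m} f = trans (fromℕ-+ (f zero) (ℕ∑ (f ∘ suc)))
      (cong (ℚ._+_ (fromℕ (f zero))) (fromℕ-∑ (f ∘ suc)))

    A·fromℕ : ∀ (a : Facet K k → ℕ) F → (A · (λ G → fromℕ (a G))) F ≡ fromℕ (ℕ∑ λ G → common k F G * a G)
    A·fromℕ a F = sym (trans (fromℕ-∑ (λ G → common k F G * a G)) (∑-cong λ G → fromℕ-* (common k F G) (a G)))

    module S = Eigenvalues.Gram C (upLaplacian K o k) (λ F G → ℤ.+ common k F G) upLaplacian≡CCᵀ common≡CᵀC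

  -- A larger eigenvalue when a facet misses a ridge of maximal degree

  module Forward (R₀ : Ridge K k) (degree : upperDegree K k (ridge K k R₀) ≡ D)
    (connected : ΓConnected K k) {F₀ F₁ : Facet K k}
    (R₀⊆F₀ : ridge K k R₀ ⊆ facet K k F₀) (R₀⊈F₁ : ¬ ridge K k R₀ ⊆ facet K k F₁) where

    private
      a : Facet K k → ℕ
      a = contains k R₀

      δ₌ : Facet K k → Facet K k → ℕ
      δ₌ F G = Counting.𝟙 (F Finₚ.≟ G)

      ∑a : ℕ∑ a ≡ D
      ∑a = trans (sym (upperDegree≡∑ k (ridge K k R₀))) degree

      -- A path from a facet containing `R₀` to one missing it must somewhere leave the set of
      -- facets containing `R₀`.
      boundary-edge : ∀ {F G} → Star (Adjacent K k) F G →
        ridge K k R₀ ⊆ facet K k F → ¬ ridge K k R₀ ⊆ facet K k G →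
        ∃₂ λ F′ G′ → Adjacent K k F′ G′ × ridge K k R₀ ⊆ facet K k F′ × ¬ ridge K k R₀ ⊆ facet K k G′
      boundary-edge ∎⋆ h ¬h = contradiction (λ {x} → h {x}) ¬h
      boundary-edge {F} (_◅_ {j = G} e path) h ¬h with ridge K k R₀ Subsetₚ.⊆? facet K k G
      ... | yes h′ = boundary-edge path h′ ¬h
      ... | no ¬h′ = F , G , e , (λ {x} → h {x}) , ¬h′

      -- A facet containing `R₀` shares `k + 1` ridges with itself and at least one with each of the
      -- other `D - 1` facets containing `R₀`, in total at least `D + k`. At other facets the left
      -- side is 0.
      subeigen : ∀ F → (D + k) * a F ≤ ℕ∑ λ G → common k F G * a G
      subeigen F = cases (ridge K k R₀ Subsetₚ.⊆? facet K k F)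
        where
        open ℕₚ.≤-Reasoning
        cases : Dec (ridge K k R₀ ⊆ facet K k F) → (D + k) * a F ≤ ℕ∑ λ G → common k F G * a G
        cases (no h) = ℕₚ.≤-trans (ℕₚ.≤-reflexive
          (trans (cong ((D + k) *_) (contains-no k {R₀} {F} h)) (ℕₚ.*-zeroʳ (D + k)))) ℕ.z≤n
        cases (yes h) = begin
          (D + k) * a F
            ≡⟨ trans (cong ((D + k) *_) (contains-yes k {R₀} {F} h)) (ℕₚ.*-identityʳ (D + k)) ⟩
          D + k
            ≡⟨ cong₂ _+_ ∑a (trans (Counting.∑-single F λ G G≢F → cong (_* k)
              (Counting.𝟙-no (F Finₚ.≟ G) (G≢F ∘ sym)))
                                                              (trans (cong (_* k) (Counting.𝟙-yes
                                                                (F Finₚ.≟ F) refl)) (ℕₚ.*-identityˡ k))) ⟨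
          ℕ∑ a + ℕ∑ (λ G → δ₌ F G * k)                   ≡⟨ Counting.∑-distrib-+ a (λ G → δ₌ F G * k) ⟨
          ℕ∑ (λ G → a G + δ₌ F G * k)
            ≤⟨ Counting.∑-mono (λ G → term G (ridge K k R₀ Subsetₚ.⊆? facet K k G)) ⟩
          ℕ∑ (λ G → common k F G * a G)                  ∎
          where
          term : ∀ G → Dec (ridge K k R₀ ⊆ facet K k G) → a G + δ₌ F G * k ≤ common k F G * a G
          term G h′ with F Finₚ.≟ G
          ... | yes refl = ℕₚ.≤-reflexive (trans (cong₂ _+_ (contains-yes k {R₀} {F} h) (ℕₚ.*-identityˡ k))
            (sym (trans (cong₂ _*_ (common-diag k o F) (contains-yes k {R₀} {F} h))
              (ℕₚ.*-identityʳ (suc k)))))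
          term G (no ¬h′) | no F≢G = ℕₚ.≤-trans
            (ℕₚ.≤-reflexive (trans (ℕₚ.+-identityʳ (a G)) (contains-no k {R₀} {G} ¬h′))) ℕ.z≤n
          term G (yes h′) | no F≢G = subst (_≤ common k F G * a G) (sym (ℕₚ.+-identityʳ (a G)))
            (ℕₚ.≤-trans (ℕₚ.≤-reflexive (sym (ℕₚ.*-identityˡ (a G))))
              (ℕₚ.*-monoˡ-≤ (a G) (common-adjacent k h h′)))

      -- Just outside the facets containing `R₀` the indicator vanishes but a neighbour still
      -- contributes, so the subeigenvector inequality is strict there.
      strict : ∃ λ G → a G ≡ 0 × 1 ≤ ℕ∑ λ H → common k G H * a H
      strict with boundary-edge (connected F₀ F₁) R₀⊆F₀ R₀⊈F₁
      ... | F , G , (_ , R , R⊆F , R⊆G) , h , ¬h = G , contains-no k {R₀} {G} ¬h , ℕₚ.≤-trans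
        (ℕₚ.≤-trans (common-adjacent k R⊆G R⊆F)
          (ℕₚ.≤-reflexive (trans (sym (ℕₚ.*-identityʳ (common k G F)))
            (cong (common k G F *_) (sym (contains-yes k {R₀} {F} h))))))
        (Counting.term≤∑ (λ H → common k G H * a H) F)

      open PowerIteration A A≥0
      A-diagonal : ∀ F → 1ℚ ℚ.≤ A F F
      A-diagonal F = fromℕ-mono {1} (subst (1 ≤_) (sym (common-diag k o F)) (ℕ.s≤s ℕ.z≤n))

      A-adjacent : ∀ {F G} → Adjacent K k F G → 1ℚ ℚ.≤ A F G
      A-adjacent (_ , R , R⊆F , R⊆G) = fromℕ-mono {1} (common-adjacent k R⊆F R⊆G)

      open Connected A-diagonal A-adjacent connected

      x : Vect N
      x F = fromℕ (a F)

      c : ℚ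
      c = fromℕ (D + k)

      G₁ : Facet K k
      G₁ = proj₁ strict

      excess : 1ℚ ℚ.≤ (A · x) G₁ ℚ.- c ℚ.* x G₁
      excess = subst (1ℚ ℚ.≤_) (sym (trans (cong₂ ℚ._-_ (A·fromℕ a G₁)
            (trans (cong (λ m → c ℚ.* fromℕ m) (proj₁ (proj₂ strict))) (ℚₚ.*-zeroʳ c)))
          (ℚₚ.+-identityʳ (fromℕ (ℕ∑ λ H → common k G₁ H * a H)))))
        (fromℕ-mono {1} (proj₂ (proj₂ strict)))

      larger : ∃ λ (v : Fin N → ℝ) → ∃ λ μ → ∃ λ δ → 0ℚ ℚ.< δ ×
        (∀ F → Null (λ n → (A · (λ G → seq (v G) n)) F ℚ.- seq μ n ℚ.* seq (v F) n)) ×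
        (∀ n → ∑ (λ F → seq (v F) n) ≡ 1ℚ) × (∀ n → c ℚ.+ δ ℚ.≤ seq μ n)
      larger = larger-eigenvalue {c} {x} (λ F → ι-nonneg (a F))
        (λ F → subst₂ ℚ._≤_ (fromℕ-* (D + k) (a F)) (sym (A·fromℕ a F)) (fromℕ-mono (subeigen F)))
        {F₀} (subst (λ m → 1ℚ ℚ.≤ fromℕ m) (sym (contains-yes k {R₀} {F₀} R₀⊆F₀)) ℚₚ.≤-refl)
        {G₁} excess

    not-largest : ¬ IsLargestEigenvalue (upLaplacianℝ K o k) (fromℤ (ℤ.+ (D + k)))
    not-largest (_ , largest) = contra larger
      where
      contra : ¬ _
      contra (v , μ , δ , 0<δ , residual , total , above) = ℚₚ.<-irrefl refl (ℚₚ.<-≤-trans ½δ<δ δ≤½δ)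
        where
        eigenvalue : IsEigenvalue (upLaplacianℝ K o k) μ
        eigenvalue = S.isEigenvalue v μ residual 0<δ λ n → ℚₚ.≤-trans
          (≤-by c (ι-nonneg (D + k)) (ℚₚ.+-comm c δ))
          (ℚₚ.≤-trans (above n) (ℚₚ.≤-reflexive
            (sym (trans (cong (ℚ._*_ (seq μ n)) (total n)) (ℚₚ.*-identityʳ (seq μ n))))))
        -- The order on reals allows an error; taking it as half of the gap `δ` already contradicts
        -- `c + δ ≤ μₙ`.
        eventually : Eventually (λ n → seq μ n ℚ.≤ c ℚ.+ ½ ℚ.* δ)
        eventually = largest μ eigenvalue (½ ℚ.* δ) (½-pos 0<δ)
        δ≤½δ : δ ℚ.≤ ½ ℚ.* δ
        δ≤½δ = 0≤-undiff {δ} {½ ℚ.* δ} (subst (0ℚ ℚ.≤_) (e c (½ ℚ.* δ) δ)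
          (0≤-diff (ℚₚ.≤-trans (above (proj₁ eventually)) (proj₂ eventually (proj₁ eventually) ℕₚ.≤-refl))))
          where
          e : ∀ c h d → (c ℚ.+ h) ℚ.- (c ℚ.+ d) ≡ h ℚ.- d
          e = Solver.solve-∀ ℚ-ring
        ½δ<δ : ½ ℚ.* δ ℚ.< δ
        ½δ<δ = subst₂ ℚ._<_ (ℚₚ.+-identityʳ (½ ℚ.* δ)) (split δ) (ℚₚ.+-monoʳ-< (½ ℚ.* δ) (½-pos 0<δ))

  -- Constant row sums when all facets share a ridge

  module Backward (R₀ : Ridge K k) (R₀⊆ : ∀ F → ridge K k R₀ ⊆ facet K k F) (F₀ : Facet K k) where

    private
      D≡N : D ≡ N
      D≡N = ℕₚ.≤-antisym (maxUpperDegree≤ k)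
        (ℕₚ.≤-trans (ℕₚ.≤-reflexive (sym (trans (upperDegree≡∑ k (ridge K k R₀))
        (trans (Counting.∑-cong λ F → contains-yes k {R₀} {F} (R₀⊆ F)) (Counting.∑-ones N)))))
          (upperDegree≤ k R₀))

      common≡ : ∀ F G → common k F G ≡ 1 + Counting.𝟙 (F Finₚ.≟ G) * k
      common≡ F G with F Finₚ.≟ G
      ... | yes refl = trans (common-diag k o F) (cong suc (sym (ℕₚ.*-identityˡ k)))
      ... | no F≢G = common-off-diag k F≢G (R₀⊆ F) (R₀⊆ G)

      rowSum : ∀ F → ℕ∑ (common k F) ≡ D + k
      rowSum F = trans (Counting.∑-cong (common≡ F))
        (trans (Counting.∑-distrib-+ (λ _ → 1) (λ G → Counting.𝟙 (F Finₚ.≟ G) * k))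
        (cong₂ _+_ (trans (Counting.∑-ones N) (sym D≡N))
          (trans (Counting.∑-single F λ G G≢F → cong (_* k) (Counting.𝟙-no (F Finₚ.≟ G) (G≢F ∘ sym)))
            (trans (cong (_* k) (Counting.𝟙-yes (F Finₚ.≟ F) refl)) (ℕₚ.*-identityˡ k)))))

      columnSum : ∀ G → ∑ (λ F → A F G) ≡ fromℕ (D + k)
      columnSum G = trans (sym (fromℕ-∑ (λ F → common k F G)))
        (cong fromℕ (trans (Counting.∑-cong λ F → common-sym k F G) (rowSum G)))

      one : Fin N → ℝ
      one _ = fromℚ 1ℚ

      residual : ∀ F → Null (λ n → (A · (λ G → seq (one G) n)) F ℚ.- fromℕ (D + k) ℚ.* 1ℚ)
      residual F = null-cong (λ n → trans (cong₂ ℚ._-_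
          (trans (A·fromℕ (λ _ → 1) F) (cong fromℕ
            (trans (Counting.∑-cong λ G → ℕₚ.*-identityʳ (common k F G)) (rowSum F))))
          (ℚₚ.*-identityʳ (fromℕ (D + k)))) (ℚₚ.+-inverseʳ (fromℕ (D + k)))) null-0

      0<N : 1 ≤ N
      0<N = ℕₚ.≤-trans (ℕ.s≤s ℕ.z≤n) (Finₚ.toℕ<n F₀)

      nonzero : 1ℚ ℚ.≤ fromℕ (D + k) ℚ.* ∑ {N} (λ _ → 1ℚ)
      nonzero = ℚₚ.≤-trans (fromℕ-mono {1}
        (ℕₚ.*-mono-≤ (ℕₚ.≤-trans (subst (1 ≤_) (sym D≡N) 0<N) (ℕₚ.m≤m+n D k)) 0<N))
        (ℚₚ.≤-reflexive (trans (fromℕ-* (D + k) N) (cong (ℚ._*_ (fromℕ (D + k)))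
          (trans (cong fromℕ (sym (Counting.∑-ones N))) (fromℕ-∑ {N} (λ _ → 1))))))

    largest : IsLargestEigenvalue (upLaplacianℝ K o k) (fromℤ (ℤ.+ (D + k)))
    largest = S.isEigenvalue one (fromℤ (ℤ.+ (D + k))) residual 0<1 (λ _ → nonzero) ,
      S.eigenvalue-bound (fromℕ (D + k)) (ι-nonneg (D + k)) A≥0 (λ G → ℚₚ.≤-reflexive (columnSum G))

  -- A ridge of maximal degree and the equivalence

  facet-exists : HasDimension K k → Facet K k
  facet-exists ((σ , σ∈K , ∣σ∣) , _) = proj₁ (face-index (suc k) σ∈K ∣σ∣)

  -- The maximum is either attained in the list or equal to its default 0. Any ridge of the given
  -- facet has positive degree, which rules out the default and also provides a facet containing
  -- `R₀`.
  maximal-ridge : Facet K k →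
    ∃ λ R₀ → upperDegree K k (ridge K k R₀) ≡ D × ∃ λ F₀ → ridge K k R₀ ⊆ facet K k F₀
  maximal-ridge F = cases (argmax-sel id 0 (List.map (upperDegree K k) (faces K k)))
    where
    R : Ridge K k
    R = proj₁ (ridge-opposite k o F zero)
    positive : 1 ≤ D
    positive = ℕₚ.≤-trans (ℕₚ.≤-trans
      (ℕₚ.≤-trans (ℕₚ.≤-reflexive (sym (contains-yes k {R} {F} (ridge-opposite-⊆ k o F zero))))
      (Counting.term≤∑ (contains k R) F)) (ℕₚ.≤-reflexive (sym (upperDegree≡∑ k (ridge K k R)))))
        (upperDegree≤ k R)
    cases : D ≡ 0 ⊎ D ∈ₗ List.map (upperDegree K k) (faces K k) → _
    cases (inj₁ D≡0) = contradiction D≡0 (ℕₚ.>⇒≢ positive)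
    cases (inj₂ D∈) with ∈-map⁻ (upperDegree K k) D∈
    ... | ρ , ρ∈ , D≡ = R₀ , degree , covering
      where
      R₀ : Ridge K k
      R₀ = Any.index ρ∈
      degree : upperDegree K k (ridge K k R₀) ≡ D
      degree = trans (cong (upperDegree K k) (sym (Anyₚ.lookup-index ρ∈))) (sym D≡)
      covering : ∃ λ F₀ → ridge K k R₀ ⊆ facet K k F₀
      covering with Finₚ.any? (λ F → ridge K k R₀ Subsetₚ.⊆? facet K k F)
      ... | yes h = h
      ... | no none = contradiction (trans (sym degree) (trans (upperDegree≡∑ k (ridge K k R₀))
        (Counting.∑-zero λ F → contains-no k {R₀} {F} λ h → none (F , λ {x} → h {x})))) (ℕₚ.>⇒≢ positive)

open import Data.Integer.Base using (+_)
open import Data.Nat.Base using (_+_; _≤_)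

corollary4p27 : ∀ {n : ℕ} (K : SimplicialComplex n) (k : ℕ) → 1 ≤ k →
    HasDimension K k → (o : Orientation K) →
    ΓConnected K k → Disorientable K k →
    IsLargestEigenvalue (upLaplacianℝ K o k) (fromℤ (+ (maxUpperDegree K k + k)))
    ⇔ CommonRidge K k
corollary4p27 K k _ dimension o connected (o′ , disoriented) = mk⇔ forward backward
  where
  open Spectrum K k o o′ disoriented
  forward : _ → CommonRidge K k
  forward largest with maximal-ridge (facet-exists dimension)
  -- One decidable question suffices, asked of this one ridge of maximal degree: either it lies in
  -- every facet and is the witness, or a facet missing it yields a larger eigenvalue.
  ... | R₀ , degree , F₀ , R₀⊆F₀ with Finₚ.all? (λ F → ridge K k R₀ Subsetₚ.⊆? facet K k F)
  ... | yes all = R₀ , λ F {x} → all F {x}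
  ... | no ¬all with Finₚ.¬∀⟶∃¬ _ _ (λ F → ridge K k R₀ Subsetₚ.⊆? facet K k F) ¬all
  ... | F₁ , R₀⊈F₁ = contradiction largest (Forward.not-largest R₀ degree connected R₀⊆F₀ R₀⊈F₁)
  backward : CommonRidge K k → _
  backward (R₀ , R₀⊆) = Backward.largest R₀ R₀⊆ (facet-exists dimension)
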